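{- Let $L$ be an even lattice of signature $(2,1)$ with discriminant form $(\mathcal D,q)$. Every (weakly holomorphic) modular form $F=\sum_\gamma F_\gamma\mathfrak e_\gamma$ of weight $1/2$ for the Weil representation $\overline\rho_L$ has components odd under $\gamma\mapsto-\gamma$: $F_{ -\gamma}=-F_\gamma$. Consequently: (i) all coefficients on two-torsion cosets vanish identically, i.e. $F_\mu=0$ whenever $2\mu=0$ in $\mathcal D$; in particular every reflective slot $(\mu,m)$ with $2\mu=0$ is invisible at weight $1/2$; (ii) the only reflective prescriptions available at weight $1/2$ are the odd ones, supported on the non-torsion slot pairs $\{\mu,-\mu\}$ ($2\mu\ne0$) with antisymmetric coefficients.
   Context: $\mathcal D=L^\vee/L$, $q(\gamma)=(\gamma,\gamma)/2\bmod1$, $e(x)=e^{2\pi ix}$. $\mathrm{Mp}_2(\mathbb Z)$ consists of pairs $(A,\varphi)$, $A\in\mathrm{SL}_2(\mathbb Z)$, $\varphi(\tau)^2=c\tau+d$. $\rho_L$ is the representation on $\mathbb C[\mathcal D]$ with $\rho_L(T)\mathfrak e_\gamma=e(q(\gamma))\mathfrak e_\gamma$, $\rho_L(S)\mathfrak e_\gamma=\frac{e(-1/8)}{\sqrt{|\mathcal D|}}\sum_\delta e(-(\gamma,\delta))\mathfrak e_\delta$, where $T=(\left(\begin{smallmatrix}1&1\\0&1\end{smallmatrix}\right),1)$, $S=(\left(\begin{smallmatrix}0&-1\\1&0\end{smallmatrix}\right),\sqrt\tau)$; $\overline\rho_L$ is its complex conjugate, so $\overline\rho_L(T)\mathfrak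 e_\gamma=e(-q(\gamma))\mathfrak e_\gamma$. Modular forms of weight $k$ for $\overline\rho_L$ satisfy $F(A\tau)=\varphi(\tau)^{2k}\overline\rho_L(A,\varphi)F(\tau)$. A root is a primitive $\alpha\in L$ with $\alpha^2>0$ whose reflection preserves $L$; with $\ell>0$ generating the ideal $(\alpha,L)$, its reflective slot is the pair $(\mu,m)=(\alpha/\ell+L,\alpha^2/(2\ell^2))$. A reflective prescription is a principal part $\sum a(\mu,m)q^{ -m}\mathfrak e_\mu$ supported on reflective slots; it is available at weight $1/2$ if it can occur as the principal part of a weight-$1/2$ weakly holomorphic form for $\overline\rho_L$ as far as the parity constraint is concerned, i.e. if it is odd: $a(-\mu,m)=-a(\mu,m)$. -}

module Defs where

open import Data.Fin.Base as Fin using (Fin; toℕ)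
open import Data.Fin.Properties using (all?)
open import Data.Integer.Base as ℤ using (ℤ; +_)
import Data.Integer.Properties as ℤ
open import Data.List.Base using (List)
open import Data.List.Relation.Unary.Any using (Any)
open import Data.Nat.Base as ℕ using (ℕ; zero; suc; _⊔_)
import Data.Nat.Coprimality as Coprime
import Data.Nat.Properties as ℕ
open import Data.Product.Base using (Σ-syntax; ∃-syntax; _×_; _,_)
open import Data.Rational.Base as ℚ using (ℚ; 0ℚ; 1ℚ; ½; _/_; ∣_∣)
  renaming (_+_ to _+ℚ_; _*_ to _*ℚ_; _-_ to _-ℚ_; -_ to -ℚ_; _<_ to _<ℚ_; _≤_ to _≤ℚ_)
import Data.Rational.Properties as ℚ
open import Data.Rational.Solver using (module +-*-Solver)
open import Algebra.Properties.CommutativeMonoid.Sum ℚ.+-0-commutativeMonoid using (sum)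
import Data.Rational.Unnormalised.Base as ℚᵘ
import Data.Rational.Unnormalised.Properties as ℚᵘ
open import Function.Base using (_∘_)
open import Function.Bundles using (Func; Inverse; _⟨$⟩_)
open import Level using (0ℓ)
open import Relation.Binary.Bundles using (Setoid)
open import Relation.Binary.PropositionalEquality as ≡
  using (_≡_; _≢_; refl; sym; trans; cong; cong₂; subst)
open import Relation.Nullary using (¬_; Dec; yes; no; contradiction)
open import Relation.Nullary.Decidable using (map′)

private

  ⊔≤ˡ : ∀ m n {k} → m ⊔ n ℕ.≤ k → m ℕ.≤ k
  ⊔≤ˡ m n = ℕ.m⊔n≤o⇒m≤o m n

  ⊔≤ʳ : ∀ m n {k} → m ⊔ n ℕ.≤ k → n ℕ.≤ k
  ⊔≤ʳ m n = ℕ.m⊔n≤o⇒n≤o m n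

  ⊔⊔≤ : ∀ a b c d {k} → (a ⊔ b) ⊔ (c ⊔ d) ℕ.≤ k →
    (a ℕ.≤ k × b ℕ.≤ k) × (c ℕ.≤ k × d ℕ.≤ k)
  ⊔⊔≤ a b c d h =
    let l = ⊔≤ˡ (a ⊔ b) (c ⊔ d) h
        r = ⊔≤ʳ (a ⊔ b) (c ⊔ d) h
    in (⊔≤ˡ a b l , ⊔≤ʳ a b l) , (⊔≤ˡ c d r , ⊔≤ʳ c d r)

  0<½* : ∀ {ε} → 0ℚ <ℚ ε → 0ℚ <ℚ ½ *ℚ ε
  0<½* {ε} 0<ε = subst (_<ℚ ½ *ℚ ε) (ℚ.*-zeroʳ ½) (ℚ.*-monoʳ-<-pos ½ 0<ε)

  halves : ∀ ε → ½ *ℚ ε +ℚ ½ *ℚ ε ≡ ε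
  halves ε = trans (sym (ℚ.*-distribʳ-+ ε ½ ½)) (ℚ.*-identityˡ ε)

  ∣-∣-comm : ∀ p q → ∣ p -ℚ q ∣ ≡ ∣ q -ℚ p ∣
  ∣-∣-comm p q = trans (sym (ℚ.∣-p∣≡∣p∣ (p -ℚ q)))
    (cong ∣_∣ (solve 2 (λ p q → :- (p :- q) := q :- p) refl p q))
    where open +-*-Solver

  sum-≤ : ∀ {r p q ε} → r ≡ p +ℚ q → ∣ p ∣ ≤ℚ ½ *ℚ ε → ∣ q ∣ ≤ℚ ½ *ℚ ε → ∣ r ∣ ≤ℚ ε
  sum-≤ {p = p} {q} {ε} refl p≤ q≤ =
    ℚ.≤-trans (ℚ.∣p+q∣≤∣p∣+∣q∣ p q) (subst (_ ≤ℚ_) (halves ε) (ℚ.+-mono-≤ p≤ q≤))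

IsCauchy : (ℕ → ℚ) → Set
IsCauchy x = ∀ ε → 0ℚ <ℚ ε →
  ∃[ N ] (∀ m n → N ℕ.≤ m → N ℕ.≤ n → ∣ x m -ℚ x n ∣ ≤ℚ ε)

-- Without eta, conversion checking never compares the moduli.

record ℝ : Set where
  no-eta-equality
  constructor mkℝ
  field
    seq    : ℕ → ℚ
    cauchy : IsCauchy seq

open ℝ

infix 4 _≈ʳ_ _<ʳ_ _≤ʳ_
infixl 6 _+ʳ_
infixl 7 _*ʳ_

record _≈ʳ_ (x y : ℝ) : Set where
  constructor mk≈ʳ
  field
    close : ∀ ε → 0ℚ <ℚ ε → ∃[ N ] (∀ n → N ℕ.≤ n → ∣ seq x n -ℚ seq y n ∣ ≤ℚ ε)

open _≈ʳ_

record _<ʳ_ (x y : ℝ) : Set where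
  constructor mk<ʳ
  field
    gap       : ℚ
    0<gap     : 0ℚ <ℚ gap
    from      : ℕ
    separated : ∀ n → from ℕ.≤ n → seq x n +ℚ gap ≤ℚ seq y n

_≤ʳ_ : ℝ → ℝ → Set
x ≤ʳ y = ¬ (y <ʳ x)

fromℚ : ℚ → ℝ
fromℚ q = mkℝ (λ _ → q) λ ε 0<ε → 0 , λ _ _ _ _ →
  subst (_≤ℚ ε) (cong ∣_∣ (sym (ℚ.+-inverseʳ q))) (ℚ.<⇒≤ 0<ε)

_+ʳ_ : ℝ → ℝ → ℝ
seq (x +ʳ y) n = seq x n +ℚ seq y n
cauchy (x +ʳ y) ε 0<ε =
  let Nx , hx = cauchy x (½ *ℚ ε) (0<½* 0<ε)
      Ny , hy = cauchy y (½ *ℚ ε) (0<½* 0<ε)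
  in Nx ⊔ Ny , λ m n m≥ n≥ → sum-≤
       (solve 4 (λ a b c d → (a :+ b) :- (c :+ d) := (a :- c) :+ (b :- d)) refl
         (seq x m) (seq y m) (seq x n) (seq y n))
       (hx m n (⊔≤ˡ Nx Ny m≥) (⊔≤ˡ Nx Ny n≥)) (hy m n (⊔≤ʳ Nx Ny m≥) (⊔≤ʳ Nx Ny n≥))
  where open +-*-Solver

-ʳ_ : ℝ → ℝ
seq (-ʳ x) n = -ℚ seq x n
cauchy (-ʳ x) ε 0<ε =
  let N , h = cauchy x ε 0<ε
  in N , λ m n m≥ n≥ → subst (_≤ℚ ε)
       (trans (∣-∣-comm (seq x m) (seq x n))
         (cong ∣_∣ (solve 2 (λ a b → b :- a := (:- a) :- (:- b)) refl (seq x m) (seq x n))))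
       (h m n m≥ n≥)
  where open +-*-Solver

private

  eventually-bounded : ∀ x → ∃[ B ] (0ℚ <ℚ B × ∃[ N ] (∀ n → N ℕ.≤ n → ∣ seq x n ∣ ≤ℚ B))
  eventually-bounded x =
    let N , h = cauchy x 1ℚ (ℚ.positive⁻¹ 1ℚ)
    in ∣ seq x N ∣ +ℚ 1ℚ
     , ℚ.+-mono-≤-< (ℚ.0≤∣p∣ (seq x N)) (ℚ.positive⁻¹ 1ℚ)
     , N , λ n n≥ → ℚ.≤-trans
         (subst (λ t → ∣ t ∣ ≤ℚ ∣ seq x N ∣ +ℚ ∣ seq x n -ℚ seq x N ∣)
           (solve 2 (λ a b → a :+ (b :- a) := b) refl (seq x N) (seq x n))
           (ℚ.∣p+q∣≤∣p∣+∣q∣ (seq x N) (seq x n -ℚ seq x N)))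
         (ℚ.+-monoʳ-≤ ∣ seq x N ∣ (h n N n≥ ℕ.≤-refl))
    where open +-*-Solver

  scale : ∀ B ε → 0ℚ <ℚ B → 0ℚ <ℚ ε → ∃[ δ ] (0ℚ <ℚ δ × B *ℚ δ ≡ ε)
  scale B ε 0<B 0<ε = δ , 0<δ , eq
    where
    instance
      posB : ℚ.Positive B
      posB = ℚ.positive 0<B
      nzB : ℚ.NonZero B
      nzB = ℚ.pos⇒nonZero B
      pos1/B : ℚ.Positive (ℚ.1/ B)
      pos1/B = ℚ.1/pos⇒pos B
    δ = (ℚ.1/ B) *ℚ ε
    0<δ : 0ℚ <ℚ δ
    0<δ = subst (_<ℚ δ) (ℚ.*-zeroʳ (ℚ.1/ B)) (ℚ.*-monoʳ-<-pos (ℚ.1/ B) 0<ε)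
    eq : B *ℚ δ ≡ ε
    eq = trans (sym (ℚ.*-assoc B (ℚ.1/ B) ε))
      (trans (cong (_*ℚ ε) (ℚ.*-inverseʳ B)) (ℚ.*-identityˡ ε))

  mul-≤ : ∀ {p q B δ} → 0ℚ <ℚ B → ∣ p ∣ ≤ℚ B → ∣ q ∣ ≤ℚ δ → ∣ p *ℚ q ∣ ≤ℚ B *ℚ δ
  mul-≤ {p} {q} {B} {δ} 0<B p≤ q≤ = subst (_≤ℚ B *ℚ δ) (sym (ℚ.∣p*q∣≡∣p∣*∣q∣ p q))
    (ℚ.≤-trans (ℚ.*-monoʳ-≤-nonNeg ∣ q ∣ {{ℚ.∣-∣-nonNeg q}} p≤)
               (ℚ.*-monoˡ-≤-nonNeg B {{ℚ.pos⇒nonNeg B {{ℚ.positive 0<B}}}} q≤))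

  mul-diff : ∀ {a b c d B C δ δ′ ε} → 0ℚ <ℚ B → 0ℚ <ℚ C →
    ∣ a ∣ ≤ℚ B → ∣ d ∣ ≤ℚ C → ∣ b -ℚ d ∣ ≤ℚ δ → ∣ a -ℚ c ∣ ≤ℚ δ′ →
    B *ℚ δ ≡ ½ *ℚ ε → C *ℚ δ′ ≡ ½ *ℚ ε → ∣ a *ℚ b -ℚ c *ℚ d ∣ ≤ℚ ε
  mul-diff {a} {b} {c} {d} 0<B 0<C a≤ d≤ bd≤ ac≤ eq eq′ = sum-≤
    (solve 4 (λ a b c d → a :* b :- c :* d := a :* (b :- d) :+ d :* (a :- c)) refl a b c d)
    (subst (_ ≤ℚ_) eq (mul-≤ 0<B a≤ bd≤))
    (subst (_ ≤ℚ_) eq′ (mul-≤ 0<C d≤ ac≤))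
    where open +-*-Solver

_*ʳ_ : ℝ → ℝ → ℝ
seq (x *ʳ y) n = seq x n *ℚ seq y n
cauchy (x *ʳ y) ε 0<ε =
  let B , 0<B , K , x≤B = eventually-bounded x
      C , 0<C , M , y≤C = eventually-bounded y
      δ , 0<δ , eq = scale B (½ *ℚ ε) 0<B (0<½* 0<ε)
      δ′ , 0<δ′ , eq′ = scale C (½ *ℚ ε) 0<C (0<½* 0<ε)
      Nx , hx = cauchy x δ′ 0<δ′
      Ny , hy = cauchy y δ 0<δ
  in (K ⊔ M) ⊔ (Nx ⊔ Ny) , λ m n m≥ n≥ →
       let (K≤m , _) , (Nx≤m , Ny≤m) = ⊔⊔≤ K M Nx Ny m≥
           (_ , M≤n) , (Nx≤n , Ny≤n) = ⊔⊔≤ K M Nx Ny n≥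
       in mul-diff 0<B 0<C (x≤B m K≤m) (y≤C n M≤n)
            (hy m n Ny≤m Ny≤n) (hx m n Nx≤m Nx≤n) eq eq′

≈ʳ-refl : ∀ {x} → x ≈ʳ x
close (≈ʳ-refl {x}) ε 0<ε = 0 , λ n _ →
  subst (_≤ℚ ε) (cong ∣_∣ (sym (ℚ.+-inverseʳ (seq x n)))) (ℚ.<⇒≤ 0<ε)

≈ʳ-sym : ∀ {x y} → x ≈ʳ y → y ≈ʳ x
close (≈ʳ-sym {x} {y} p) ε 0<ε = let N , h = close p ε 0<ε in
  N , λ n n≥ → subst (_≤ℚ ε) (∣-∣-comm (seq x n) (seq y n)) (h n n≥)

≈ʳ-trans : ∀ {x y z} → x ≈ʳ y → y ≈ʳ z → x ≈ʳ z
close (≈ʳ-trans {x} {y} {z} p q) ε 0<ε =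
  let N , h = close p (½ *ℚ ε) (0<½* 0<ε)
      M , k = close q (½ *ℚ ε) (0<½* 0<ε)
  in N ⊔ M , λ n n≥ → sum-≤
       (solve 3 (λ a b c → a :- c := (a :- b) :+ (b :- c)) refl (seq x n) (seq y n) (seq z n))
       (h n (⊔≤ˡ N M n≥)) (k n (⊔≤ʳ N M n≥))
  where open +-*-Solver

+ʳ-cong : ∀ {x x′ y y′} → x ≈ʳ x′ → y ≈ʳ y′ → (x +ʳ y) ≈ʳ (x′ +ʳ y′)
close (+ʳ-cong {x} {x′} {y} {y′} p q) ε 0<ε =
  let N , h = close p (½ *ℚ ε) (0<½* 0<ε)
      M , k = close q (½ *ℚ ε) (0<½* 0<ε)
  in N ⊔ M , λ n n≥ → sum-≤
       (solve 4 (λ a b c d → (a :+ b) :- (c :+ d) := (a :- c) :+ (b :- d)) refl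
         (seq x n) (seq y n) (seq x′ n) (seq y′ n))
       (h n (⊔≤ˡ N M n≥)) (k n (⊔≤ʳ N M n≥))
  where open +-*-Solver

-ʳ-cong : ∀ {x y} → x ≈ʳ y → (-ʳ x) ≈ʳ (-ʳ y)
close ( -ʳ-cong {x} {y} p) ε 0<ε = let N , h = close p ε 0<ε in
  N , λ n n≥ → subst (_≤ℚ ε)
    (trans (∣-∣-comm (seq x n) (seq y n))
      (cong ∣_∣ (solve 2 (λ a b → b :- a := (:- a) :- (:- b)) refl (seq x n) (seq y n))))
    (h n n≥)
  where open +-*-Solver

*ʳ-cong : ∀ {x x′ y y′} → x ≈ʳ x′ → y ≈ʳ y′ → (x *ʳ y) ≈ʳ (x′ *ʳ y′)
close (*ʳ-cong {x} {x′} {y} {y′} p q) ε 0<ε =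
  let B , 0<B , K , x≤B = eventually-bounded x
      C , 0<C , M , y≤C = eventually-bounded y′
      δ , 0<δ , eq = scale B (½ *ℚ ε) 0<B (0<½* 0<ε)
      δ′ , 0<δ′ , eq′ = scale C (½ *ℚ ε) 0<C (0<½* 0<ε)
      Nx , hx = close p δ′ 0<δ′
      Ny , hy = close q δ 0<δ
  in (K ⊔ M) ⊔ (Nx ⊔ Ny) , λ n n≥ →
       let (K≤n , M≤n) , (Nx≤n , Ny≤n) = ⊔⊔≤ K M Nx Ny n≥
       in mul-diff 0<B 0<C (x≤B n K≤n) (y≤C n M≤n) (hy n Ny≤n) (hx n Nx≤n) eq eq′

record ℂ : Set where
  constructor _+i_
  field
    Re Im : ℝ

open ℂ

infix 4 _≈_
infixl 6 _+_ _-_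
infixl 7 _*_
infixr 8 _^_
infix 8 -_

record _≈_ (z w : ℂ) : Set where
  constructor mk≈
  field
    Re-≈ : Re z ≈ʳ Re w
    Im-≈ : Im z ≈ʳ Im w

_+_ : ℂ → ℂ → ℂ
z + w = (Re z +ʳ Re w) +i (Im z +ʳ Im w)

-_ : ℂ → ℂ
- z = (-ʳ Re z) +i (-ʳ Im z)

_-_ : ℂ → ℂ → ℂ
z - w = z + (- w)

_*_ : ℂ → ℂ → ℂ
z * w = (Re z *ʳ Re w +ʳ -ʳ (Im z *ʳ Im w)) +i (Re z *ʳ Im w +ʳ Im z *ʳ Re w)

conj : ℂ → ℂ
conj z = Re z +i (-ʳ Im z)

ofℝ : ℝ → ℂ
ofℝ x = x +i fromℚ 0ℚ

ofℚ : ℚ → ℂ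
ofℚ = ofℝ ∘ fromℚ

ofℤ : ℤ → ℂ
ofℤ a = ofℚ (a / 1)

0ℂ 1ℂ 𝐢 : ℂ
0ℂ = ofℚ 0ℚ
1ℂ = ofℚ 1ℚ
𝐢 = fromℚ 0ℚ +i fromℚ 1ℚ

_^_ : ℂ → ℕ → ℂ
z ^ zero = 1ℂ
z ^ suc k = z * z ^ k

∣_∣² : ℂ → ℝ
∣ z ∣² = Re z *ʳ Re z +ʳ Im z *ʳ Im z

ℂₛ : Setoid 0ℓ 0ℓ
ℂₛ = record
  { Carrier = ℂ
  ; _≈_ = _≈_
  ; isEquivalence = record
    { refl = mk≈ ≈ʳ-refl ≈ʳ-refl
    ; sym = λ (mk≈ p q) → mk≈ (≈ʳ-sym p) (≈ʳ-sym q)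
    ; trans = λ (mk≈ p q) (mk≈ p′ q′) → mk≈ (≈ʳ-trans p p′) (≈ʳ-trans q q′)
    }
  }

module ℂ-Setoid = Setoid ℂₛ

+-cong : ∀ {z z′ w w′} → z ≈ z′ → w ≈ w′ → z + w ≈ z′ + w′
+-cong (mk≈ p q) (mk≈ r s) = mk≈ (+ʳ-cong p r) (+ʳ-cong q s)

conj-cong : ∀ {z w} → z ≈ w → conj z ≈ conj w
conj-cong (mk≈ p q) = mk≈ p (-ʳ-cong q)

*-cong : ∀ {z z′ w w′} → z ≈ z′ → w ≈ w′ → z * w ≈ z′ * w′
*-cong (mk≈ p q) (mk≈ r s) = mk≈
  (+ʳ-cong (*ʳ-cong p r) (-ʳ-cong (*ʳ-cong q s)))
  (+ʳ-cong (*ʳ-cong p s) (*ʳ-cong q r))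

-- Distances are compared through squares, so that no real square root is needed.

record _⟶_ (z : ℕ → ℂ) (w : ℂ) : Set where
  constructor mk⟶
  field
    limit : ∀ ε → 0ℚ <ℚ ε →
      ∃[ N ] (∀ n → N ℕ.≤ n → ∣ z n - w ∣² <ʳ fromℚ (ε *ℚ ε))

partialSum : (ℕ → ℂ) → ℕ → ℂ
partialSum z zero = 0ℂ
partialSum z (suc n) = partialSum z n + z n

_SumsTo_ : (ℕ → ℂ) → ℂ → Set
z SumsTo w = partialSum z ⟶ w

expTerm : ℂ → ℕ → ℂ
expTerm z zero = 1ℂ
expTerm z (suc k) = expTerm z k * z * ofℚ (+ 1 / suc k)

-- The exponential function and π.  The fields determine both uniquely:
-- exp is the sum of the exponential series, and π / 2 is the least positive
-- zero of the cosine, minimality being stated as positivity of cos on [0, π / 2).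

record Exponential : Set where
  field
    exp        : ℂ → ℂ
    exp-series : ∀ z → expTerm z SumsTo exp z

  cos : ℝ → ℝ
  cos t = Re (exp (𝐢 * ofℝ t))

  field
    π         : ℝ
    0<π       : fromℚ 0ℚ <ʳ π
    cos-π/2   : cos (fromℚ ½ *ʳ π) ≈ʳ fromℚ 0ℚ
    cos-below : ∀ t → fromℚ 0ℚ ≤ʳ t → t <ʳ fromℚ ½ *ʳ π → fromℚ 0ℚ <ʳ cos t

  e : ℂ → ℂ
  e z = exp (ofℤ (+ 2) * ofℝ π * 𝐢 * z)

record ℍ : Set where
  constructor mkℍ
  field
    point : ℂ
    0<Im  : fromℚ 0ℚ <ʳ Im point

open ℍ public

ℍₛ : Setoid 0ℓ 0ℓ
ℍₛ = record
  { Carrier = ℍ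
  ; _≈_ = λ σ τ → point σ ≈ point τ
  ; isEquivalence = record
    { refl = ℂ-Setoid.refl ; sym = ℂ-Setoid.sym ; trans = ℂ-Setoid.trans }
  }

IsHolomorphic : (ℍ → ℂ) → Set
IsHolomorphic f = ∀ τ → ∃[ f′ ] ∀ ε → 0ℚ <ℚ ε → ∃[ δ ] (0ℚ <ℚ δ ×
  (∀ σ → ∣ point σ - point τ ∣² <ʳ fromℚ (δ *ℚ δ) →
     ∣ (f σ - f τ) - f′ * (point σ - point τ) ∣²
       ≤ʳ fromℚ (ε *ℚ ε) *ʳ ∣ point σ - point τ ∣²))

record SL₂ℤ : Set where
  constructor mkSL₂
  field
    a b c d : ℤ
    det     : a ℤ.* d ℤ.- b ℤ.* c ≡ + 1

-- j A τ = cτ + d, and σ ≐ A · τ says σ = (aτ + b) / (cτ + d).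

j : SL₂ℤ → ℍ → ℂ
j A τ = ofℤ (SL₂ℤ.c A) * point τ + ofℤ (SL₂ℤ.d A)

_≐_·_ : ℍ → SL₂ℤ → ℍ → Set
σ ≐ A · τ = j A τ * point σ ≈ ofℤ (SL₂ℤ.a A) * point τ + ofℤ (SL₂ℤ.b A)

record Mp₂ℤ : Set where
  field
    matrix      : SL₂ℤ
    φ           : Func ℍₛ ℂₛ
    holomorphic : IsHolomorphic (φ ⟨$⟩_)
    φ²          : ∀ τ → (φ ⟨$⟩ τ) ^ 2 ≈ j matrix τ

  open SL₂ℤ matrix public

open Mp₂ℤ using (matrix; φ)

HasEntries : Mp₂ℤ → ℤ → ℤ → ℤ → ℤ → Set
HasEntries M a b c d =
  Mp₂ℤ.a M ≡ a × Mp₂ℤ.b M ≡ b × Mp₂ℤ.c M ≡ c × Mp₂ℤ.d M ≡ d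

_≈ᴹ_ : Mp₂ℤ → Mp₂ℤ → Set
M ≈ᴹ N = HasEntries M (Mp₂ℤ.a N) (Mp₂ℤ.b N) (Mp₂ℤ.c N) (Mp₂ℤ.d N)
       × (∀ τ → φ M ⟨$⟩ τ ≈ φ N ⟨$⟩ τ)

-- The group law (A , φ(τ)) (B , ψ(τ)) = (AB , φ(Bτ) ψ(τ)), as a relation.

record IsProduct (M N P : Mp₂ℤ) : Set where
  private
    module M = Mp₂ℤ M
    module N = Mp₂ℤ N
  field
    entries : HasEntries P
      (M.a ℤ.* N.a ℤ.+ M.b ℤ.* N.c) (M.a ℤ.* N.b ℤ.+ M.b ℤ.* N.d)
      (M.c ℤ.* N.a ℤ.+ M.d ℤ.* N.c) (M.c ℤ.* N.b ℤ.+ M.d ℤ.* N.d)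
    φ-product : ∀ τ σ → σ ≐ N.matrix · τ → φ P ⟨$⟩ τ ≈ (φ M ⟨$⟩ σ) * (φ N ⟨$⟩ τ)

IsIdentity : Mp₂ℤ → Set
IsIdentity M = HasEntries M (+ 1) (+ 0) (+ 0) (+ 1) × (∀ τ → φ M ⟨$⟩ τ ≈ 1ℂ)

IsT : Mp₂ℤ → Set
IsT M = HasEntries M (+ 1) (+ 1) (+ 0) (+ 1) × (∀ τ → φ M ⟨$⟩ τ ≈ 1ℂ)

-- φ(τ)² = τ is part of Mp₂ℤ; the principal branch √τ is the one with positive real part.

IsS : Mp₂ℤ → Set
IsS M = HasEntries M (+ 0) (ℤ.- + 1) (+ 1) (+ 0) × (∀ τ → fromℚ 0ℚ <ʳ Re (φ M ⟨$⟩ τ))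

IsInteger : ℚ → Set
IsInteger r = ∃[ z ] r ≡ z / 1

private

  /1-+ : ∀ m n → m / 1 +ℚ n / 1 ≡ (m ℤ.+ n) / 1
  /1-+ m n = ℚ.toℚᵘ-injective (ℚᵘ.≃-trans (ℚ.toℚᵘ-homo-+ (m / 1) (n / 1))
    (ℚᵘ.≃-trans (ℚᵘ.+-cong (ℚ.toℚᵘ-fromℚᵘ (ℚᵘ.mkℚᵘ m 0)) (ℚ.toℚᵘ-fromℚᵘ (ℚᵘ.mkℚᵘ n 0)))
    (ℚᵘ.≃-trans (ℚᵘ.*≡* (cong (ℤ._* + 1)
      (cong₂ ℤ._+_ (ℤ.*-identityʳ m) (ℤ.*-identityʳ n))))
      (ℚᵘ.≃-sym (ℚ.toℚᵘ-fromℚᵘ (ℚᵘ.mkℚᵘ (m ℤ.+ n) 0))))))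

  /1-neg : ∀ m → -ℚ (m / 1) ≡ (ℤ.- m) / 1
  /1-neg m = ℚ.toℚᵘ-injective (ℚᵘ.≃-trans (ℚ.toℚᵘ-homo‿- (m / 1))
    (ℚᵘ.≃-trans (ℚᵘ.-‿cong (ℚ.toℚᵘ-fromℚᵘ (ℚᵘ.mkℚᵘ m 0)))
      (ℚᵘ.≃-sym (ℚ.toℚᵘ-fromℚᵘ (ℚᵘ.mkℚᵘ (ℤ.- m) 0)))))

integer-0 : IsInteger 0ℚ
integer-0 = + 0 , refl

integer-+ : ∀ {r s} → IsInteger r → IsInteger s → IsInteger (r +ℚ s)
integer-+ (m , refl) (n , refl) = m ℤ.+ n , /1-+ m n

integer-neg : ∀ {r} → IsInteger r → IsInteger (-ℚ r)
integer-neg (m , refl) = ℤ.- m , /1-neg m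

integer? : ∀ r → Dec (IsInteger r)
integer? r = map′ (λ eq → ℚ.↥ r , sym eq) (λ { (z , refl) → cong (_/ 1) (↥-/1 z) }) (ℚ.↥ r / 1 ℚ.≟ r)
  where
  ↥-/1 : ∀ z → ℚ.↥ (z / 1) ≡ z
  ↥-/1 (+ n) = cong ℚ.↥_ (ℚ.normalize-coprime (Coprime.sym (Coprime.1-coprimeTo n)))
  ↥-/1 (ℤ.-[1+ n ]) = cong (λ p → ℚ.↥ (-ℚ p))
    (ℚ.normalize-coprime (Coprime.sym (Coprime.1-coprimeTo (suc n))))

-- A lattice of rank n is ℤⁿ with the bilinear form given by a Gram matrix.

bilinear : ∀ {n} → (Fin n → Fin n → ℤ) → (Fin n → ℚ) → (Fin n → ℚ) → ℚ
bilinear G x y = sum λ i → sum λ k → (G i k / 1) *ℚ (x i *ℚ y k)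

ι : ∀ {n} → (Fin n → ℤ) → Fin n → ℚ
ι x i = x i / 1

record EvenLattice (n : ℕ) : Set where
  field
    gram      : Fin n → Fin n → ℤ
    symmetric : ∀ i k → gram i k ≡ gram k i

  ⟪_,_⟫ : (Fin n → ℚ) → (Fin n → ℚ) → ℚ
  ⟪_,_⟫ = bilinear gram

  field
    even : ∀ (x : Fin n → ℤ) → ∃[ k ] ⟪ ι x , ι x ⟫ ≡ (+ 2 ℤ.* k) / 1

-- Signature (p , q): an orthogonal family of p vectors of positive and q
-- vectors of negative norm.  As p + q is the rank, it is a basis of L ⊗ ℚ.

record HasSignature (p q : ℕ) (L : EvenLattice (p ℕ.+ q)) : Set where
  open EvenLattice L
  field
    basis      : Fin (p ℕ.+ q) → Fin (p ℕ.+ q) → ℤ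
    orthogonal : ∀ i k → i ≢ k → ⟪ ι (basis i) , ι (basis k) ⟫ ≡ 0ℚ
    positive   : ∀ i → toℕ i ℕ.< p → 0ℚ <ℚ ⟪ ι (basis i) , ι (basis i) ⟫
    negative   : ∀ i → p ℕ.≤ toℕ i → ⟪ ι (basis i) , ι (basis i) ⟫ <ℚ 0ℚ

private

  sum-neg : ∀ {n} (x y : Fin n → ℚ) → (∀ i → x i ≡ -ℚ y i) → sum x ≡ -ℚ sum y
  sum-neg {zero} x y h = refl
  sum-neg {suc n} x y h = trans
    (cong₂ _+ℚ_ (h Fin.zero) (sum-neg (x ∘ Fin.suc) (y ∘ Fin.suc) (h ∘ Fin.suc)))
    (sym (ℚ.neg-distrib-+ (y Fin.zero) (sum (y ∘ Fin.suc))))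

  bilinear-neg : ∀ {n} (G : Fin n → Fin n → ℤ) x y →
    bilinear G (-ℚ_ ∘ x) y ≡ -ℚ bilinear G x y
  bilinear-neg G x y = sum-neg _ _ λ i → sum-neg _ _ λ k →
    solve 3 (λ g a b → g :* ((:- a) :* b) := :- (g :* (a :* b))) refl (G i k / 1) (x i) (y k)
    where open +-*-Solver

module Discriminant {n : ℕ} (L : EvenLattice n) where
  open EvenLattice L

  record Dual : Set where
    no-eta-equality
    constructor mkDual
    field
      vec      : Fin n → ℚ
      integral : ∀ (y : Fin n → ℤ) → IsInteger ⟪ vec , ι y ⟫

  open Dual public

  infix 4 _∼_

  record _∼_ (γ δ : Dual) : Set where
    constructor mk∼
    field
      difference : ∀ i → IsInteger (vec γ i -ℚ vec δ i)

  _∼?_ : ∀ γ δ → Dec (γ ∼ δ)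
  γ ∼? δ = map′ mk∼ _∼_.difference (all? λ i → integer? (vec γ i -ℚ vec δ i))

  ∼-refl : ∀ {γ} → γ ∼ γ
  ∼-refl {γ} = mk∼ λ i → subst IsInteger (sym (ℚ.+-inverseʳ (vec γ i))) integer-0

  ∼-sym : ∀ {γ δ} → γ ∼ δ → δ ∼ γ
  ∼-sym {γ} {δ} (mk∼ h) = mk∼ λ i → subst IsInteger
    (solve 2 (λ a b → :- (a :- b) := b :- a) refl (vec γ i) (vec δ i)) (integer-neg (h i))
    where open +-*-Solver

  ∼-trans : ∀ {γ δ η} → γ ∼ δ → δ ∼ η → γ ∼ η
  ∼-trans {γ} {δ} {η} (mk∼ h) (mk∼ k) = mk∼ λ i → subst IsInteger
    (solve 3 (λ a b c → (a :- b) :+ (b :- c) := a :- c) refl (vec γ i) (vec δ i) (vec η i))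
    (integer-+ (h i) (k i))
    where open +-*-Solver

  𝒟 : Setoid 0ℓ 0ℓ
  𝒟 = record
    { Carrier = Dual
    ; _≈_ = _∼_
    ; isEquivalence = record { refl = ∼-refl ; sym = ∼-sym ; trans = ∼-trans }
    }

  neg : Dual → Dual
  vec (neg γ) i = -ℚ vec γ i
  integral (neg γ) y =
    subst IsInteger (sym (bilinear-neg gram (vec γ) (ι y)))
      (integer-neg {⟪ vec γ , ι y ⟫} (integral γ y))

  IsTwoTorsion : Dual → Set
  IsTwoTorsion γ = ∀ i → IsInteger (vec γ i +ℚ vec γ i)

  ⟨_,_⟩ : Dual → Dual → ℚ
  ⟨ γ , δ ⟩ = ⟪ vec γ , vec δ ⟫

  -- A rational representative of the discriminant quadratic form, which is
  -- only ever used modulo 1.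
  q : Dual → ℚ
  q γ = ½ *ℚ ⟨ γ , γ ⟩

  -- ℂ[𝒟], an element being the function of its coordinates.

  ℂ[𝒟] : Set
  ℂ[𝒟] = Func 𝒟 ℂₛ

  infix 4 _≋_
  infixl 6 _⊕_
  infixr 7 _·_

  _≋_ : ℂ[𝒟] → ℂ[𝒟] → Set
  u ≋ v = ∀ γ → u ⟨$⟩ γ ≈ v ⟨$⟩ γ

  ℂ[𝒟]ₛ : Setoid 0ℓ 0ℓ
  ℂ[𝒟]ₛ = record
    { Carrier = ℂ[𝒟]
    ; _≈_ = _≋_
    ; isEquivalence = record
      { refl = λ γ → ℂ-Setoid.refl
      ; sym = λ p γ → ℂ-Setoid.sym (p γ)
      ; trans = λ p r γ → ℂ-Setoid.trans (p γ) (r γ)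
      }
    }

  _⊕_ : ℂ[𝒟] → ℂ[𝒟] → ℂ[𝒟]
  u ⊕ v = record
    { to = λ γ → (u ⟨$⟩ γ) + (v ⟨$⟩ γ)
    ; cong = λ p → +-cong (Func.cong u p) (Func.cong v p)
    }

  _·_ : ℂ → ℂ[𝒟] → ℂ[𝒟]
  z · u = record
    { to = λ γ → z * (u ⟨$⟩ γ)
    ; cong = λ p → *-cong (ℂ-Setoid.refl {z}) (Func.cong u p)
    }

  conjugate : ℂ[𝒟] → ℂ[𝒟]
  conjugate u = record
    { to = λ γ → conj (u ⟨$⟩ γ)
    ; cong = λ p → conj-cong (Func.cong u p)
    }

  𝔢 : Dual → ℂ[𝒟]
  𝔢 γ = record { to = to ; cong = to-cong }
    where
    to : Dual → ℂ
    to δ with γ ∼? δ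
    ... | yes _ = 1ℂ
    ... | no _  = 0ℂ

    to-cong : ∀ {δ η} → δ ∼ η → to δ ≈ to η
    to-cong {δ} {η} δ∼η with γ ∼? δ | γ ∼? η
    ... | yes _ | yes _ = ℂ-Setoid.refl
    ... | no _  | no _  = ℂ-Setoid.refl
    ... | yes p | no ¬p = contradiction (∼-trans p δ∼η) ¬p
    ... | no ¬p | yes p = contradiction (∼-trans p (∼-sym δ∼η)) ¬p

  Vector : Set
  Vector = Fin n → ℤ

  IsPrimitive : Vector → Set
  IsPrimitive α = ∀ (k : ℤ) (β : Vector) → (∀ i → α i ≡ k ℤ.* β i) → ℤ.∣ k ∣ ≡ 1

  -- y is the image x - (2 (x , α) / α²) α of x.
  ReflectionPreservesLattice : Vector → Set
  ReflectionPreservesLattice α = ∀ (x : Vector) → ∃[ y ] ∀ i →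
    ⟪ ι α , ι α ⟫ *ℚ (ι x i -ℚ ι {n} y i) ≡ ((+ 2 / 1) *ℚ ⟪ ι x , ι α ⟫) *ℚ ι α i

  record IsRoot (α : Vector) : Set where
    field
      isPrimitive : IsPrimitive α
      positive    : 0ℚ <ℚ ⟪ ι α , ι α ⟫
      reflection  : ReflectionPreservesLattice α

  record GeneratesIdeal (α : Vector) (ℓ : ℕ) : Set where
    field
      divides  : ∀ (x : Vector) → ∃[ k ] ⟪ ι α , ι x ⟫ ≡ (k ℤ.* + ℓ) / 1
      attained : Σ[ x ∈ Vector ] ⟪ ι α , ι x ⟫ ≡ + ℓ / 1

  record IsReflectiveSlot (μ : Dual) (m : ℚ) : Set where
    field
      α         : Vector
      root      : IsRoot α
      ℓ         : ℕ
      .{{ℓ≢0}}  : ℕ.NonZero ℓ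
      generator : GeneratesIdeal α ℓ
      μ≡α/ℓ     : ∀ i → IsInteger (vec μ i -ℚ α i / ℓ)
      m≡α²/2ℓ²  : (+ (2 ℕ.* ℓ ℕ.* ℓ) / 1) *ℚ m ≡ ⟪ ι α , ι α ⟫

  -- Σ a(μ , m) q⁻ᵐ 𝔢_μ: a finite sum over 𝒟 × ℚ, supported on reflective slots.
  record ReflectivePrescription : Set where
    field
      a       : Dual → ℚ → ℂ
      a-cong  : ∀ {μ ν} m → μ ∼ ν → a μ m ≈ a ν m
      support : List (Dual × ℚ)
      finite  : ∀ μ m → ¬ (a μ m ≈ 0ℂ) →
                Any (λ (ν , r) → μ ∼ ν × m ≡ r) support
      slots   : ∀ μ m → ¬ (a μ m ≈ 0ℂ) → IsReflectiveSlot μ m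

  open ReflectivePrescription

  -- The parity constraint at weight 1/2.
  AvailableAtWeight½ : ReflectivePrescription → Set
  AvailableAtWeight½ P = ∀ μ m → a P (neg μ) m ≈ - a P μ m

  IsNonTorsionSlotPair : Dual → ℚ → Set
  IsNonTorsionSlotPair μ m =
    IsReflectiveSlot μ m × IsReflectiveSlot (neg μ) m × ¬ IsTwoTorsion μ

  SupportedOnNonTorsionPairs : ReflectivePrescription → Set
  SupportedOnNonTorsionPairs P = ∀ μ m → ¬ (a P μ m ≈ 0ℂ) → IsNonTorsionSlotPair μ m

  AntisymmetricOnNonTorsionPairs : ReflectivePrescription → Set
  AntisymmetricOnNonTorsionPairs P =
    ∀ μ m → IsNonTorsionSlotPair μ m → a P (neg μ) m ≈ - a P μ m

module ModularForms (E : Exponential) {n : ℕ} (L : EvenLattice n) where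
  open Exponential E using (e)
  open Discriminant L

  -- The constant e(-1/8) is the one for signature (2 , 1).
  record WeilRepresentation : Set where
    field
      ρ       : Mp₂ℤ → ℂ[𝒟] → ℂ[𝒟]
      ρ-cong  : ∀ {M N} {u v} → M ≈ᴹ N → u ≋ v → ρ M u ≋ ρ N v
      ρ-⊕     : ∀ M u v → ρ M (u ⊕ v) ≋ ρ M u ⊕ ρ M v
      ρ-·     : ∀ M z u → ρ M (z · u) ≋ z · ρ M u
      ρ-id    : ∀ M u → IsIdentity M → ρ M u ≋ u
      ρ-∙     : ∀ M N P u → IsProduct M N P → ρ P u ≋ ρ M (ρ N u)

      T       : Mp₂ℤ
      isT     : IsT T
      ρ-T     : ∀ γ → ρ T (𝔢 γ) ≋ e (ofℚ (q γ)) · 𝔢 γ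

      order   : ℕ
      size    : Inverse (≡.setoid (Fin order)) 𝒟
      1/√∣𝒟∣  : ℝ
      0<1/√   : fromℚ 0ℚ <ʳ 1/√∣𝒟∣
      1/√²    : 1/√∣𝒟∣ *ʳ 1/√∣𝒟∣ *ʳ fromℚ (+ order / 1) ≈ʳ fromℚ 1ℚ
      S       : Mp₂ℤ
      isS     : IsS S
      -- the coordinate of 𝔢_δ on both sides
      ρ-S     : ∀ γ δ → ρ S (𝔢 γ) ⟨$⟩ δ
                  ≈ e (ofℚ (ℤ.- + 1 / 8)) * ofℝ 1/√∣𝒟∣ * e (ofℚ (-ℚ ⟨ γ , δ ⟩))

    ρ̄ : Mp₂ℤ → ℂ[𝒟] → ℂ[𝒟]
    ρ̄ M u = conjugate (ρ M (conjugate u))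

  qTerm : (ℚ → ℂ) → ℚ → ℍ → ℕ → ℂ
  qTerm c r₀ τ k = c (r₀ +ℚ + k / 1) * e (ofℚ (r₀ +ℚ + k / 1) * point τ)

  module _ (W : WeilRepresentation) where
    open WeilRepresentation W using (ρ̄)

    -- F_γ(τ) = Σ_r c(γ , r) e(r τ), the sum being over r ∈ -q(γ) + ℤ with
    -- r ≥ -pole; it may be started at any r₀ ≤ -pole in this class.
    record QExpansion (F : Func ℍₛ ℂ[𝒟]ₛ) : Set where
      field
        coeff      : Dual → ℚ → ℂ
        coeff-cong : ∀ {γ δ} r → γ ∼ δ → coeff γ r ≈ coeff δ r
        exponents  : ∀ γ r → ¬ IsInteger (r +ℚ q γ) → coeff γ r ≈ 0ℂ
        pole       : ℕ
        bounded    : ∀ γ r → r <ℚ -ℚ (+ pole / 1) → coeff γ r ≈ 0ℂ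
        expansion  : ∀ γ r₀ → IsInteger (r₀ +ℚ q γ) → r₀ ≤ℚ -ℚ (+ pole / 1) → ∀ τ →
          qTerm (coeff γ) r₀ τ SumsTo ((F ⟨$⟩ τ) ⟨$⟩ γ)

    -- Weakly holomorphic forms of weight κ / 2 for ρ̄.
    record WeaklyHolomorphicForm (κ : ℕ) : Set where
      field
        F           : Func ℍₛ ℂ[𝒟]ₛ
        holomorphic : ∀ γ → IsHolomorphic (λ τ → (F ⟨$⟩ τ) ⟨$⟩ γ)
        modular     : ∀ M τ σ → σ ≐ matrix M · τ →
                      F ⟨$⟩ σ ≋ ((φ M ⟨$⟩ τ) ^ κ) · ρ̄ M (F ⟨$⟩ τ)
        qExpansion  : QExpansion F

      component : Dual → ℍ → ℂ
      component γ τ = (F ⟨$⟩ τ) ⟨$⟩ γ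

      open QExpansion qExpansion public

    WeightOneHalfForm : Set
    WeightOneHalfForm = WeaklyHolomorphicForm 1

    open WeaklyHolomorphicForm
    open ReflectivePrescription

    InvisibleAtWeight½ : Dual → ℚ → Set
    InvisibleAtWeight½ μ m = ∀ (f : WeightOneHalfForm) → coeff f μ (-ℚ m) ≈ 0ℂ

    _IsPrincipalPartOf_ : ReflectivePrescription → WeightOneHalfForm → Set
    P IsPrincipalPartOf f = ∀ μ m → 0ℚ <ℚ m → coeff f μ (-ℚ m) ≈ a P μ m

{-# OPTIONS --safe #-}

-- The central element Z = (-I , i) = S² of Mp₂(ℤ) fixes every τ, so a form of
-- weight 1/2 satisfies F = i ρ̄(Z) F.  Orthogonality of the characters of 𝒟 in
-- ρ(Z) = ρ(S)² gives ρ(Z) 𝔢_γ = e(-1/4) 𝔢_{-γ}, hence F_{-γ} = - F_γ.  The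
-- pairing on 𝒟 is nondegenerate because ρ(S) is invertible.  The coefficients
-- inherit the parity because a q-expansion is determined by its values: along
-- the powers of a small e(τ), the leading term of a vanishing series dominates.
--
-- Analytically this rests on the addition theorem for the exponential series
-- and on e(1/4) = i.  The sign of sin(π/2) is found by doubling a small angle,
-- at which the sine is positive by its series, while the cosine is positive.

module Submission where

open import Defs
open import Algebra.Bundles using (CommutativeRing)
import Algebra.Properties.CommutativeMonoid.Sum
import Algebra.Properties.Semiring.Sum
import Algebra.Solver.Ring
import Algebra.Solver.Ring.AlmostCommutativeRing as ACR
open import Data.Fin.Base as Fin using (Fin)
open import Data.Fin.Permutation using (Permutation; permutation)
import Data.Fin.Properties as Fin
open import Data.Integer.Base as ℤ using (ℤ; +_)
import Data.Integer.Properties as ℤ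
open import Data.Maybe.Base using (Maybe; just; nothing)
open import Data.Nat.Base as ℕ using (ℕ; zero; suc; _⊔_)
import Data.Nat.Properties as ℕ
open import Data.Product.Base using (∃-syntax; _×_; _,_; proj₁; proj₂)
open import Data.Rational.Base as ℚ using (ℚ; 0ℚ; 1ℚ; ½; _/_; ∣_∣)
  renaming (_+_ to _+ℚ_; _*_ to _*ℚ_; _-_ to _-ℚ_; -_ to -ℚ_; _<_ to _<ℚ_; _≤_ to _≤ℚ_)
import Data.Rational.Properties as ℚ
import Data.Rational.Unnormalised.Base as ℚᵘ
import Data.Rational.Unnormalised.Properties as ℚᵘ
open import Data.Rational.Solver using (module +-*-Solver)
open import Data.Sum.Base using (inj₁; inj₂)
open import Function.Base using (_∘_)
open import Function.Bundles using (Func; Inverse; _⟨$⟩_; _⇔_; mk⇔)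
open import Level using (0ℓ)
open import Relation.Binary.Definitions using (tri<; tri≈; tri>)
open import Relation.Binary.PropositionalEquality
  using (_≡_; _≢_; refl; sym; trans; cong; cong₂; subst)
open import Relation.Nullary using (¬_; Dec; yes; no; contradiction)

-- The commutative ring ℂ

open ℝ
open ℂ
open _≈ʳ_
open _≈_

-- Real numbers are Cauchy sequences of rationals, so their sign cannot be decided, and `exp` and π
-- are known only through the series and the first zero of the cosine. Estimates therefore run
-- through rational bounds on the representing sequences. Division by a complex number, unless it is
-- an exponential with its explicit inverse, becomes the cancellation of a factor whose real or
-- imaginary part is bounded away from 0. This singles out i among the square roots of -1, both for
-- e(1/4) and for the product of the two branches of √τ that occur in S². It also makes 1 - e(r)
-- cancellable for non-integral r, on which the orthogonality of characters rests. The final sign is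
-- i * i: the automorphy factor of Z contributes one i, and e(-1/8)² = -i becomes the other after
-- conjugation. Since prescriptions restrict their support through negated equations, the last part
-- also needs that z ≈ 0 is stable under double negation.

pointwise : ∀ {x y} → (∀ n → seq x n ≡ seq y n) → x ≈ʳ y
close (pointwise {x} {y} h) ε 0<ε = 0 , λ n _ → subst (_≤ℚ ε)
  (cong ∣_∣ (sym (trans (cong (_-ℚ seq y n) (h n)) (ℚ.+-inverseʳ (seq y n))))) (ℚ.<⇒≤ 0<ε)

-- The operations act termwise on representing sequences, so a ring law of ℂ is a pair of identities
-- in ℚ, within reach of the rational solver and free of any ε.
pointwiseℂ : ∀ {z w} → (∀ n → seq (Re z) n ≡ seq (Re w) n) →
  (∀ n → seq (Im z) n ≡ seq (Im w) n) → z ≈ w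
pointwiseℂ p q = mk≈ (pointwise p) (pointwise q)

module _ where
  open +-*-Solver

  +-assoc : ∀ x y z → (x + y) + z ≈ x + (y + z)
  +-assoc x y z = pointwiseℂ
    (λ n → ℚ.+-assoc (seq (Re x) n) (seq (Re y) n) (seq (Re z) n))
    (λ n → ℚ.+-assoc (seq (Im x) n) (seq (Im y) n) (seq (Im z) n))

  +-comm : ∀ x y → x + y ≈ y + x
  +-comm x y = pointwiseℂ
    (λ n → ℚ.+-comm (seq (Re x) n) (seq (Re y) n))
    (λ n → ℚ.+-comm (seq (Im x) n) (seq (Im y) n))

  +-identityˡ : ∀ x → 0ℂ + x ≈ x
  +-identityˡ x = pointwiseℂ
    (λ n → ℚ.+-identityˡ (seq (Re x) n)) (λ n → ℚ.+-identityˡ (seq (Im x) n))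

  +-inverseˡ : ∀ x → - x + x ≈ 0ℂ
  +-inverseˡ x = pointwiseℂ
    (λ n → ℚ.+-inverseˡ (seq (Re x) n)) (λ n → ℚ.+-inverseˡ (seq (Im x) n))

  -‿cong : ∀ {x y} → x ≈ y → - x ≈ - y
  -‿cong (mk≈ p q) = mk≈ (-ʳ-cong p) (-ʳ-cong q)

  *-comm : ∀ x y → x * y ≈ y * x
  *-comm x y = pointwiseℂ
    (λ n → solve 4 (λ a b c d → a :* c :+ :- (b :* d) := c :* a :+ :- (d :* b)) refl
      (seq (Re x) n) (seq (Im x) n) (seq (Re y) n) (seq (Im y) n))
    (λ n → solve 4 (λ a b c d → a :* d :+ b :* c := c :* b :+ d :* a) refl
      (seq (Re x) n) (seq (Im x) n) (seq (Re y) n) (seq (Im y) n))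

  *-assoc : ∀ x y z → (x * y) * z ≈ x * (y * z)
  *-assoc x y z = pointwiseℂ
    (λ n → solve 6 (λ a b c d e f →
        (a :* c :+ :- (b :* d)) :* e :+ :- ((a :* d :+ b :* c) :* f)
        := a :* (c :* e :+ :- (d :* f)) :+ :- (b :* (c :* f :+ d :* e))) refl
      (seq (Re x) n) (seq (Im x) n) (seq (Re y) n) (seq (Im y) n) (seq (Re z) n) (seq (Im z) n))
    (λ n → solve 6 (λ a b c d e f →
        (a :* c :+ :- (b :* d)) :* f :+ (a :* d :+ b :* c) :* e
        := a :* (c :* f :+ d :* e) :+ b :* (c :* e :+ :- (d :* f))) refl
      (seq (Re x) n) (seq (Im x) n) (seq (Re y) n) (seq (Im y) n) (seq (Re z) n) (seq (Im z) n))

  *-identityˡ : ∀ x → 1ℂ * x ≈ x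
  *-identityˡ x = pointwiseℂ
    (λ n → solve 2 (λ a b → con 1ℚ :* a :+ :- (con 0ℚ :* b) := a) refl (seq (Re x) n) (seq (Im x) n))
    (λ n → solve 2 (λ a b → con 1ℚ :* b :+ con 0ℚ :* a := b) refl (seq (Re x) n) (seq (Im x) n))

  *-distribʳ-+ : ∀ z x y → (x + y) * z ≈ x * z + y * z
  *-distribʳ-+ z x y = pointwiseℂ
    (λ n → solve 6 (λ a b c d e f →
        (a :+ c) :* e :+ :- ((b :+ d) :* f) := (a :* e :+ :- (b :* f)) :+ (c :* e :+ :- (d :* f))) refl
      (seq (Re x) n) (seq (Im x) n) (seq (Re y) n) (seq (Im y) n) (seq (Re z) n) (seq (Im z) n))
    (λ n → solve 6 (λ a b c d e f →
        (a :+ c) :* f :+ (b :+ d) :* e := (a :* f :+ b :* e) :+ (c :* f :+ d :* e)) refl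
      (seq (Re x) n) (seq (Im x) n) (seq (Re y) n) (seq (Im y) n) (seq (Re z) n) (seq (Im z) n))

module ≈ = ℂ-Setoid

ℂ-commutativeRing : CommutativeRing 0ℓ 0ℓ
ℂ-commutativeRing = record
  { Carrier = ℂ ; _≈_ = _≈_ ; _+_ = _+_ ; _*_ = _*_ ; -_ = -_ ; 0# = 0ℂ ; 1# = 1ℂ
  ; isCommutativeRing = record
    { isRing = record
      { +-isAbelianGroup = record
        { isGroup = record
          { isMonoid = record
            { isSemigroup = record
              { isMagma = record { isEquivalence = ≈.isEquivalence ; ∙-cong = +-cong }
              ; assoc = +-assoc }
            ; identity = +-identityˡ , λ x → ≈.trans (+-comm x 0ℂ) (+-identityˡ x) }
          ; inverse = +-inverseˡ , λ x → ≈.trans (+-comm x (- x)) (+-inverseˡ x)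
          ; ⁻¹-cong = -‿cong }
        ; comm = +-comm }
      ; *-cong = *-cong
      ; *-assoc = *-assoc
      ; *-identity = *-identityˡ , λ x → ≈.trans (*-comm x 1ℂ) (*-identityˡ x)
      ; distrib = (λ x y z → ≈.trans (*-comm x (y + z)) (≈.trans (*-distribʳ-+ x y z)
                    (+-cong (*-comm y x) (*-comm z x)))) , *-distribʳ-+ }
    ; *-comm = *-comm }
  }

ofℚ-+ : ∀ p q → ofℚ (p +ℚ q) ≈ ofℚ p + ofℚ q
ofℚ-+ p q = pointwiseℂ (λ _ → refl) (λ _ → refl)

ofℚ-* : ∀ p q → ofℚ (p *ℚ q) ≈ ofℚ p * ofℚ q
ofℚ-* p q = pointwiseℂ
  (λ _ → solve 2 (λ p q → p :* q := p :* q :+ :- (con 0ℚ :* con 0ℚ)) refl p q)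
  (λ _ → solve 2 (λ p q → con 0ℚ := p :* con 0ℚ :+ con 0ℚ :* q) refl p q)
  where open +-*-Solver

ofℚ-neg : ∀ p → ofℚ (-ℚ p) ≈ - ofℚ p
ofℚ-neg p = pointwiseℂ (λ _ → refl) (λ _ → refl)

ofℚ-cong : ∀ {p q} → p ≡ q → ofℚ p ≈ ofℚ q
ofℚ-cong refl = ≈.refl

-- ℂ is a ℚ-algebra, so the ring solver can compute with rational coefficients.

private
  ℂ-almost : ACR.AlmostCommutativeRing 0ℓ 0ℓ
  ℂ-almost = ACR.fromCommutativeRing ℂ-commutativeRing

  ℚ⟶ℂ : ℚ.+-*-rawRing ACR.-Raw-AlmostCommutative⟶ ℂ-almost
  ℚ⟶ℂ = record
    { ⟦_⟧ = ofℚ ; +-homo = ofℚ-+ ; *-homo = ofℚ-* ; -‿homo = ofℚ-neg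
    ; 0-homo = ≈.refl ; 1-homo = ≈.refl }

  _ofℚ≟_ : ∀ p q → Maybe (ofℚ p ≈ ofℚ q)
  p ofℚ≟ q with p ℚ.≟ q
  ... | yes refl = just ≈.refl
  ... | no _     = nothing

module ℂ-Solver = Algebra.Solver.Ring ℚ.+-*-rawRing ℂ-almost ℚ⟶ℂ _ofℚ≟_

-- Rational bounds for the ℓ¹ norm

≤-by : ∀ {p q} d → 0ℚ ≤ℚ d → p +ℚ d ≡ q → p ≤ℚ q
≤-by {p} d 0≤d refl = subst (_≤ℚ p +ℚ d) (ℚ.+-identityʳ p) (ℚ.+-monoʳ-≤ p 0≤d)

<-by : ∀ {p q} d → 0ℚ <ℚ d → p +ℚ d ≡ q → p <ℚ q
<-by {p} d 0<d refl = subst (_<ℚ p +ℚ d) (ℚ.+-identityʳ p) (ℚ.+-monoʳ-< p 0<d)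

≤⇒0≤- : ∀ {p q} → p ≤ℚ q → 0ℚ ≤ℚ q -ℚ p
≤⇒0≤- {p} {q} p≤q = subst (_≤ℚ q -ℚ p) (ℚ.+-inverseʳ p) (ℚ.+-monoˡ-≤ (-ℚ p) p≤q)

<⇒0<- : ∀ {p q} → p <ℚ q → 0ℚ <ℚ q -ℚ p
<⇒0<- {p} {q} p<q = subst (_<ℚ q -ℚ p) (ℚ.+-inverseʳ p) (ℚ.+-monoˡ-< (-ℚ p) p<q)

0≤+ : ∀ {p q} → 0ℚ ≤ℚ p → 0ℚ ≤ℚ q → 0ℚ ≤ℚ p +ℚ q
0≤+ = ℚ.+-mono-≤

0<+ : ∀ {p q} → 0ℚ <ℚ p → 0ℚ ≤ℚ q → 0ℚ <ℚ p +ℚ q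
0<+ = ℚ.+-mono-<-≤

0≤* : ∀ {p q} → 0ℚ ≤ℚ p → 0ℚ ≤ℚ q → 0ℚ ≤ℚ p *ℚ q
0≤* {p} {q} 0≤p 0≤q = subst (_≤ℚ p *ℚ q) (ℚ.*-zeroʳ p)
  (ℚ.*-monoˡ-≤-nonNeg p {{ℚ.nonNegative 0≤p}} 0≤q)

0<* : ∀ {p q} → 0ℚ <ℚ p → 0ℚ <ℚ q → 0ℚ <ℚ p *ℚ q
0<* {p} {q} 0<p 0<q = subst (_<ℚ p *ℚ q) (ℚ.*-zeroʳ p)
  (ℚ.*-monoʳ-<-pos p {{ℚ.positive 0<p}} 0<q)

*-mono-≤ : ∀ {p q r s} → 0ℚ ≤ℚ p → 0ℚ ≤ℚ s → p ≤ℚ q → r ≤ℚ s → p *ℚ r ≤ℚ q *ℚ s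
*-mono-≤ {p} {q} {r} {s} 0≤p 0≤s p≤q r≤s = ℚ.≤-trans
  (ℚ.*-monoˡ-≤-nonNeg p {{ℚ.nonNegative 0≤p}} r≤s)
  (ℚ.*-monoʳ-≤-nonNeg s {{ℚ.nonNegative 0≤s}} p≤q)

0<½ : 0ℚ <ℚ ½
0<½ = ℚ.positive⁻¹ ½

0<1 : 0ℚ <ℚ 1ℚ
0<1 = ℚ.positive⁻¹ 1ℚ

½+½ : ∀ ε → ½ *ℚ ε +ℚ ½ *ℚ ε ≡ ε
½+½ = solve 1 (λ ε → con ½ :* ε :+ con ½ :* ε := ε) refl
  where open +-*-Solver

p≤∣p∣ : ∀ p → p ≤ℚ ∣ p ∣
p≤∣p∣ p with ℚ.≤-total 0ℚ p
... | inj₁ 0≤p = ℚ.≤-reflexive (sym (ℚ.0≤p⇒∣p∣≡p 0≤p))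
... | inj₂ p≤0 = ℚ.≤-trans p≤0 (ℚ.0≤∣p∣ p)

-p≤∣p∣ : ∀ p → -ℚ p ≤ℚ ∣ p ∣
-p≤∣p∣ p = subst (-ℚ p ≤ℚ_) (ℚ.∣-p∣≡∣p∣ p) (p≤∣p∣ (-ℚ p))

0<⇒∃quotient : ∀ {b} ε → 0ℚ <ℚ b → 0ℚ <ℚ ε → ∃[ δ ] (0ℚ <ℚ δ × b *ℚ δ ≡ ε)
0<⇒∃quotient {b} ε 0<b 0<ε = 1/b *ℚ ε , 0<* 0<1/b 0<ε ,
  trans (sym (ℚ.*-assoc b 1/b ε)) (trans (cong (_*ℚ ε) (ℚ.*-inverseʳ b)) (ℚ.*-identityˡ ε))
  where
  instance
    positive-b : ℚ.Positive b
    positive-b = ℚ.positive 0<b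
    nonZero-b : ℚ.NonZero b
    nonZero-b = ℚ.pos⇒nonZero b
  1/b : ℚ
  1/b = ℚ.1/ b
  0<1/b : 0ℚ <ℚ 1/b
  0<1/b = ℚ.positive⁻¹ 1/b {{ℚ.1/pos⇒pos b}}

≤-from-+ε : ∀ {p q} → (∀ ε → 0ℚ <ℚ ε → p ≤ℚ q +ℚ ε) → p ≤ℚ q
≤-from-+ε {p} {q} h with p ℚ.≤? q
... | yes p≤q = p≤q
... | no p≰q = contradiction (ℚ.<-≤-trans lower (h ε 0<ε)) (ℚ.<-irrefl refl)
  where
  open +-*-Solver
  0<p-q : 0ℚ <ℚ p -ℚ q
  0<p-q = <⇒0<- (ℚ.≰⇒> p≰q)
  ε : ℚ
  ε = ½ *ℚ (p -ℚ q)
  0<ε : 0ℚ <ℚ ε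
  0<ε = 0<* 0<½ 0<p-q
  lower : q +ℚ ε <ℚ p
  lower = <-by ε 0<ε (solve 2 (λ p q →
    q :+ con ½ :* (p :- q) :+ con ½ :* (p :- q) := p) refl p q)

size₁ : ℂ → ℕ → ℚ
size₁ z n = ∣ seq (Re z) n ∣ +ℚ ∣ seq (Im z) n ∣

0≤size₁ : ∀ z n → 0ℚ ≤ℚ size₁ z n
0≤size₁ z n = 0≤+ (ℚ.0≤∣p∣ (seq (Re z) n)) (ℚ.0≤∣p∣ (seq (Im z) n))

∣Re∣≤size₁ : ∀ z n → ∣ seq (Re z) n ∣ ≤ℚ size₁ z n
∣Re∣≤size₁ z n = ≤-by (∣ seq (Im z) n ∣) (ℚ.0≤∣p∣ (seq (Im z) n)) refl

∣Im∣≤size₁ : ∀ z n → ∣ seq (Im z) n ∣ ≤ℚ size₁ z n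
∣Im∣≤size₁ z n = ≤-by (∣ seq (Re z) n ∣) (ℚ.0≤∣p∣ (seq (Re z) n)) (ℚ.+-comm (∣ seq (Im z) n ∣) _)

-- Rational upper bounds for the ℓ¹ norm |Re z| + |Im z|, which is
-- submultiplicative and needs no square root.

infix 4 ∥_∥≤_

record ∥_∥≤_ (z : ℂ) (q : ℚ) : Set where
  constructor mk∥≤
  field
    eventually : ∀ ε → 0ℚ <ℚ ε → ∃[ N ] (∀ n → N ℕ.≤ n → size₁ z n ≤ℚ q +ℚ ε)

open ∥_∥≤_ public

∥∥-≤ : ∀ {z q} N → (∀ n → N ℕ.≤ n → size₁ z n ≤ℚ q) → ∥ z ∥≤ q
eventually (∥∥-≤ N h) ε 0<ε = N , λ n n≥ → ℚ.≤-trans (h n n≥) (≤-by ε (ℚ.<⇒≤ 0<ε) refl)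

∥∥-nonNeg : ∀ {z q} → ∥ z ∥≤ q → 0ℚ ≤ℚ q
∥∥-nonNeg {z} (mk∥≤ h) = ≤-from-+ε λ ε 0<ε → let N , hN = h ε 0<ε in
  ℚ.≤-trans (0≤size₁ z N) (hN N ℕ.≤-refl)

∥∥-mono : ∀ {z p q} → p ≤ℚ q → ∥ z ∥≤ p → ∥ z ∥≤ q
eventually (∥∥-mono p≤q (mk∥≤ h)) ε 0<ε = let N , hN = h ε 0<ε in
  N , λ n n≥ → ℚ.≤-trans (hN n n≥) (ℚ.+-monoˡ-≤ ε p≤q)

-- The slack built into the bound makes it a closed condition; this is what lets bounds pass to
-- limits.
∥∥-from-ε : ∀ {z q} → (∀ ε → 0ℚ <ℚ ε → ∥ z ∥≤ q +ℚ ε) → ∥ z ∥≤ q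
eventually (∥∥-from-ε {z} {q} h) ε 0<ε =
  let N , hN = eventually (h (½ *ℚ ε) (0<* 0<½ 0<ε)) (½ *ℚ ε) (0<* 0<½ 0<ε)
  in N , λ n n≥ → subst (size₁ z n ≤ℚ_)
       (trans (ℚ.+-assoc q _ _) (cong (q +ℚ_) (½+½ ε))) (hN n n≥)

private
  triangle : ∀ a b c d → ∣ a +ℚ c ∣ +ℚ ∣ b +ℚ d ∣ ≤ℚ (∣ a ∣ +ℚ ∣ b ∣) +ℚ (∣ c ∣ +ℚ ∣ d ∣)
  triangle a b c d = ℚ.≤-trans (ℚ.+-mono-≤ (ℚ.∣p+q∣≤∣p∣+∣q∣ a c) (ℚ.∣p+q∣≤∣p∣+∣q∣ b d))
    (ℚ.≤-reflexive (solve 4 (λ a b c d → (a :+ c) :+ (b :+ d) := (a :+ b) :+ (c :+ d)) refl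
      (∣ a ∣) (∣ b ∣) (∣ c ∣) (∣ d ∣)))
    where open +-*-Solver

∥∥-+ : ∀ {z w p q} → ∥ z ∥≤ p → ∥ w ∥≤ q → ∥ z + w ∥≤ p +ℚ q
eventually (∥∥-+ {z} {w} {p} {q} (mk∥≤ h) (mk∥≤ k)) ε 0<ε =
  let N , hN = h (½ *ℚ ε) (0<* 0<½ 0<ε)
      M , kM = k (½ *ℚ ε) (0<* 0<½ 0<ε)
  in N ⊔ M , λ n n≥ → ℚ.≤-trans
       (triangle (seq (Re z) n) (seq (Im z) n) (seq (Re w) n) (seq (Im w) n))
       (ℚ.≤-trans
         (ℚ.+-mono-≤ (hN n (ℕ.m⊔n≤o⇒m≤o N M n≥)) (kM n (ℕ.m⊔n≤o⇒n≤o N M n≥)))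
         (ℚ.≤-reflexive (solve 3 (λ p q ε →
           (p :+ con ½ :* ε) :+ (q :+ con ½ :* ε) := (p :+ q) :+ ε) refl p q ε)))
  where open +-*-Solver

∥∥-cong : ∀ {z w q} → z ≈ w → ∥ z ∥≤ q → ∥ w ∥≤ q
eventually (∥∥-cong {z} {w} {q} z≈w (mk∥≤ h)) ε 0<ε =
  let N , hN = h (½ *ℚ ε) (0<* 0<½ 0<ε)
      K , hK = close (Re-≈ z≈w) (½ *ℚ (½ *ℚ ε)) 0<¼ε
      M , hM = close (Im-≈ z≈w) (½ *ℚ (½ *ℚ ε)) 0<¼ε
  in N ⊔ (K ⊔ M) , λ n n≥ →
       let KM≤n = ℕ.m⊔n≤o⇒n≤o N (K ⊔ M) n≥
       in ℚ.≤-trans (ℚ.+-mono-≤ (shift (seq (Re z) n) (seq (Re w) n)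
                                  (hK n (ℕ.m⊔n≤o⇒m≤o K M KM≤n)))
                                (shift (seq (Im z) n) (seq (Im w) n)
                                  (hM n (ℕ.m⊔n≤o⇒n≤o K M KM≤n))))
          (ℚ.≤-trans (ℚ.≤-reflexive (solve 3 (λ a b ε →
             (a :+ con ½ :* (con ½ :* ε)) :+ (b :+ con ½ :* (con ½ :* ε)) := (a :+ b) :+ con ½ :* ε)
             refl (∣ seq (Re z) n ∣) (∣ seq (Im z) n ∣) ε))
          (ℚ.≤-trans (ℚ.+-monoˡ-≤ (½ *ℚ ε) (hN n (ℕ.m⊔n≤o⇒m≤o N (K ⊔ M) n≥)))
            (ℚ.≤-reflexive (trans (ℚ.+-assoc q _ _) (cong (q +ℚ_) (½+½ ε))))))
  where
  open +-*-Solver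
  0<¼ε : 0ℚ <ℚ ½ *ℚ (½ *ℚ ε)
  0<¼ε = 0<* 0<½ (0<* 0<½ 0<ε)
  shift : ∀ a b {δ} → ∣ a -ℚ b ∣ ≤ℚ δ → ∣ b ∣ ≤ℚ ∣ a ∣ +ℚ δ
  shift a b {δ} a-b≤δ = ℚ.≤-trans
    (subst (λ t → ∣ t ∣ ≤ℚ ∣ a ∣ +ℚ ∣ a -ℚ b ∣)
      (solve 2 (λ a b → a :- (a :- b) := b) refl a b)
      (ℚ.∣p-q∣≤∣p∣+∣q∣ a (a -ℚ b)))
    (ℚ.+-monoʳ-≤ ∣ a ∣ a-b≤δ)

∥∥-* : ∀ {z w p q} → ∥ z ∥≤ p → ∥ w ∥≤ q → ∥ z * w ∥≤ p *ℚ q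
eventually (∥∥-* {z} {w} {p} {q} ∥z∥ ∥w∥) ε 0<ε =
  let N , hN = eventually ∥z∥ δ 0<δ
      M , kM = eventually ∥w∥ δ 0<δ
  in N ⊔ M , λ n n≥ → ℚ.≤-trans
       (product (seq (Re z) n) (seq (Im z) n) (seq (Re w) n) (seq (Im w) n))
       (ℚ.≤-trans
         (*-mono-≤ (0≤size₁ z n) (0≤+ 0≤q (ℚ.<⇒≤ 0<δ))
           (hN n (ℕ.m⊔n≤o⇒m≤o N M n≥)) (kM n (ℕ.m⊔n≤o⇒n≤o N M n≥)))
         bound)
  where
  open +-*-Solver
  0≤p : 0ℚ ≤ℚ p
  0≤p = ∥∥-nonNeg ∥z∥
  0≤q : 0ℚ ≤ℚ q
  0≤q = ∥∥-nonNeg ∥w∥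
  quotient : ∃[ δ ] (0ℚ <ℚ δ × (1ℚ +ℚ (p +ℚ q +ℚ ε)) *ℚ δ ≡ ε)
  quotient = 0<⇒∃quotient ε (0<+ 0<1 (0≤+ (0≤+ 0≤p 0≤q) (ℚ.<⇒≤ 0<ε))) 0<ε
  δ : ℚ
  δ = proj₁ quotient
  0<δ : 0ℚ <ℚ δ
  0<δ = proj₁ (proj₂ quotient)
  bound : (p +ℚ δ) *ℚ (q +ℚ δ) ≤ℚ p *ℚ q +ℚ ε
  -- The exact slack is δ (1 + ε - δ), and ε - δ = δ (p + q + ε) by the choice of δ; the summands 1
  -- and ε in the denominator of δ serve to make this nonnegative.
  bound = ≤-by (δ *ℚ (1ℚ +ℚ δ *ℚ (p +ℚ q +ℚ ε)))
    (0≤* (ℚ.<⇒≤ 0<δ) (0≤+ (ℚ.<⇒≤ 0<1) (0≤* (ℚ.<⇒≤ 0<δ) (0≤+ (0≤+ 0≤p 0≤q) (ℚ.<⇒≤ 0<ε)))))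
    (trans (solve 4 (λ p q ε δ →
       (p :+ δ) :* (q :+ δ) :+ δ :* (con 1ℚ :+ δ :* (p :+ q :+ ε))
       := p :* q :+ (con 1ℚ :+ (p :+ q :+ ε)) :* δ
          :+ δ :* (δ :* (con 1ℚ :+ (p :+ q :+ ε)) :- ε)) refl p q ε δ)
     (trans (cong (λ t → p *ℚ q +ℚ t +ℚ δ *ℚ (δ *ℚ (1ℚ +ℚ (p +ℚ q +ℚ ε)) -ℚ ε))
              (proj₂ (proj₂ quotient)))
     (trans (cong (λ t → p *ℚ q +ℚ ε +ℚ δ *ℚ (t -ℚ ε))
              (trans (ℚ.*-comm δ _) (proj₂ (proj₂ quotient))))
       (solve 4 (λ p q ε δ → p :* q :+ ε :+ δ :* (ε :- ε) := p :* q :+ ε) refl p q ε δ))))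
  product : ∀ a b c d →
    ∣ a *ℚ c +ℚ -ℚ (b *ℚ d) ∣ +ℚ ∣ a *ℚ d +ℚ b *ℚ c ∣ ≤ℚ (∣ a ∣ +ℚ ∣ b ∣) *ℚ (∣ c ∣ +ℚ ∣ d ∣)
  product a b c d = ℚ.≤-trans (triangle (a *ℚ c) (a *ℚ d) (-ℚ (b *ℚ d)) (b *ℚ c))
    (ℚ.≤-reflexive (trans
      (cong₂ _+ℚ_ (cong₂ _+ℚ_ (ℚ.∣p*q∣≡∣p∣*∣q∣ a c) (ℚ.∣p*q∣≡∣p∣*∣q∣ a d))
        (cong₂ _+ℚ_ (trans (ℚ.∣-p∣≡∣p∣ (b *ℚ d)) (ℚ.∣p*q∣≡∣p∣*∣q∣ b d)) (ℚ.∣p*q∣≡∣p∣*∣q∣ b c)))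
      (solve 4 (λ a b c d → (a :* c :+ a :* d) :+ (b :* d :+ b :* c) := (a :+ b) :* (c :+ d)) refl
        (∣ a ∣) (∣ b ∣) (∣ c ∣) (∣ d ∣))))

∥∥-neg : ∀ {z q} → ∥ z ∥≤ q → ∥ - z ∥≤ q
eventually (∥∥-neg {z} {q} (mk∥≤ h)) ε 0<ε = let N , hN = h ε 0<ε in
  N , λ n n≥ → subst (_≤ℚ q +ℚ ε)
    (sym (cong₂ _+ℚ_ (ℚ.∣-p∣≡∣p∣ (seq (Re z) n)) (ℚ.∣-p∣≡∣p∣ (seq (Im z) n)))) (hN n n≥)

∥∥-- : ∀ {z w p q} → ∥ z ∥≤ p → ∥ w ∥≤ q → ∥ z - w ∥≤ p +ℚ q
∥∥-- h k = ∥∥-+ h (∥∥-neg k)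

∥∥-conj : ∀ {z q} → ∥ z ∥≤ q → ∥ conj z ∥≤ q
eventually (∥∥-conj {z} {q} (mk∥≤ h)) ε 0<ε = let N , hN = h ε 0<ε in
  N , λ n n≥ → subst (_≤ℚ q +ℚ ε)
    (cong (∣ seq (Re z) n ∣ +ℚ_) (sym (ℚ.∣-p∣≡∣p∣ (seq (Im z) n)))) (hN n n≥)

∥ofℚ∥ : ∀ {q} → 0ℚ ≤ℚ q → ∥ ofℚ q ∥≤ q
∥ofℚ∥ {q} 0≤q = ∥∥-≤ 0 λ n _ → ℚ.≤-reflexive
  (trans (ℚ.+-identityʳ ∣ q ∣) (ℚ.0≤p⇒∣p∣≡p 0≤q))

private
  seq-bounded : ∀ x → ∃[ B ] ∃[ N ] (∀ n → N ℕ.≤ n → ∣ seq x n ∣ ≤ℚ B)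
  seq-bounded x = let N , h = cauchy x 1ℚ 0<1 in
    ∣ seq x N ∣ +ℚ 1ℚ , N , λ n n≥ → ℚ.≤-trans
      (subst (λ t → ∣ t ∣ ≤ℚ ∣ seq x N ∣ +ℚ ∣ seq x n -ℚ seq x N ∣)
        (solve 2 (λ a b → a :+ (b :- a) := b) refl (seq x N) (seq x n))
        (ℚ.∣p+q∣≤∣p∣+∣q∣ (seq x N) (seq x n -ℚ seq x N)))
      (ℚ.+-monoʳ-≤ ∣ seq x N ∣ (h n N n≥ ℕ.≤-refl))
    where open +-*-Solver

∥∥-bounded : ∀ z → ∃[ q ] ∥ z ∥≤ q
∥∥-bounded z =
  let B , N , h = seq-bounded (Re z)
      C , M , k = seq-bounded (Im z)
  in B +ℚ C , ∥∥-≤ (N ⊔ M) λ n n≥ →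
       ℚ.+-mono-≤ (h n (ℕ.m⊔n≤o⇒m≤o N M n≥)) (k n (ℕ.m⊔n≤o⇒n≤o N M n≥))

∥∥≤0⇒≈ : ∀ {z w} → ∥ z - w ∥≤ 0ℚ → z ≈ w
∥∥≤0⇒≈ {z} {w} (mk∥≤ h) = mk≈
  (mk≈ʳ λ ε 0<ε → let N , hN = h ε 0<ε in N , λ n n≥ →
    ℚ.≤-trans (∣Re∣≤size₁ (z - w) n) (subst (size₁ (z - w) n ≤ℚ_) (ℚ.+-identityˡ ε) (hN n n≥)))
  (mk≈ʳ λ ε 0<ε → let N , hN = h ε 0<ε in N , λ n n≥ →
    ℚ.≤-trans (∣Im∣≤size₁ (z - w) n) (subst (size₁ (z - w) n ≤ℚ_) (ℚ.+-identityˡ ε) (hN n n≥)))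

≈⇒∥∥≤0 : ∀ {z w} → z ≈ w → ∥ z - w ∥≤ 0ℚ
≈⇒∥∥≤0 {z} {w} z≈w = ∥∥-cong
  (≈.trans (≈.sym (CommutativeRing.-‿inverseʳ ℂ-commutativeRing z)) (+-cong ≈.refl (-‿cong z≈w)))
  (∥ofℚ∥ ℚ.≤-refl)

-- Limits

record Lim (z : ℕ → ℂ) (w : ℂ) : Set where
  constructor mkLim
  field
    within : ∀ ε → 0ℚ <ℚ ε → ∃[ N ] (∀ n → N ℕ.≤ n → ∥ z n - w ∥≤ ε)

open Lim public

-- From a² + b² < (ε/2)² both |a| and |b| are at most ε/2, hence the ℓ¹ norm is at most ε.
-- Comparison of rationals is decidable, so `root` argues by contradiction and extracts no square
-- root.
⟶⇒Lim : ∀ {z w} → z ⟶ w → Lim z w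
within (⟶⇒Lim {z} {w} h) ε 0<ε =
  let N , hN = _⟶_.limit h (½ *ℚ ε) (0<* 0<½ 0<ε) in
  N , λ n n≥ → let open _<ʳ_ (hN n n≥) in
    ∥∥-≤ from λ m m≥ → subst (size₁ (z n - w) m ≤ℚ_) (½+½ ε)
      (ℚ.+-mono-≤
        (root (seq (Re (z n - w)) m) (seq (Im (z n - w)) m) (gap) (separated m m≥) 0<gap)
        (root (seq (Im (z n - w)) m) (seq (Re (z n - w)) m) gap
          (subst (λ t → t +ℚ gap ≤ℚ _) (ℚ.+-comm (seq (Re (z n - w)) m *ℚ _) _) (separated m m≥)) 0<gap))
  where
  open +-*-Solver
  root : ∀ a b g → (a *ℚ a +ℚ b *ℚ b) +ℚ g ≤ℚ ½ *ℚ ε *ℚ (½ *ℚ ε) → 0ℚ <ℚ g → ∣ a ∣ ≤ℚ ½ *ℚ ε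
  root a b g a²+b²+g≤ 0<g with ∣ a ∣ ℚ.≤? ½ *ℚ ε
  ... | yes a≤ = a≤
  ... | no a≰ = contradiction (ℚ.<-≤-trans (<-by (b *ℚ b +ℚ g) (ℚ.+-mono-≤-< 0≤b² 0<g)
                  (sym (ℚ.+-assoc (a *ℚ a) _ _))) (ℚ.≤-trans a²+b²+g≤ ε²≤a²))
                  (ℚ.<-irrefl refl)
    where
    square : ∀ p → ∣ p ∣ *ℚ ∣ p ∣ ≡ p *ℚ p
    square p with ℚ.≤-total 0ℚ p
    ... | inj₁ 0≤p = cong₂ _*ℚ_ (ℚ.0≤p⇒∣p∣≡p 0≤p) (ℚ.0≤p⇒∣p∣≡p 0≤p)
    ... | inj₂ p≤0 = trans (cong₂ _*ℚ_ ∣p∣≡-p ∣p∣≡-p)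
                       (solve 1 (λ p → (:- p) :* (:- p) := p :* p) refl p)
      where
      ∣p∣≡-p : ∣ p ∣ ≡ -ℚ p
      ∣p∣≡-p = trans (sym (ℚ.∣-p∣≡∣p∣ p)) (ℚ.0≤p⇒∣p∣≡p (ℚ.neg-antimono-≤ p≤0))
    0≤b² : 0ℚ ≤ℚ b *ℚ b
    0≤b² = subst (0ℚ ≤ℚ_) (square b) (0≤* (ℚ.0≤∣p∣ b) (ℚ.0≤∣p∣ b))
    ε²≤a² : ½ *ℚ ε *ℚ (½ *ℚ ε) ≤ℚ a *ℚ a
    ε²≤a² = subst (½ *ℚ ε *ℚ (½ *ℚ ε) ≤ℚ_) (square a)
      (*-mono-≤ (ℚ.<⇒≤ (0<* 0<½ 0<ε)) (ℚ.0≤∣p∣ a) (ℚ.<⇒≤ (ℚ.≰⇒> a≰)) (ℚ.<⇒≤ (ℚ.≰⇒> a≰)))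

Lim-unique : ∀ {z w w′} → Lim z w → Lim z w′ → w ≈ w′
Lim-unique {z} {w} {w′} (mkLim h) (mkLim k) = ∥∥≤0⇒≈ (∥∥-from-ε λ ε 0<ε →
  let N , hN = h (½ *ℚ ε) (0<* 0<½ 0<ε)
      M , kM = k (½ *ℚ ε) (0<* 0<½ 0<ε)
      n = N ⊔ M
  in ∥∥-mono (ℚ.≤-reflexive (trans (½+½ ε) (sym (ℚ.+-identityˡ ε))))
       (∥∥-cong (solve 3 (λ a b c → (a :- c) :- (a :- b) := b :- c) ≈.refl (z n) w w′)
         (∥∥-- (kM n (ℕ.m≤n⊔m N M)) (hN n (ℕ.m≤m⊔n N M)))))
  where open ℂ-Solver

Lim-cong : ∀ {z z′ w w′} → (∀ n → z n ≈ z′ n) → w ≈ w′ → Lim z w → Lim z′ w′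
within (Lim-cong z≈ w≈ (mkLim h)) ε 0<ε = let N , hN = h ε 0<ε in
  N , λ n n≥ → ∥∥-cong (+-cong (z≈ n) (-‿cong w≈)) (hN n n≥)

Lim-const : ∀ w → Lim (λ _ → w) w
within (Lim-const w) ε 0<ε = 0 , λ _ _ → ∥∥-mono (ℚ.<⇒≤ 0<ε) (≈⇒∥∥≤0 ≈.refl)

Lim-+ : ∀ {z z′ w w′} → Lim z w → Lim z′ w′ → Lim (λ n → z n + z′ n) (w + w′)
within (Lim-+ {z} {z′} {w} {w′} (mkLim h) (mkLim k)) ε 0<ε =
  let N , hN = h (½ *ℚ ε) (0<* 0<½ 0<ε)
      M , kM = k (½ *ℚ ε) (0<* 0<½ 0<ε)
  in N ⊔ M , λ n n≥ → ∥∥-mono (ℚ.≤-reflexive (½+½ ε))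
       (∥∥-cong (solve 4 (λ a b c d → (a :- c) :+ (b :- d) := (a :+ b) :- (c :+ d)) ≈.refl
           (z n) (z′ n) w w′)
         (∥∥-+ (hN n (ℕ.m⊔n≤o⇒m≤o N M n≥)) (kM n (ℕ.m⊔n≤o⇒n≤o N M n≥))))
  where open ℂ-Solver

Lim-neg : ∀ {z w} → Lim z w → Lim (λ n → - z n) (- w)
within (Lim-neg {z} {w} (mkLim h)) ε 0<ε = let N , hN = h ε 0<ε in
  N , λ n n≥ → ∥∥-cong (solve 2 (λ a b → :- (a :- b) := (:- a) :- (:- b)) ≈.refl (z n) w)
    (∥∥-neg (hN n n≥))
  where open ℂ-Solver

Lim-conj : ∀ {z w} → Lim z w → Lim (λ n → conj (z n)) (conj w)
within (Lim-conj {z} {w} (mkLim h)) ε 0<ε = let N , hN = h ε 0<ε in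
  N , λ n n≥ → ∥∥-cong (pointwiseℂ (λ _ → refl)
      (λ m → ℚ.neg-distrib-+ (seq (Im (z n)) m) (-ℚ seq (Im w) m)))
    (∥∥-conj (hN n n≥))

Lim-suc : ∀ {z w} → Lim z w → Lim (z ∘ suc) w
within (Lim-suc (mkLim h)) ε 0<ε = let N , hN = h ε 0<ε in
  N , λ n n≥ → hN (suc n) (ℕ.m≤n⇒m≤1+n n≥)

Lim-*ˡ : ∀ {z w} u → Lim z w → Lim (λ n → u * z n) (u * w)
within (Lim-*ˡ {z} {w} u (mkLim h)) ε 0<ε =
  let q , u≤q = ∥∥-bounded u
      δ , 0<δ , eq = 0<⇒∃quotient {1ℚ +ℚ q} ε (0<+ 0<1 (∥∥-nonNeg u≤q)) 0<ε
      N , hN = h δ 0<δ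
  in N , λ n n≥ → ∥∥-mono
       (ℚ.≤-trans (ℚ.*-monoʳ-≤-nonNeg δ {{ℚ.nonNegative (ℚ.<⇒≤ 0<δ)}} {q} {1ℚ +ℚ q}
         (≤-by 1ℚ (ℚ.<⇒≤ 0<1) (ℚ.+-comm q 1ℚ))) (ℚ.≤-reflexive eq))
       (∥∥-cong (solve 3 (λ u z w → u :* (z :- w) := u :* z :- u :* w) ≈.refl u (z n) w)
         (∥∥-* u≤q (hN n n≥)))
  where open ℂ-Solver

-- z w − z₀ w₀ = (z − z₀) (w − w₀) + z₀ (w − w₀) + w₀ (z − z₀)
Lim-* : ∀ {z w z₀ w₀} → Lim z z₀ → Lim w w₀ → Lim (λ n → z n * w n) (z₀ * w₀)
Lim-* {z} {w} {z₀} {w₀} hz hw = Lim-cong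
  (λ n → solve 4 (λ z w z₀ w₀ →
      (z :- z₀) :* (w :- w₀) :+ (z₀ :* w :+ (w₀ :* z :+ :- (z₀ :* w₀))) := z :* w) ≈.refl
    (z n) (w n) z₀ w₀)
  (solve 2 (λ z₀ w₀ → con 0ℚ :+ (z₀ :* w₀ :+ (w₀ :* z₀ :+ :- (z₀ :* w₀))) := z₀ :* w₀)
    ≈.refl z₀ w₀)
  (Lim-+ product (Lim-+ (Lim-*ˡ z₀ hw) (Lim-+ (Lim-*ˡ w₀ hz) (Lim-const (- (z₀ * w₀))))))
  where
  open ℂ-Solver
  product : Lim (λ n → (z n - z₀) * (w n - w₀)) 0ℂ
  within product ε 0<ε =
    let N , hN = within hz 1ℚ 0<1
        M , kM = within hw ε 0<ε
    in N ⊔ M , λ n n≥ → ∥∥-mono (ℚ.≤-reflexive (ℚ.*-identityˡ ε))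
         (∥∥-cong (solve 1 (λ z → z := z :- con 0ℚ) ≈.refl ((z n - z₀) * (w n - w₀)))
           (∥∥-* (hN n (ℕ.m⊔n≤o⇒m≤o N M n≥)) (kM n (ℕ.m⊔n≤o⇒n≤o N M n≥))))

-- Power series and the Cauchy product

module ℂ-Ring = CommutativeRing ℂ-commutativeRing

¼ : ℚ
¼ = + 1 / 4

0≤¼ : 0ℚ ≤ℚ ¼
0≤¼ = ℚ.nonNegative⁻¹ ¼

½≤1 : ½ ≤ℚ 1ℚ
½≤1 = ≤-by ½ (ℚ.<⇒≤ 0<½) refl

infix 10 _^ℚ_

_^ℚ_ : ℚ → ℕ → ℚ
q ^ℚ zero = 1ℚ
q ^ℚ suc k = q *ℚ q ^ℚ k

^ℚ-nonNeg : ∀ {q} → 0ℚ ≤ℚ q → ∀ k → 0ℚ ≤ℚ q ^ℚ k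
^ℚ-nonNeg 0≤q zero = ℚ.<⇒≤ 0<1
^ℚ-nonNeg 0≤q (suc k) = 0≤* 0≤q (^ℚ-nonNeg 0≤q k)

^ℚ-pos : ∀ {q} → 0ℚ <ℚ q → ∀ k → 0ℚ <ℚ q ^ℚ k
^ℚ-pos 0<q zero = 0<1
^ℚ-pos 0<q (suc k) = 0<* 0<q (^ℚ-pos 0<q k)

^ℚ-* : ∀ p q k → (p *ℚ q) ^ℚ k ≡ p ^ℚ k *ℚ q ^ℚ k
^ℚ-* p q zero = refl
^ℚ-* p q (suc k) = trans (cong (p *ℚ q *ℚ_) (^ℚ-* p q k))
  (solve 4 (λ p q r s → p :* q :* (r :* s) := (p :* r) :* (q :* s)) refl p q (p ^ℚ k) (q ^ℚ k))
  where open +-*-Solver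

/1-+ : ∀ m n → m / 1 +ℚ n / 1 ≡ (m ℤ.+ n) / 1
/1-+ m n = proj₂ (integer-+ (m , refl) (n , refl))

suc/1 : ∀ k → + suc k / 1 ≡ 1ℚ +ℚ + k / 1
suc/1 k = sym (/1-+ (+ 1) (+ k))

0≤+/ : ∀ n d .{{_ : ℕ.NonZero d}} → 0ℚ ≤ℚ + n / d
0≤+/ n d = ℚ.nonNegative⁻¹ (+ n / d) {{ℚ.normalize-nonNeg n d}}

0<suc/ : ∀ n d .{{_ : ℕ.NonZero d}} → 0ℚ <ℚ + suc n / d
0<suc/ n d = ℚ.positive⁻¹ (+ suc n / d) {{ℚ.normalize-pos (suc n) d}}

/1-mono : ∀ {m n} → m ℕ.≤ n → + m / 1 ≤ℚ + n / 1
/1-mono {m} {n} m≤n = ≤-by (+ (n ℕ.∸ m) / 1) (0≤+/ (n ℕ.∸ m) 1)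
  (trans (/1-+ (+ m) (+ (n ℕ.∸ m))) (cong (λ k → + k / 1) (ℕ.m+[n∸m]≡n m≤n)))

1/suc*suc : ∀ k → + 1 / suc k *ℚ (+ suc k / 1) ≡ 1ℚ
1/suc*suc k = ℚ.toℚᵘ-injective (ℚᵘ.≃-trans (ℚ.toℚᵘ-homo-* (+ 1 / suc k) (+ suc k / 1))
  (ℚᵘ.≃-trans (ℚᵘ.*-cong (ℚ.toℚᵘ-fromℚᵘ (ℚᵘ.mkℚᵘ (+ 1) k)) (ℚ.toℚᵘ-fromℚᵘ (ℚᵘ.mkℚᵘ (+ suc k) 0)))
    (ℚᵘ.*≡* (cong +_ (trans (ℕ.*-identityʳ _) (trans (ℕ.+-identityʳ (suc k))
      (sym (trans (ℕ.+-identityʳ _) (ℕ.*-identityʳ (suc k))))))))))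

abstract
  archimedean : ∀ q → ∃[ n ] q ≤ℚ + n / 1
  archimedean q@(ℚ.mkℚ i d-1 _) = ℤ.∣ i ∣ , ℚ.toℚᵘ-cancel-≤
    (ℚᵘ.≤-respʳ-≃ (ℚᵘ.≃-sym (ℚ.toℚᵘ-fromℚᵘ (ℚᵘ.mkℚᵘ (+ ℤ.∣ i ∣) 0)))
      (ℚᵘ.*≤* (ℤ.≤-trans (ℤ.≤-reflexive (ℤ.*-identityʳ i)) (i≤ i))))
    where
    i≤ : ∀ i → i ℤ.≤ + ℤ.∣ i ∣ ℤ.* + suc d-1
    i≤ (+ n) = ℤ.≤-trans (ℤ.+≤+ (ℕ.m≤m*n n (suc d-1))) (ℤ.≤-reflexive (ℤ.pos-* n (suc d-1)))
    i≤ ℤ.-[1+ n ] = ℤ.-≤+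

-- Bernoulli's inequality for (1 - h)⁻¹, cleared of denominators.
bernoulli : ∀ {h} → 0ℚ ≤ℚ h → h ≤ℚ 1ℚ → ∀ k → (1ℚ -ℚ h) ^ℚ k *ℚ (1ℚ +ℚ + k / 1 *ℚ h) ≤ℚ 1ℚ
bernoulli {h} 0≤h h≤1 zero = ℚ.≤-reflexive
  (solve 1 (λ h → con 1ℚ :* (con 1ℚ :+ con 0ℚ :* h) := con 1ℚ) refl h)
  where open +-*-Solver
bernoulli {h} 0≤h h≤1 (suc k) = ℚ.≤-trans
  (≤-by (p *ℚ (h *ℚ h *ℚ (1ℚ +ℚ + k / 1))) (0≤* 0≤p (0≤* (0≤* 0≤h 0≤h) (0≤+ (ℚ.<⇒≤ 0<1) (0≤+/ k 1))))
    (trans (cong (λ t → (1ℚ -ℚ h) *ℚ p *ℚ (1ℚ +ℚ t *ℚ h) +ℚ p *ℚ (h *ℚ h *ℚ (1ℚ +ℚ + k / 1))) (suc/1 k))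
      (solve 3 (λ h p k →
        (con 1ℚ :- h) :* p :* (con 1ℚ :+ (con 1ℚ :+ k) :* h) :+ p :* (h :* h :* (con 1ℚ :+ k))
        := p :* (con 1ℚ :+ k :* h)) refl h p (+ k / 1))))
  (bernoulli 0≤h h≤1 k)
  where
  open +-*-Solver
  p : ℚ
  p = (1ℚ -ℚ h) ^ℚ k
  0≤p : 0ℚ ≤ℚ p
  0≤p = ^ℚ-nonNeg (≤⇒0≤- h≤1) k

abstract
  ^ℚ-small : ∀ {h} → 0ℚ <ℚ h → h ≤ℚ 1ℚ → ∀ c ε → 0ℚ ≤ℚ c → 0ℚ <ℚ ε →
    ∃[ N ] (∀ n → N ℕ.≤ n → c *ℚ (1ℚ -ℚ h) ^ℚ n ≤ℚ ε)
  ^ℚ-small {h} 0<h h≤1 c ε 0≤c 0<ε = N , λ n n≥ → ℚ.≤-trans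
    (ℚ.*-monoʳ-≤-nonNeg (p n) {{ℚ.nonNegative (0≤p n)}} (c≤ n n≥))
    (ℚ.≤-trans (ℚ.≤-reflexive (trans (ℚ.*-assoc ε _ (p n)) (cong (ε *ℚ_) (ℚ.*-comm _ (p n)))))
      (ℚ.≤-trans (ℚ.*-monoˡ-≤-nonNeg ε {{ℚ.nonNegative (ℚ.<⇒≤ 0<ε)}} (bernoulli (ℚ.<⇒≤ 0<h) h≤1 n))
        (ℚ.≤-reflexive (ℚ.*-identityʳ ε))))
    where
    open +-*-Solver
    p : ℕ → ℚ
    p n = (1ℚ -ℚ h) ^ℚ n
    0≤p : ∀ n → 0ℚ ≤ℚ p n
    0≤p = ^ℚ-nonNeg (≤⇒0≤- h≤1)
    -- δ = (c + 1) / (h ε): for n ≥ δ this gives c ≤ ε (1 + n h), and Bernoulli's inequality turns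
    -- the second factor into the desired power.
    δ : ∃[ δ ] (0ℚ <ℚ δ × (h *ℚ ε) *ℚ δ ≡ c +ℚ 1ℚ)
    δ = 0<⇒∃quotient (c +ℚ 1ℚ) (0<* 0<h 0<ε) (ℚ.+-mono-≤-< 0≤c 0<1)
    N : ℕ
    N = proj₁ (archimedean (proj₁ δ))
    c≤ : ∀ n → N ℕ.≤ n → c ≤ℚ ε *ℚ (1ℚ +ℚ + n / 1 *ℚ h)
    c≤ n n≥ = ℚ.≤-trans (≤-by 1ℚ (ℚ.<⇒≤ 0<1) (sym (proj₂ (proj₂ δ))))
      (ℚ.≤-trans (ℚ.*-monoˡ-≤-nonNeg (h *ℚ ε) {{ℚ.nonNegative (ℚ.<⇒≤ (0<* 0<h 0<ε))}}
          (ℚ.≤-trans (proj₂ (archimedean (proj₁ δ))) (/1-mono n≥)))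
        (≤-by ε (ℚ.<⇒≤ 0<ε) (solve 3 (λ h ε n →
          h :* ε :* n :+ ε := ε :* (con 1ℚ :+ n :* h)) refl h ε (+ n / 1))))

partialSum-cong : ∀ {a b} → (∀ k → a k ≈ b k) → ∀ n → partialSum a n ≈ partialSum b n
partialSum-cong a≈b zero = ≈.refl
partialSum-cong a≈b (suc n) = +-cong (partialSum-cong a≈b n) (a≈b n)

partialSum-suc : ∀ a n → partialSum a (suc n) ≈ a 0 + partialSum (a ∘ suc) n
partialSum-suc a zero = +-comm 0ℂ (a 0)
partialSum-suc a (suc n) =
  ≈.trans (+-cong (partialSum-suc a n) ≈.refl) (+-assoc (a 0) _ (a (suc n)))

partialSum-+ : ∀ a b n → partialSum (λ k → a k + b k) n ≈ partialSum a n + partialSum b n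
partialSum-+ a b zero = ≈.sym (+-identityˡ 0ℂ)
partialSum-+ a b (suc n) = ≈.trans (+-cong (partialSum-+ a b n) ≈.refl)
  (solve 4 (λ p q r s → (p :+ q) :+ (r :+ s) := (p :+ r) :+ (q :+ s)) ≈.refl
    (partialSum a n) (partialSum b n) (a n) (b n))
  where open ℂ-Solver

partialSum-*ˡ : ∀ u a n → partialSum (λ k → u * a k) n ≈ u * partialSum a n
partialSum-*ˡ u a zero = solve 1 (λ u → con 0ℚ := u :* con 0ℚ) ≈.refl u
  where open ℂ-Solver
partialSum-*ˡ u a (suc n) = ≈.trans (+-cong (partialSum-*ˡ u a n) ≈.refl)
  (≈.sym (ℂ-Ring.distribˡ u (partialSum a n) (a n)))

-- ∑ ¼ᵏ = 4/3 ≤ 2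
geometric-bound : ∀ {a c} → (∀ k → ∥ a k ∥≤ c *ℚ ¼ ^ℚ k) → ∀ n → ∥ partialSum a n ∥≤ + 2 / 1 *ℚ c
geometric-bound {a} {c} h zero = ∥∥-mono (0≤* (0≤+/ 2 1) 0≤c) (∥ofℚ∥ ℚ.≤-refl)
  where
  0≤c : 0ℚ ≤ℚ c
  0≤c = subst (0ℚ ≤ℚ_) (ℚ.*-identityʳ c) (∥∥-nonNeg (h 0))
geometric-bound {a} {c} h (suc n) = ∥∥-mono
  (≤-by (½ *ℚ c) (0≤* (ℚ.<⇒≤ 0<½) 0≤c)
    (solve 1 (λ c →
      (c :* con 1ℚ :+ con (+ 2 / 1) :* (con ¼ :* c)) :+ con ½ :* c := con (+ 2 / 1) :* c) refl c))
  (∥∥-cong (≈.sym (partialSum-suc a n)) (∥∥-+ (h 0) (geometric-bound {a ∘ suc} {¼ *ℚ c} (λ k →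
    ∥∥-mono (ℚ.≤-reflexive (solve 3 (λ c q p → c :* (q :* p) := q :* c :* p) refl c ¼ (¼ ^ℚ k)))
      (h (suc k))) n)))
  where
  open +-*-Solver
  0≤c : 0ℚ ≤ℚ c
  0≤c = subst (0ℚ ≤ℚ_) (ℚ.*-identityʳ c) (∥∥-nonNeg (h 0))

-- The coefficients of a Cauchy product. Shifting the first factor avoids subtraction of indices.
conv : (ℕ → ℂ) → (ℕ → ℂ) → ℕ → ℂ
conv a b zero = a 0 * b 0
conv a b (suc k) = a 0 * b (suc k) + conv (a ∘ suc) b k

-- The defining recursion seen from the other end: here the second factor is shifted. Commutativity
-- follows by playing the two against each other.
conv-suc : ∀ a b k → conv a b (suc k) ≈ conv a (b ∘ suc) k + a (suc k) * b 0
conv-suc a b zero = ≈.refl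
conv-suc a b (suc k) = ≈.trans (+-cong ≈.refl (conv-suc (a ∘ suc) b k))
  (≈.sym (+-assoc (a 0 * b (2 ℕ.+ k)) _ _))

conv-comm : ∀ a b k → conv a b k ≈ conv b a k
conv-comm a b zero = *-comm (a 0) (b 0)
conv-comm a b (suc k) = ≈.trans
  (+-cong (*-comm (a 0) (b (suc k))) (conv-comm (a ∘ suc) b k))
  (≈.trans (+-comm _ (conv b (a ∘ suc) k)) (≈.sym (conv-suc b a k)))

conv-congˡ : ∀ {a a′} b → (∀ i → a i ≈ a′ i) → ∀ k → conv a b k ≈ conv a′ b k
conv-congˡ b h zero = *-cong (h 0) ≈.refl
conv-congˡ b h (suc k) = +-cong (*-cong (h 0) ≈.refl) (conv-congˡ b (h ∘ suc) k)

conv-+ˡ : ∀ a a′ b k → conv (λ i → a i + a′ i) b k ≈ conv a b k + conv a′ b k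
conv-+ˡ a a′ b zero = *-distribʳ-+ (b 0) (a 0) (a′ 0)
conv-+ˡ a a′ b (suc k) = ≈.trans
  (+-cong (*-distribʳ-+ (b (suc k)) (a 0) (a′ 0)) (conv-+ˡ (a ∘ suc) (a′ ∘ suc) b k))
  (solve 4 (λ p q r s → (p :+ q) :+ (r :+ s) := (p :+ r) :+ (q :+ s)) ≈.refl
    (a 0 * b (suc k)) (a′ 0 * b (suc k)) (conv (a ∘ suc) b k) (conv (a′ ∘ suc) b k))
  where open ℂ-Solver

conv-*ˡ : ∀ u a b k → conv (λ i → u * a i) b k ≈ u * conv a b k
conv-*ˡ u a b zero = *-assoc u (a 0) (b 0)
conv-*ˡ u a b (suc k) = ≈.trans
  (+-cong (*-assoc u (a 0) (b (suc k))) (conv-*ˡ u (a ∘ suc) b k))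
  (≈.sym (ℂ-Ring.distribˡ u (a 0 * b (suc k)) (conv (a ∘ suc) b k)))

-- The derivation x d/dx on coefficient sequences. Its Leibniz rule takes the place of the binomial
-- theorem in the addition formula for the exponential.
index* : (ℕ → ℂ) → ℕ → ℂ
index* a k = ofℤ (+ k) * a k

ofℤ-suc : ∀ k → ofℤ (+ suc k) ≈ 1ℂ + ofℤ (+ k)
ofℤ-suc k = ≈.trans (ofℚ-cong (suc/1 k)) (ofℚ-+ 1ℚ (+ k / 1))

conv-leibniz : ∀ a b k → conv (index* a) b k + conv a (index* b) k ≈ index* (conv a b) k
conv-leibniz a b zero = solve 2 (λ a b →
  con 0ℚ :* a :* b :+ a :* (con 0ℚ :* b) := con 0ℚ :* (a :* b)) ≈.refl (a 0) (b 0)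
  where open ℂ-Solver
conv-leibniz a b (suc k) = ≈.trans
  (+-cong (+-cong ≈.refl (≈.trans (conv-congˡ b shift k) (conv-+ˡ (index* a′) a′ b k)))
    (+-cong (*-cong ≈.refl (*-cong (ofℤ-suc k) ≈.refl)) ≈.refl))
  (≈.trans (solve 6 (λ a₀ b₁ n p q r →
      (con 0ℚ :* a₀ :* b₁ :+ (p :+ q)) :+ (a₀ :* ((con 1ℚ :+ n) :* b₁) :+ r)
      := (p :+ r) :+ (q :+ (con 1ℚ :+ n) :* (a₀ :* b₁))) ≈.refl
    (a 0) (b (suc k)) (ofℤ (+ k)) (conv (index* a′) b k) (conv a′ b k) (conv a′ (index* b) k))
  (≈.trans (+-cong (conv-leibniz a′ b k) ≈.refl)
  (≈.trans (solve 3 (λ n c p → n :* c :+ (c :+ (con 1ℚ :+ n) :* p) := (con 1ℚ :+ n) :* (p :+ c))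
      ≈.refl (ofℤ (+ k)) (conv a′ b k) (a 0 * b (suc k)))
    (*-cong (≈.sym (ofℤ-suc k)) ≈.refl))))
  where
  open ℂ-Solver
  a′ : ℕ → ℂ
  a′ = a ∘ suc
  shift : ∀ i → index* a (suc i) ≈ index* a′ i + a′ i
  shift i = ≈.trans (*-cong (ofℤ-suc i) ≈.refl)
    (solve 2 (λ n a → (con 1ℚ :+ n) :* a := n :* a :+ a) ≈.refl (ofℤ (+ i)) (a′ i))

-- The sum of the products `a i * b k` with i, k < n but i + k ≥ n.
cauchyDefect : (ℕ → ℂ) → (ℕ → ℂ) → ℕ → ℂ
cauchyDefect a b n = partialSum a n * partialSum b n - partialSum (conv a b) n

-- With `suc n` in place of n, the index into `a` of every such product is positive, so `a` can be
-- shifted; the two summands collect k = n and k < n.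
cauchyDefect-suc : ∀ a b n →
  partialSum (a ∘ suc) n * b n + cauchyDefect (a ∘ suc) b n ≈ cauchyDefect a b (suc n)
cauchyDefect-suc a b n = ≈.trans
  (solve 5 (λ a₀ s b t c →
    s :* b :+ (s :* t :- c) := (a₀ :+ s) :* (t :+ b) :- (a₀ :* (t :+ b) :+ c)) ≈.refl
    (a 0) (partialSum (a ∘ suc) n) (b n) (partialSum b n) (partialSum (conv (a ∘ suc) b) n))
  (+-cong (*-cong (≈.sym (partialSum-suc a n)) ≈.refl) (-‿cong (≈.sym convolution)))
  where
  open ℂ-Solver
  convolution : partialSum (conv a b) (suc n) ≈
                a 0 * (partialSum b n + b n) + partialSum (conv (a ∘ suc) b) n
  convolution = ≈.trans (partialSum-suc (conv a b) n)
    (≈.trans (+-cong ≈.refl (≈.trans (partialSum-+ (λ k → a 0 * b (suc k)) (conv (a ∘ suc) b) n)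
      (+-cong (partialSum-*ˡ (a 0) (b ∘ suc) n) ≈.refl)))
    (≈.trans (solve 4 (λ a b t c → a :* b :+ (a :* t :+ c) := a :* (b :+ t) :+ c) ≈.refl
      (a 0) (b 0) (partialSum (b ∘ suc) n) (partialSum (conv (a ∘ suc) b) n))
      (+-cong (*-cong ≈.refl (≈.sym (partialSum-suc b n))) ≈.refl)))

-- Each step of the recursion replaces A by A/4 and adds a product of size 2 (A/4) B ¼ⁿ. The number
-- of steps is the factor n.
cauchyDefect-bound : ∀ {a b A B} → (∀ k → ∥ a k ∥≤ A *ℚ ¼ ^ℚ k) → (∀ k → ∥ b k ∥≤ B *ℚ ¼ ^ℚ k) →
  ∀ n → ∥ cauchyDefect a b n ∥≤ + 2 / 1 *ℚ (A *ℚ B) *ℚ (+ n / 1 *ℚ ¼ ^ℚ n)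
cauchyDefect-bound {a} {b} {A} {B} ha hb zero = ∥∥-mono
  (ℚ.≤-reflexive (solve 1 (λ c → con 0ℚ := c :* (con 0ℚ :* con 1ℚ)) refl (+ 2 / 1 *ℚ (A *ℚ B))))
  (∥∥-cong (pointwiseℂ (λ _ → refl) (λ _ → refl)) (∥ofℚ∥ ℚ.≤-refl))
  where open +-*-Solver
cauchyDefect-bound {a} {b} {A} {B} ha hb (suc n) = ∥∥-mono
  (ℚ.≤-reflexive (trans
    (solve 4 (λ A B n p →
      con (+ 2 / 1) :* (con ¼ :* A) :* (B :* p)
        :+ con (+ 2 / 1) :* (con ¼ :* A :* B) :* (n :* p)
      := con (+ 2 / 1) :* (A :* B) :* ((con 1ℚ :+ n) :* (con ¼ :* p))) refl A B (+ n / 1) (¼ ^ℚ n))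
    (cong (λ t → + 2 / 1 *ℚ (A *ℚ B) *ℚ (t *ℚ (¼ *ℚ ¼ ^ℚ n))) (sym (suc/1 n)))))
  (∥∥-cong (cauchyDefect-suc a b n)
    (∥∥-+ (∥∥-* (geometric-bound {c = ¼ *ℚ A} ha′ n) (hb n)) (cauchyDefect-bound {A = ¼ *ℚ A} {B} ha′ hb n)))
  where
  open +-*-Solver
  ha′ : ∀ k → ∥ a (suc k) ∥≤ ¼ *ℚ A *ℚ ¼ ^ℚ k
  ha′ k = ∥∥-mono (ℚ.≤-reflexive
    (solve 3 (λ c q p → c :* (q :* p) := q :* c :* p) refl A ¼ (¼ ^ℚ k))) (ha (suc k))

-- Split ¼ⁿ as ½ⁿ ½ⁿ; Bernoulli's inequality at h = ½ bounds n ½ⁿ by 2.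
n*¼^n≤2*½^n : ∀ n → + n / 1 *ℚ ¼ ^ℚ n ≤ℚ + 2 / 1 *ℚ ½ ^ℚ n
n*¼^n≤2*½^n n = subst (λ t → + n / 1 *ℚ t ≤ℚ + 2 / 1 *ℚ p) (sym (^ℚ-* ½ ½ n))
  (≤-by (+ 2 / 1 *ℚ p *ℚ (1ℚ -ℚ p *ℚ (1ℚ +ℚ + n / 1 *ℚ ½)) +ℚ + 2 / 1 *ℚ (p *ℚ p))
    (0≤+ (0≤* (0≤* (0≤+/ 2 1) 0≤p) (≤⇒0≤- (bernoulli {½} (ℚ.<⇒≤ 0<½) ½≤1 n)))
      (0≤* (0≤+/ 2 1) (0≤* 0≤p 0≤p)))
    (solve 2 (λ n p → n :* (p :* p) :+ (con (+ 2 / 1) :* p :* (con 1ℚ :- p :* (con 1ℚ :+ n :* con ½))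
        :+ con (+ 2 / 1) :* (p :* p)) := con (+ 2 / 1) :* p) refl (+ n / 1) p))
  where
  open +-*-Solver
  p : ℚ
  p = ½ ^ℚ n
  0≤p : 0ℚ ≤ℚ p
  0≤p = ^ℚ-nonNeg (ℚ.<⇒≤ 0<½) n

cauchyProduct : ∀ {a b A B z w} → (∀ k → ∥ a k ∥≤ A *ℚ ¼ ^ℚ k) → (∀ k → ∥ b k ∥≤ B *ℚ ¼ ^ℚ k) →
  Lim (partialSum a) z → Lim (partialSum b) w → Lim (partialSum (conv a b)) (z * w)
cauchyProduct {a} {b} {A} {B} {z} {w} ha hb a→z b→w = Lim-cong
  (λ n → solve 2 (λ p c → p :+ :- (p :- c) := c) ≈.refl
    (partialSum a n * partialSum b n) (partialSum (conv a b) n))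
  (solve 1 (λ p → p :+ :- con 0ℚ := p) ≈.refl (z * w))
  (Lim-+ (Lim-* a→z b→w) (Lim-neg defect→0))
  where
  open ℂ-Solver
  0≤-const : ∀ {a A} → (∀ k → ∥ a k ∥≤ A *ℚ ¼ ^ℚ k) → 0ℚ ≤ℚ A
  0≤-const {a} {A} h = subst (0ℚ ≤ℚ_) (ℚ.*-identityʳ A) (∥∥-nonNeg (h 0))
  c : ℚ
  c = + 2 / 1 *ℚ (A *ℚ B)
  0≤c : 0ℚ ≤ℚ c
  0≤c = 0≤* (0≤+/ 2 1) (0≤* (0≤-const {a} {A} ha) (0≤-const {b} {B} hb))
  defect→0 : Lim (cauchyDefect a b) 0ℂ
  within defect→0 ε 0<ε =
    let N , hN = ^ℚ-small 0<½ ½≤1 (c *ℚ (+ 2 / 1)) ε (0≤* 0≤c (0≤+/ 2 1)) 0<ε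
    in N , λ n n≥ → ∥∥-mono
         (ℚ.≤-trans (ℚ.*-monoˡ-≤-nonNeg c {{ℚ.nonNegative 0≤c}} (n*¼^n≤2*½^n n))
           (ℚ.≤-trans (ℚ.≤-reflexive (sym (ℚ.*-assoc c (+ 2 / 1) (½ ^ℚ n)))) (hN n n≥)))
         (∥∥-cong (solve 1 (λ d → d := d :- con 0ℚ) ≈.refl (cauchyDefect a b n))
           (cauchyDefect-bound {A = A} {B} ha hb n))

-- The exponential function

conj-+ : ∀ z w → conj (z + w) ≈ conj z + conj w
conj-+ z w = pointwiseℂ (λ _ → refl) (λ n → ℚ.neg-distrib-+ (seq (Im z) n) (seq (Im w) n))

conj-* : ∀ z w → conj (z * w) ≈ conj z * conj w
conj-* z w = pointwiseℂ
  (λ n → solve 4 (λ a b c d → a :* c :+ :- (b :* d) := a :* c :+ :- ((:- b) :* (:- d))) refl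
    (seq (Re z) n) (seq (Im z) n) (seq (Re w) n) (seq (Im w) n))
  (λ n → solve 4 (λ a b c d → :- (a :* d :+ b :* c) := a :* (:- d) :+ (:- b) :* c) refl
    (seq (Re z) n) (seq (Im z) n) (seq (Re w) n) (seq (Im w) n))
  where open +-*-Solver

conj-ofℚ : ∀ q → conj (ofℚ q) ≈ ofℚ q
conj-ofℚ q = pointwiseℂ (λ _ → refl) (λ _ → refl)

conj-involutive : ∀ z → conj (conj z) ≈ z
conj-involutive z = pointwiseℂ (λ _ → refl)
  (λ n → solve 1 (λ b → :- (:- b) := b) refl (seq (Im z) n))
  where open +-*-Solver

Lim-∥∥ : ∀ {z w q} → Lim z w → (∀ n → ∥ z n ∥≤ q) → ∥ w ∥≤ q
Lim-∥∥ {z} {w} (mkLim h) z≤q = ∥∥-from-ε λ ε 0<ε → let N , hN = h ε 0<ε in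
  ∥∥-cong (solve 2 (λ z w → z :- (z :- w) := w) ≈.refl (z N) w) (∥∥-- (z≤q N) (hN N ℕ.≤-refl))
  where open ℂ-Solver

ratio⇒geometric : ∀ (a : ℕ → ℂ) c → ∥ a 0 ∥≤ c → (∀ k {c} → ∥ a k ∥≤ c → ∥ a (suc k) ∥≤ ¼ *ℚ c) →
  ∀ k → ∥ a k ∥≤ c *ℚ ¼ ^ℚ k
ratio⇒geometric a c a₀ ratio zero = ∥∥-mono (ℚ.≤-reflexive (sym (ℚ.*-identityʳ c))) a₀
ratio⇒geometric a c a₀ ratio (suc k) = ∥∥-mono
  (ℚ.≤-reflexive (solve 2 (λ c p → con ¼ :* (c :* p) := c :* (con ¼ :* p)) refl c (¼ ^ℚ k)))
  (ratio k (ratio⇒geometric a c a₀ ratio k))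
  where open +-*-Solver

-- The finitely many early terms are absorbed into the constant: dropping one term loses one power
-- of ¼, which the factor 4 restores.
eventualRatio⇒geometric : ∀ K (a : ℕ → ℂ) → (∀ k → K ℕ.≤ k → ∀ {c} → ∥ a k ∥≤ c → ∥ a (suc k) ∥≤ ¼ *ℚ c) →
  ∃[ C ] (∀ k → ∥ a k ∥≤ C *ℚ ¼ ^ℚ k)
eventualRatio⇒geometric zero a ratio = let c , a₀ = ∥∥-bounded (a 0) in
  c , ratio⇒geometric a c a₀ (λ k → ratio k ℕ.z≤n)
eventualRatio⇒geometric (suc K) a ratio = c +ℚ + 4 / 1 *ℚ C , bound
  where
  open +-*-Solver
  c : ℚ
  c = proj₁ (∥∥-bounded (a 0))
  0≤c : 0ℚ ≤ℚ c
  0≤c = ∥∥-nonNeg (proj₂ (∥∥-bounded (a 0)))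
  tail : ∃[ C ] (∀ k → ∥ a (suc k) ∥≤ C *ℚ ¼ ^ℚ k)
  tail = eventualRatio⇒geometric K (a ∘ suc) (λ k k≥ → ratio (suc k) (ℕ.s≤s k≥))
  C : ℚ
  C = proj₁ tail
  0≤C : 0ℚ ≤ℚ C
  0≤C = subst (0ℚ ≤ℚ_) (ℚ.*-identityʳ C) (∥∥-nonNeg (proj₂ tail 0))
  bound : ∀ k → ∥ a k ∥≤ (c +ℚ + 4 / 1 *ℚ C) *ℚ ¼ ^ℚ k
  bound zero = ∥∥-mono (≤-by (+ 4 / 1 *ℚ C) (0≤* (0≤+/ 4 1) 0≤C)
    (sym (ℚ.*-identityʳ (c +ℚ + 4 / 1 *ℚ C)))) (proj₂ (∥∥-bounded (a 0)))
  bound (suc k) = ∥∥-mono (≤-by (c *ℚ (¼ *ℚ ¼ ^ℚ k)) (0≤* 0≤c (0≤* 0≤¼ (^ℚ-nonNeg 0≤¼ k)))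
    (solve 3 (λ c C p → C :* p :+ c :* (con ¼ :* p)
      := (c :+ con (+ 4 / 1) :* C) :* (con ¼ :* p)) refl c C (¼ ^ℚ k))) (proj₂ tail k)

expTerm-cong : ∀ {z w} → z ≈ w → ∀ k → expTerm z k ≈ expTerm w k
expTerm-cong z≈w zero = ≈.refl
expTerm-cong z≈w (suc k) = *-cong (*-cong (expTerm-cong z≈w k) z≈w) ≈.refl

conj-expTerm : ∀ z k → conj (expTerm z k) ≈ expTerm (conj z) k
conj-expTerm z zero = conj-ofℚ 1ℚ
conj-expTerm z (suc k) = ≈.trans (conj-* (expTerm z k * z) (ofℚ (+ 1 / suc k)))
  (*-cong (≈.trans (conj-* (expTerm z k) z) (*-cong (conj-expTerm z k) ≈.refl))
    (conj-ofℚ (+ 1 / suc k)))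

conj-partialSum : ∀ a n → conj (partialSum a n) ≈ partialSum (conj ∘ a) n
conj-partialSum a zero = conj-ofℚ 0ℚ
conj-partialSum a (suc n) =
  ≈.trans (conj-+ (partialSum a n) (a n)) (+-cong (conj-partialSum a n) ≈.refl)

expTerm-ratio : ∀ {z q} k → ∥ z ∥≤ q → + 4 / 1 *ℚ q ≤ℚ + suc k / 1 →
  ∀ {c} → ∥ expTerm z k ∥≤ c → ∥ expTerm z (suc k) ∥≤ ¼ *ℚ c
expTerm-ratio {z} {q} k z≤q 4q≤ {c} hc = ∥∥-mono
  (ℚ.≤-trans (ℚ.≤-reflexive (trans (ℚ.*-assoc c q r) (ℚ.*-comm c (q *ℚ r))))
    (ℚ.*-monoʳ-≤-nonNeg c {{ℚ.nonNegative (∥∥-nonNeg hc)}} qr≤¼))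
  (∥∥-* (∥∥-* hc z≤q) (∥ofℚ∥ (0≤+/ 1 (suc k))))
  where
  open +-*-Solver
  r : ℚ
  r = + 1 / suc k
  qr≤¼ : q *ℚ r ≤ℚ ¼
  qr≤¼ = ℚ.≤-trans (ℚ.≤-reflexive (solve 2 (λ q r → q :* r := con (+ 4 / 1) :* q :* (con ¼ :* r)) refl q r))
    (ℚ.≤-trans (ℚ.*-monoʳ-≤-nonNeg (¼ *ℚ r) {{ℚ.nonNegative (0≤* 0≤¼ (0≤+/ 1 (suc k)))}} 4q≤)
      (ℚ.≤-reflexive (trans (solve 2 (λ s r → s :* (con ¼ :* r) := con ¼ :* (r :* s)) refl (+ suc k / 1) r)
        (cong (¼ *ℚ_) (1/suc*suc k)))))

expTerm-geometric : ∀ z → ∃[ C ] (∀ k → ∥ expTerm z k ∥≤ C *ℚ ¼ ^ℚ k)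
expTerm-geometric z =
  let q , z≤q = ∥∥-bounded z
      K , 4q≤K = archimedean (+ 4 / 1 *ℚ q)
  in eventualRatio⇒geometric K (expTerm z) λ k k≥ →
       expTerm-ratio k z≤q (ℚ.≤-trans 4q≤K (/1-mono (ℕ.m≤n⇒m≤1+n k≥)))

-- Coefficient form of the differential equation x d/dx exp(z x) = z x exp(z x).
index*-expTerm : ∀ z k → index* (expTerm z) (suc k) ≈ z * expTerm z k
index*-expTerm z k = ≈.trans
  (solve 4 (λ s t z r → s :* (t :* z :* r) := r :* s :* (z :* t)) ≈.refl
    (ofℤ (+ suc k)) (expTerm z k) z (ofℚ (+ 1 / suc k)))
  (≈.trans (*-cong (≈.trans (≈.sym (ofℚ-* (+ 1 / suc k) (+ suc k / 1))) (ofℚ-cong (1/suc*suc k))) ≈.refl)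
    (*-identityˡ (z * expTerm z k)))
  where open ℂ-Solver

conv-index*-expTerm : ∀ z b k → conv (index* (expTerm z)) b (suc k) ≈ z * conv (expTerm z) b k
conv-index*-expTerm z b k = ≈.trans
  (+-cong (solve 2 (λ a b → con 0ℚ :* a :* b := con 0ℚ) ≈.refl 1ℂ (b (suc k)))
    (≈.trans (conv-congˡ b (index*-expTerm z) k) (conv-*ˡ z (expTerm z) b k)))
  (+-identityˡ (z * conv (expTerm z) b k))
  where open ℂ-Solver

-- Both sides satisfy the recursion (k + 1) t(k + 1) = (z + w) t(k). For the convolution this is the
-- Leibniz rule together with the differential equation of each factor.
expTerm-+ : ∀ z w k → expTerm (z + w) k ≈ conv (expTerm z) (expTerm w) k
expTerm-+ z w zero = ≈.sym (*-identityˡ 1ℂ)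
expTerm-+ z w (suc k) = ≈.trans
  (*-cong (*-cong (expTerm-+ z w k) ≈.refl) ≈.refl)
  (≈.trans (solve 4 (λ c z w r → c :* (z :+ w) :* r := r :* (z :* c :+ w :* c)) ≈.refl
    (conv a b k) z w r)
  (≈.trans (*-cong ≈.refl (+-cong (≈.sym (conv-index*-expTerm z b k))
    (≈.sym (≈.trans (conv-comm a (index* b) (suc k))
      (≈.trans (conv-index*-expTerm w a k) (*-cong ≈.refl (conv-comm b a k)))))))
  (≈.trans (*-cong ≈.refl (conv-leibniz a b (suc k)))
  (≈.trans (≈.sym (*-assoc r (ofℤ (+ suc k)) (conv a b (suc k))))
  (≈.trans (*-cong (≈.trans (≈.sym (ofℚ-* (+ 1 / suc k) (+ suc k / 1))) (ofℚ-cong (1/suc*suc k))) ≈.refl)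
    (*-identityˡ (conv a b (suc k))))))))
  where
  open ℂ-Solver
  a b : ℕ → ℂ
  a = expTerm z
  b = expTerm w
  r : ℂ
  r = ofℚ (+ 1 / suc k)

module ExpProperties (E : Exponential) where
  open Exponential E public

  exp-Lim : ∀ z → Lim (partialSum (expTerm z)) (exp z)
  exp-Lim z = ⟶⇒Lim (exp-series z)

  exp-cong : ∀ {z w} → z ≈ w → exp z ≈ exp w
  exp-cong {z} {w} z≈w = Lim-unique
    (Lim-cong (partialSum-cong (expTerm-cong z≈w)) ≈.refl (exp-Lim z)) (exp-Lim w)

  exp-conj : ∀ z → conj (exp z) ≈ exp (conj z)
  exp-conj z = Lim-unique
    (Lim-cong (λ n → ≈.trans (conj-partialSum (expTerm z) n) (partialSum-cong (conj-expTerm z) n))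
      ≈.refl (Lim-conj (exp-Lim z)))
    (exp-Lim (conj z))

  exp-+ : ∀ z w → exp (z + w) ≈ exp z * exp w
  exp-+ z w =
    let A , hA = expTerm-geometric z
        B , hB = expTerm-geometric w
    in Lim-unique (exp-Lim (z + w))
         (Lim-cong (partialSum-cong (λ k → ≈.sym (expTerm-+ z w k))) ≈.refl
           (cauchyProduct {A = A} {B} hA hB (exp-Lim z) (exp-Lim w)))

  -- The remainder is the series from index 2 on. Its first term is at most q²/2, and q ≤ ¼ already
  -- makes all later ratios at most ¼, so the geometric bound applies with constant q².
  exp-near : ∀ {z q} → ∥ z ∥≤ q → q ≤ℚ ¼ → ∥ exp z - (1ℂ + z) ∥≤ + 2 / 1 *ℚ (q *ℚ q)
  exp-near {z} {q} z≤q q≤¼ = Lim-∥∥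
    (Lim-cong split ≈.refl (Lim-+ (Lim-suc (Lim-suc (exp-Lim z))) (Lim-const (- (1ℂ + z)))))
    (geometric-bound {c = q *ℚ q} (ratio⇒geometric a (q *ℚ q) a₀ ratio))
    where
    a : ℕ → ℂ
    a k = expTerm z (2 ℕ.+ k)
    0≤q : 0ℚ ≤ℚ q
    0≤q = ∥∥-nonNeg z≤q
    split : ∀ n → partialSum (expTerm z) (2 ℕ.+ n) - (1ℂ + z) ≈ partialSum a n
    split n = ≈.trans
      (+-cong (≈.trans (partialSum-suc (expTerm z) (suc n))
        (+-cong ≈.refl (partialSum-suc (expTerm z ∘ suc) n))) ≈.refl)
      (solve 2 (λ z s → (con 1ℚ :+ (con 1ℚ :* z :* con 1ℚ :+ s)) :- (con 1ℚ :+ z) := s) ≈.refl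
        z (partialSum a n))
      where open ℂ-Solver
    a₀ : ∥ a 0 ∥≤ q *ℚ q
    a₀ = ∥∥-mono (≤-by (½ *ℚ (q *ℚ q)) (0≤* (ℚ.<⇒≤ 0<½) (0≤* 0≤q 0≤q))
        (solve 1 (λ q → con 1ℚ :* q :* con 1ℚ :* q :* con ½ :+ con ½ :* (q :* q) := q :* q) refl q))
      (∥∥-* (∥∥-* (∥∥-* (∥∥-* (∥ofℚ∥ (ℚ.<⇒≤ 0<1)) z≤q) (∥ofℚ∥ (0≤+/ 1 1))) z≤q) (∥ofℚ∥ (0≤+/ 1 2)))
      where open +-*-Solver
    ratio : ∀ k {c} → ∥ a k ∥≤ c → ∥ a (suc k) ∥≤ ¼ *ℚ c
    ratio k = expTerm-ratio (2 ℕ.+ k) z≤q (ℚ.≤-trans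
      (ℚ.*-monoˡ-≤-nonNeg (+ 4 / 1) q≤¼) (/1-mono {1} {3 ℕ.+ k} (ℕ.s≤s ℕ.z≤n)))

  exp-0 : exp 0ℂ ≈ 1ℂ
  exp-0 = ≈.trans (∥∥≤0⇒≈ (exp-near (∥ofℚ∥ {0ℚ} ℚ.≤-refl) 0≤¼)) (ℂ-Ring.+-identityʳ 1ℂ)

-- π and the values e(r) for rational r

0ʳ : ℝ
0ʳ = fromℚ 0ℚ

lowerBound : ∀ {x} → 0ʳ <ʳ x → ∃[ g ] (0ℚ <ℚ g × ∃[ N ] (∀ n → N ℕ.≤ n → g ≤ℚ seq x n))
lowerBound {x} (mk<ʳ g 0<g N h) = g , 0<g , N , λ n n≥ →
  subst (_≤ℚ seq x n) (ℚ.+-identityˡ g) (h n n≥)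

0<ʳ-by : ∀ {x} g → 0ℚ <ℚ g → ∀ N → (∀ n → N ℕ.≤ n → g ≤ℚ seq x n) → 0ʳ <ʳ x
0<ʳ-by {x} g 0<g N h = mk<ʳ g 0<g N λ n n≥ →
  subst (_≤ℚ seq x n) (sym (ℚ.+-identityˡ g)) (h n n≥)

0<ʳ-+ : ∀ {x y} → 0ʳ <ʳ x → 0ʳ <ʳ y → 0ʳ <ʳ x +ʳ y
0<ʳ-+ {x} {y} 0<x 0<y =
  let g , 0<g , N , h = lowerBound 0<x
      g′ , 0<g′ , M , k = lowerBound 0<y
  in 0<ʳ-by (g +ℚ g′) (0<+ 0<g (ℚ.<⇒≤ 0<g′)) (N ⊔ M) λ n n≥ →
       ℚ.+-mono-≤ (h n (ℕ.m⊔n≤o⇒m≤o N M n≥)) (k n (ℕ.m⊔n≤o⇒n≤o N M n≥))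

0<ʳ-* : ∀ {x y} → 0ʳ <ʳ x → 0ʳ <ʳ y → 0ʳ <ʳ x *ʳ y
0<ʳ-* {x} {y} 0<x 0<y =
  let g , 0<g , N , h = lowerBound 0<x
      g′ , 0<g′ , M , k = lowerBound 0<y
  in 0<ʳ-by (g *ℚ g′) (0<* 0<g 0<g′) (N ⊔ M) λ n n≥ →
       let h′ = h n (ℕ.m⊔n≤o⇒m≤o N M n≥)
           k′ = k n (ℕ.m⊔n≤o⇒n≤o N M n≥)
       in *-mono-≤ (ℚ.<⇒≤ 0<g) (ℚ.≤-trans (ℚ.<⇒≤ 0<g′) k′) h′ k′

0<ʳ-cong : ∀ {x y} → x ≈ʳ y → 0ʳ <ʳ x → 0ʳ <ʳ y
0<ʳ-cong {x} {y} x≈y 0<x =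
  let g , 0<g , N , h = lowerBound 0<x
      M , k = close x≈y (½ *ℚ g) (0<* 0<½ 0<g)
  in 0<ʳ-by (½ *ℚ g) (0<* 0<½ 0<g) (N ⊔ M) λ n n≥ →
       lower (h n (ℕ.m⊔n≤o⇒m≤o N M n≥)) (k n (ℕ.m⊔n≤o⇒n≤o N M n≥))
  where
  open +-*-Solver
  lower : ∀ {a b g} → g ≤ℚ a → ∣ a -ℚ b ∣ ≤ℚ ½ *ℚ g → ½ *ℚ g ≤ℚ b
  lower {a} {b} {g} g≤a a-b≤ = ≤-by ((a -ℚ g) +ℚ (½ *ℚ g -ℚ (a -ℚ b)))
    (0≤+ (≤⇒0≤- g≤a) (≤⇒0≤- (ℚ.≤-trans (p≤∣p∣ (a -ℚ b)) a-b≤)))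
    (solve 3 (λ a b g → con ½ :* g :+ ((a :- g) :+ (con ½ :* g :- (a :- b))) := b) refl a b g)

private
  cancel-0<ʳ : ∀ {x y} → x *ʳ y ≈ʳ 0ʳ → 0ʳ <ʳ y → x ≈ʳ 0ʳ
  close (cancel-0<ʳ {x} {y} xy≈0 0<y) ε 0<ε =
    let g , 0<g , N , h = lowerBound 0<y
        M , k = close xy≈0 (g *ℚ ε) (0<* 0<g 0<ε)
    in N ⊔ M , λ n n≥ → ℚ.*-cancelˡ-≤-pos g {{ℚ.positive 0<g}}
         (bound (seq x n) (seq y n) (ℚ.<⇒≤ 0<g) (h n (ℕ.m⊔n≤o⇒m≤o N M n≥))
           (k n (ℕ.m⊔n≤o⇒n≤o N M n≥)))
    where
    bound : ∀ a b {g c} → 0ℚ ≤ℚ g → g ≤ℚ b → ∣ a *ℚ b -ℚ 0ℚ ∣ ≤ℚ c → g *ℚ ∣ a -ℚ 0ℚ ∣ ≤ℚ c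
    bound a b {g} {c} 0≤g g≤b h = ℚ.≤-trans
      (ℚ.*-monoʳ-≤-nonNeg (∣ a -ℚ 0ℚ ∣) {{ℚ.∣-∣-nonNeg (a -ℚ 0ℚ)}} g≤b)
      (subst (_≤ℚ c) (trans (cong ∣_∣ (ℚ.+-identityʳ (a *ℚ b)))
        (trans (ℚ.∣p*q∣≡∣p∣*∣q∣ a b) (trans (ℚ.*-comm (∣ a ∣) (∣ b ∣))
          (cong₂ _*ℚ_ (ℚ.0≤p⇒∣p∣≡p (ℚ.≤-trans 0≤g g≤b)) (cong ∣_∣ (sym (ℚ.+-identityʳ a))))))) h)

  -- Multiplying z w by the conjugate of w leaves z |w|², whose two coordinates allow real
  -- cancellation; no inverse of w has to be built.
  cancel-∣∣² : ∀ {z w} → z * w ≈ 0ℂ → 0ʳ <ʳ ∣ w ∣² → z ≈ 0ℂ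
  cancel-∣∣² {z} {w} zw≈0 0<w = mk≈ (cancel-0<ʳ (Re-≈ product) 0<w) (cancel-0<ʳ (Im-≈ product) 0<w)
    where
    product : (Re z *ʳ ∣ w ∣²) +i (Im z *ʳ ∣ w ∣²) ≈ 0ℂ
    product = ≈.trans (pointwiseℂ
      (λ n → solve 4 (λ a b c d → a :* (c :* c :+ d :* d)
          := (a :* c :+ :- (b :* d)) :* c :+ :- ((a :* d :+ b :* c) :* (:- d))) refl
        (seq (Re z) n) (seq (Im z) n) (seq (Re w) n) (seq (Im w) n))
      (λ n → solve 4 (λ a b c d → b :* (c :* c :+ d :* d)
          := (a :* c :+ :- (b :* d)) :* (:- d) :+ (a :* d :+ b :* c) :* c) refl
        (seq (Re z) n) (seq (Im z) n) (seq (Re w) n) (seq (Im w) n)))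
      (≈.trans (*-cong zw≈0 (≈.refl {conj w})) (ℂ-Ring.zeroˡ (conj w)))
      where open +-*-Solver

0≤square : ∀ p → 0ℚ ≤ℚ p *ℚ p
0≤square p with ℚ.≤-total 0ℚ p
... | inj₁ 0≤p = 0≤* 0≤p 0≤p
... | inj₂ p≤0 = subst (0ℚ ≤ℚ_) (solve 1 (λ p → (:- p) :* (:- p) := p :* p) refl p)
                   (0≤* (ℚ.neg-antimono-≤ p≤0) (ℚ.neg-antimono-≤ p≤0))
  where open +-*-Solver

cancel-0<Re : ∀ {z w} → z * w ≈ 0ℂ → 0ʳ <ʳ Re w → z ≈ 0ℂ
cancel-0<Re {z} {w} zw≈0 0<w =
  let g , 0<g , N , h = lowerBound 0<w
  in cancel-∣∣² {z} {w} zw≈0 (0<ʳ-by (g *ℚ g) (0<* 0<g 0<g) N λ n n≥ → ℚ.≤-trans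
       (*-mono-≤ (ℚ.<⇒≤ 0<g) (ℚ.≤-trans (ℚ.<⇒≤ 0<g) (h n n≥)) (h n n≥) (h n n≥))
       (≤-by (seq (Im w) n *ℚ seq (Im w) n) (0≤square (seq (Im w) n)) refl))

cancel-0<Im : ∀ {z w} → z * w ≈ 0ℂ → 0ʳ <ʳ Im w → z ≈ 0ℂ
cancel-0<Im {z} {w} zw≈0 0<w =
  let g , 0<g , N , h = lowerBound 0<w
  in cancel-∣∣² {z} {w} zw≈0 (0<ʳ-by (g *ℚ g) (0<* 0<g 0<g) N λ n n≥ → ℚ.≤-trans
       (*-mono-≤ (ℚ.<⇒≤ 0<g) (ℚ.≤-trans (ℚ.<⇒≤ 0<g) (h n n≥)) (h n n≥) (h n n≥))
       (≤-by (seq (Re w) n *ℚ seq (Re w) n) (0≤square (seq (Re w) n))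
         (ℚ.+-comm (seq (Im w) n *ℚ seq (Im w) n) _)))

𝐢² : 𝐢 * 𝐢 ≈ - 1ℂ
𝐢² = pointwiseℂ (λ _ → refl) (λ _ → refl)

-- In (z - i)(z + i) = 0 the second factor has positive imaginary part and can be cancelled.
z²≈-1⇒z≈𝐢 : ∀ {z} → z * z ≈ - 1ℂ → 0ʳ <ʳ Im z → z ≈ 𝐢
z²≈-1⇒z≈𝐢 {z} z²≈-1 0<Im = ∥∥≤0⇒≈ (∥∥-cong (≈.sym z-𝐢≈0) (∥ofℚ∥ ℚ.≤-refl))
  where
  open ℂ-Solver
  0<1ʳ : 0ʳ <ʳ fromℚ 1ℚ
  0<1ʳ = 0<ʳ-by 1ℚ 0<1 0 λ _ _ → ℚ.≤-refl
  z-𝐢≈0 : z - 𝐢 ≈ 0ℂ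
  z-𝐢≈0 = cancel-0<Im {z - 𝐢} {z + 𝐢}
    (≈.trans (solve 2 (λ z i → (z :- i) :* (z :+ i) := z :* z :- i :* i) ≈.refl z 𝐢)
      (≈.trans (+-cong z²≈-1 (-‿cong 𝐢²))
        (solve 0 (:- con 1ℚ :- (:- con 1ℚ) := con 0ℚ) ≈.refl)))
    (0<ʳ-+ 0<Im 0<1ʳ)

module CircleProperties (E : Exponential) where
  open ExpProperties E public

  2πi : ℂ
  2πi = ofℤ (+ 2) * ofℝ π * 𝐢

  e-cong : ∀ {z w} → z ≈ w → e z ≈ e w
  e-cong {z} {w} z≈w = exp-cong (*-cong (≈.refl {2πi}) z≈w)

  e-+ : ∀ z w → e (z + w) ≈ e z * e w
  e-+ z w = ≈.trans (exp-cong (ℂ-Ring.distribˡ 2πi z w)) (exp-+ (2πi * z) (2πi * w))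

  e-0 : e 0ℂ ≈ 1ℂ
  e-0 = ≈.trans (exp-cong (ℂ-Ring.zeroʳ 2πi)) exp-0

  e-inverse : ∀ z → e (- z) * e z ≈ 1ℂ
  e-inverse z = ≈.trans (≈.sym (e-+ (- z) z)) (≈.trans (e-cong (+-inverseˡ z)) e-0)

  𝐞 : ℚ → ℂ
  𝐞 r = e (ofℚ r)

  𝐞-+ : ∀ r s → 𝐞 (r +ℚ s) ≈ 𝐞 r * 𝐞 s
  𝐞-+ r s = ≈.trans (e-cong (ofℚ-+ r s)) (e-+ (ofℚ r) (ofℚ s))

  𝐞-cong : ∀ {r s} → r ≡ s → 𝐞 r ≈ 𝐞 s
  𝐞-cong refl = ≈.refl

  -- The radian measure 2πr as a real number, the form in which the conditions on the cosine that
  -- define π can be applied.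
  angle : ℚ → ℝ
  angle r = fromℚ (+ 2 / 1 *ℚ r) *ʳ π

  2πi*r : ∀ r → 2πi * ofℚ r ≈ 𝐢 * ofℝ (angle r)
  2πi*r r = pointwiseℂ
    (λ n → solve 2 (λ r p →
      ((t :* p :+ :- (o :* o)) :* o :+ :- ((t :* o :+ o :* p) :* l)) :* r
        :+ :- (((t :* p :+ :- (o :* o)) :* l :+ (t :* o :+ o :* p) :* o) :* o)
      := o :* ((t :* r) :* p) :+ :- (l :* o)) refl r (seq π n))
    (λ n → solve 2 (λ r p →
      ((t :* p :+ :- (o :* o)) :* o :+ :- ((t :* o :+ o :* p) :* l)) :* o
        :+ ((t :* p :+ :- (o :* o)) :* l :+ (t :* o :+ o :* p) :* o) :* r
      := o :* o :+ l :* ((t :* r) :* p)) refl r (seq π n))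
    where
    open +-*-Solver
    t o l : ∀ {n} → Polynomial n
    t = con (+ 2 / 1)
    o = con 0ℚ
    l = con 1ℚ

  𝐞-angle : ∀ r → 𝐞 r ≈ exp (𝐢 * ofℝ (angle r))
  𝐞-angle r = exp-cong (2πi*r r)

  𝐞-conj : ∀ r → conj (𝐞 r) ≈ 𝐞 (-ℚ r)
  𝐞-conj r = ≈.trans (conj-cong (𝐞-angle r)) (≈.trans (exp-conj (𝐢 * ofℝ (angle r)))
    (≈.trans (exp-cong (pointwiseℂ
      (λ n → solve 2 (λ r p → con 0ℚ :* ((t :* r) :* p) :+ :- (con 1ℚ :* con 0ℚ)
        := con 0ℚ :* ((t :* :- r) :* p) :+ :- (con 1ℚ :* con 0ℚ)) refl r (seq π n))
      (λ n → solve 2 (λ r p → :- (con 0ℚ :* con 0ℚ :+ con 1ℚ :* ((t :* r) :* p))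
        := con 0ℚ :* con 0ℚ :+ con 1ℚ :* ((t :* :- r) :* p)) refl r (seq π n))))
      (≈.sym (𝐞-angle (-ℚ r)))))
    where
    open +-*-Solver
    t : ∀ {n} → Polynomial n
    t = con (+ 2 / 1)

  ∣𝐞∣ : ∀ r → 𝐞 r * conj (𝐞 r) ≈ 1ℂ
  ∣𝐞∣ r = ≈.trans (*-cong (≈.refl {𝐞 r}) (𝐞-conj r)) (≈.trans (≈.sym (𝐞-+ r (-ℚ r)))
    (≈.trans (𝐞-cong (ℚ.+-inverseʳ r)) e-0))

  0<Re-𝐞 : ∀ r → 0ℚ ≤ℚ r → r <ℚ ¼ → 0ʳ <ʳ Re (𝐞 r)
  0<Re-𝐞 r 0≤r r<¼ = 0<ʳ-cong (≈ʳ-sym (Re-≈ (𝐞-angle r)))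
    (cos-below (angle r) nonNegative below-π/2)
    where
    open +-*-Solver
    π-bound : ∃[ g ] (0ℚ <ℚ g × ∃[ N ] (∀ n → N ℕ.≤ n → g ≤ℚ seq π n))
    π-bound = lowerBound 0<π
    g : ℚ
    g = proj₁ π-bound
    0<g : 0ℚ <ℚ g
    0<g = proj₁ (proj₂ π-bound)
    N : ℕ
    N = proj₁ (proj₂ (proj₂ π-bound))
    g≤π : ∀ n → N ℕ.≤ n → g ≤ℚ seq π n
    g≤π = proj₂ (proj₂ (proj₂ π-bound))
    nonNegative : 0ʳ ≤ʳ angle r
    nonNegative (mk<ʳ h 0<h M k) = ℚ.<-irrefl refl (ℚ.<-≤-trans
      (ℚ.+-mono-≤-< (0≤* (0≤* (0≤+/ 2 1) 0≤r)
        (ℚ.≤-trans (ℚ.<⇒≤ 0<g) (g≤π (N ⊔ M) (ℕ.m≤m⊔n N M)))) 0<h)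
      (k (N ⊔ M) (ℕ.m≤n⊔m N M)))
    below-π/2 : angle r <ʳ fromℚ ½ *ʳ π
    -- π/2 - 2πr = 2 (¼ - r) π, and π is eventually at least g.
    below-π/2 = mk<ʳ (+ 2 / 1 *ℚ (¼ -ℚ r) *ℚ g) (0<* (0<* (0<suc/ 1 1) (<⇒0<- r<¼)) 0<g) N λ n n≥ →
      ≤-by (+ 2 / 1 *ℚ (¼ -ℚ r) *ℚ (seq π n -ℚ g))
        (0≤* (0≤* (0≤+/ 2 1) (ℚ.<⇒≤ (<⇒0<- r<¼))) (≤⇒0≤- (g≤π n n≥)))
        (solve 3 (λ r g p →
          con (+ 2 / 1) :* r :* p :+ con (+ 2 / 1) :* (con ¼ :- r) :* g
            :+ con (+ 2 / 1) :* (con ¼ :- r) :* (p :- g) := con ½ :* p) refl r g (seq π n))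

  0<Re-𝐞-neg : ∀ r → 0ℚ ≤ℚ r → r <ℚ ¼ → 0ʳ <ʳ Re (𝐞 (-ℚ r))
  0<Re-𝐞-neg r 0≤r r<¼ = 0<ʳ-cong (Re-≈ (𝐞-conj r)) (0<Re-𝐞 r 0≤r r<¼)

  Re-𝐞-¼ : Re (𝐞 ¼) ≈ʳ 0ʳ
  Re-𝐞-¼ = ≈ʳ-trans (Re-≈ (𝐞-angle ¼)) cos-π/2

  -- A quarter turn halved k times. Its smallness brings the exponential series under control, and
  -- repeated doubling leads back to exactly ¼.
  step : ℕ → ℚ
  step k = ½ ^ℚ k *ℚ ¼

  0<step : ∀ k → 0ℚ <ℚ step k
  0<step k = 0<* (^ℚ-pos 0<½ k) (0<suc/ 0 4)

  step-double : ∀ k → step (suc k) +ℚ step (suc k) ≡ step k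
  step-double k = solve 1 (λ p → con ½ :* p :* con ¼ :+ con ½ :* p :* con ¼ := p :* con ¼) refl (½ ^ℚ k)
    where open +-*-Solver

  step-suc<¼ : ∀ k → step (suc k) <ℚ ¼
  step-suc<¼ k = ℚ.<-≤-trans (<-by (step (suc k)) (0<step (suc k)) (step-double k)) (step≤¼ k)
    where
    step≤¼ : ∀ k → step k ≤ℚ ¼
    step≤¼ zero = ℚ.≤-refl
    step≤¼ (suc k) = ℚ.≤-trans
      (≤-by (step (suc k)) (ℚ.<⇒≤ (0<step (suc k))) (step-double k)) (step≤¼ k)

  -- Two consequences of one first-order estimate of `exp` at 2πt: on the circle it makes the sine
  -- positive, which fixes e(1/4); on the real line it makes e(it) = exp(-2πt) a strict contraction,
  -- which yields arguments of small modulus for q-series.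
  record SmallAngle : Set where
    field
      exponent : ℕ
      0<Im     : 0ʳ <ʳ Im (𝐞 (step exponent))
      gap      : ℚ
      0<gap    : 0ℚ <ℚ gap
      decay    : ∥ e (𝐢 * ofℚ (step exponent)) ∥≤ 1ℚ -ℚ gap

  -- With g ≤ π ≤ U and t so small that 8U²t ≤ g, the quadratic error term
  -- 2(2Ut)² of the exponential series is at most gt, half of the linear term 2πt.
  abstract
    smallAngle : SmallAngle
    smallAngle = record
      { exponent = k
      ; 0<Im = 0<ʳ-cong (≈ʳ-sym (Im-≈ (𝐞-angle t))) 0<sin
      ; gap = t *ℚ g
      ; 0<gap = 0<* 0<t 0<g
      ; decay = ∥∥-cong (exp-cong (≈.sym 2πi*𝐢t)) decay
      }
      where
      open +-*-Solver
      bound : ∃[ g ] (0ℚ <ℚ g × ∃[ N ] (∀ n → N ℕ.≤ n → g ≤ℚ seq π n))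
      bound = lowerBound 0<π
      upper : ∃[ U ] ∥ ofℝ π ∥≤ U
      upper = ∥∥-bounded (ofℝ π)
      upperN : ∃[ N ] (∀ n → N ℕ.≤ n → size₁ (ofℝ π) n ≤ℚ proj₁ upper +ℚ 1ℚ)
      upperN = eventually (proj₂ upper) 1ℚ 0<1
      U g t : ℚ
      -- The added 1 gives U ≥ 1 and the minimum gives g ≤ 1. Then 8tU ≤ 8tU² ≤ g ≤ 1, so that q =
      -- 2tU is at most ¼, as `exp-near` requires.
      U = proj₁ upper +ℚ 1ℚ
      g = proj₁ bound ℚ.⊓ 1ℚ
      0<g : 0ℚ <ℚ g
      0<g with ℚ.⊓-sel (proj₁ bound) 1ℚ
      ... | inj₁ eq = subst (0ℚ <ℚ_) (sym eq) (proj₁ (proj₂ bound))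
      ... | inj₂ eq = subst (0ℚ <ℚ_) (sym eq) 0<1
      1≤U : 1ℚ ≤ℚ U
      1≤U = ≤-by (proj₁ upper) (∥∥-nonNeg (proj₂ upper)) (ℚ.+-comm 1ℚ (proj₁ upper))
      0≤U : 0ℚ ≤ℚ U
      0≤U = ℚ.≤-trans (ℚ.<⇒≤ 0<1) 1≤U
      N : ℕ
      N = proj₁ (proj₂ (proj₂ bound)) ⊔ proj₁ upperN
      g≤π : ∀ n → N ℕ.≤ n → g ≤ℚ seq π n
      g≤π n n≥ = ℚ.≤-trans (ℚ.p⊓q≤p (proj₁ bound) 1ℚ)
        (proj₂ (proj₂ (proj₂ bound)) n (ℕ.m⊔n≤o⇒m≤o _ (proj₁ upperN) n≥))
      π≤U : ∀ n → N ℕ.≤ n → seq π n ≤ℚ U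
      π≤U n n≥ = ℚ.≤-trans (p≤∣p∣ (seq π n)) (subst (_≤ℚ U) (ℚ.+-identityʳ (∣ seq π n ∣))
        (proj₂ upperN n (ℕ.m⊔n≤o⇒n≤o (proj₁ (proj₂ (proj₂ bound))) _ n≥)))
      small : ∃[ k ] (∀ n → k ℕ.≤ n → (+ 2 / 1 *ℚ (U *ℚ U)) *ℚ ½ ^ℚ n ≤ℚ g)
      small = ^ℚ-small 0<½ ½≤1 (+ 2 / 1 *ℚ (U *ℚ U)) g (0≤* (0≤+/ 2 1) (0≤* 0≤U 0≤U)) 0<g
      k : ℕ
      k = proj₁ small
      t = step k
      0<t : 0ℚ <ℚ t
      0<t = 0<step k
      8U²t≤g : + 8 / 1 *ℚ (U *ℚ U) *ℚ t ≤ℚ g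
      8U²t≤g = ℚ.≤-trans (ℚ.≤-reflexive (solve 2 (λ U p →
          con (+ 8 / 1) :* (U :* U) :* (p :* con ¼) := con (+ 2 / 1) :* (U :* U) :* p) refl U (½ ^ℚ k)))
        (proj₂ small k ℕ.≤-refl)
      q : ℚ
      q = + 2 / 1 *ℚ t *ℚ U
      q≤¼ : q ≤ℚ ¼
      q≤¼ = ≤-by (¼ *ℚ ((1ℚ -ℚ g) +ℚ (g -ℚ + 8 / 1 *ℚ (U *ℚ U) *ℚ t)
                    +ℚ + 8 / 1 *ℚ t *ℚ (U *ℚ (U -ℚ 1ℚ))))
        (0≤* 0≤¼ (0≤+ (0≤+ (≤⇒0≤- (ℚ.p⊓q≤q (proj₁ bound) 1ℚ)) (≤⇒0≤- 8U²t≤g))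
          (0≤* (0≤* (0≤+/ 8 1) (ℚ.<⇒≤ 0<t)) (0≤* 0≤U (≤⇒0≤- 1≤U)))))
        (solve 3 (λ g t U →
          con (+ 2 / 1) :* t :* U :+ con ¼ :* ((con 1ℚ :- g) :+ (g :- con (+ 8 / 1) :* (U :* U) :* t)
            :+ con (+ 8 / 1) :* t :* (U :* (U :- con 1ℚ))) := con ¼) refl g t U)
      2q²≤tg : + 2 / 1 *ℚ (q *ℚ q) ≤ℚ t *ℚ g
      2q²≤tg = ℚ.≤-trans (ℚ.≤-reflexive (solve 2 (λ t U →
          con (+ 2 / 1) :* (con (+ 2 / 1) :* t :* U :* (con (+ 2 / 1) :* t :* U))
            := t :* (con (+ 8 / 1) :* (U :* U) :* t)) refl t U))
        (ℚ.*-monoˡ-≤-nonNeg t {{ℚ.nonNegative (ℚ.<⇒≤ 0<t)}} 8U²t≤g)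
      y : ℝ
      y = angle t
      0≤2t : 0ℚ ≤ℚ + 2 / 1 *ℚ t
      0≤2t = 0≤* (0≤+/ 2 1) (ℚ.<⇒≤ 0<t)
      2tg≤y : ∀ n → N ℕ.≤ n → + 2 / 1 *ℚ t *ℚ g ≤ℚ seq y n
      2tg≤y n n≥ = ℚ.*-monoˡ-≤-nonNeg (+ 2 / 1 *ℚ t) {{ℚ.nonNegative 0≤2t}} (g≤π n n≥)
      y≤q : ∀ n → N ℕ.≤ n → seq y n ≤ℚ q
      y≤q n n≥ = ℚ.*-monoˡ-≤-nonNeg (+ 2 / 1 *ℚ t) {{ℚ.nonNegative 0≤2t}} (π≤U n n≥)
      0≤y : ∀ n → N ℕ.≤ n → 0ℚ ≤ℚ seq y n
      0≤y n n≥ = ℚ.≤-trans (0≤* 0≤2t (ℚ.<⇒≤ 0<g)) (2tg≤y n n≥)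
      ∥y∥ : ∥ ofℝ y ∥≤ q
      ∥y∥ = ∥∥-≤ N λ n n≥ → subst (_≤ℚ q) (sym (trans (ℚ.+-identityʳ (∣ seq y n ∣))
        (ℚ.0≤p⇒∣p∣≡p (0≤y n n≥)))) (y≤q n n≥)
      ∥𝐢y∥ : ∥ 𝐢 * ofℝ y ∥≤ q
      ∥𝐢y∥ = ∥∥-mono (ℚ.≤-reflexive (ℚ.*-identityˡ q)) (∥∥-* (∥∥-≤ {𝐢} {1ℚ} 0 λ _ _ → ℚ.≤-refl) ∥y∥)

      0<sin : 0ʳ <ʳ Im (exp (𝐢 * ofℝ y))
      0<sin =
        -- The linear term is at least 2tg and the remainder at most tg; spending tg/2 on the slack
        -- of the bound leaves tg/2.
        let M , h = eventually (exp-near ∥𝐢y∥ q≤¼) (½ *ℚ (t *ℚ g)) (0<* 0<½ (0<* 0<t 0<g))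
        in 0<ʳ-by (½ *ℚ (t *ℚ g)) (0<* 0<½ (0<* 0<t 0<g)) (N ⊔ M) λ n n≥ →
             lower (seq (Im (exp (𝐢 * ofℝ y))) n) (seq y n) (2tg≤y n (ℕ.m⊔n≤o⇒m≤o N M n≥))
               (ℚ.≤-trans (∣Im∣≤size₁ (exp (𝐢 * ofℝ y) - (1ℂ + 𝐢 * ofℝ y)) n)
                 (h n (ℕ.m⊔n≤o⇒n≤o N M n≥)))
        where
        lower : ∀ s y → + 2 / 1 *ℚ t *ℚ g ≤ℚ y →
          ∣ s +ℚ -ℚ (0ℚ +ℚ (0ℚ *ℚ 0ℚ +ℚ 1ℚ *ℚ y)) ∣ ≤ℚ + 2 / 1 *ℚ (q *ℚ q) +ℚ ½ *ℚ (t *ℚ g) →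
          ½ *ℚ (t *ℚ g) ≤ℚ s
        lower s y 2tg≤y h = ≤-by ((y -ℚ + 2 / 1 *ℚ t *ℚ g) +ℚ (t *ℚ g -ℚ + 2 / 1 *ℚ (q *ℚ q))
            +ℚ (+ 2 / 1 *ℚ (q *ℚ q) +ℚ ½ *ℚ (t *ℚ g) -ℚ -ℚ d))
          (0≤+ (0≤+ (≤⇒0≤- 2tg≤y) (≤⇒0≤- 2q²≤tg)) (≤⇒0≤- (ℚ.≤-trans (-p≤∣p∣ d) h)))
          (solve 5 (λ s y t g r → con ½ :* (t :* g)
              :+ ((y :- con (+ 2 / 1) :* t :* g) :+ (t :* g :- r)
                :+ (r :+ con ½ :* (t :* g) :- :- (s :+ :- (con 0ℚ :+ (con 0ℚ :* con 0ℚ :+ con 1ℚ :* y)))))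
              := s)
            refl s y t g (+ 2 / 1 *ℚ (q *ℚ q)))
          where
          d : ℚ
          d = s +ℚ -ℚ (0ℚ +ℚ (0ℚ *ℚ 0ℚ +ℚ 1ℚ *ℚ y))

      2πi*𝐢t : 2πi * (𝐢 * ofℚ t) ≈ - ofℝ y
      2πi*𝐢t = ≈.trans (ℂ-solve 3 (λ p i t → p S.:* (i S.:* t) S.:= i S.:* (p S.:* t)) ≈.refl 2πi 𝐢 (ofℚ t))
        (≈.trans (*-cong (≈.refl {𝐢}) (2πi*r t)) (pointwiseℂ
          (λ n → solve 1 (λ y → con 0ℚ :* (con 0ℚ :* y :+ :- (con 1ℚ :* con 0ℚ))
              :+ :- (con 1ℚ :* (con 0ℚ :* con 0ℚ :+ con 1ℚ :* y)) := :- y) refl (seq y n))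
          (λ n → solve 1 (λ y → con 0ℚ :* (con 0ℚ :* con 0ℚ :+ con 1ℚ :* y)
              :+ con 1ℚ :* (con 0ℚ :* y :+ :- (con 1ℚ :* con 0ℚ)) := con 0ℚ) refl (seq y n))))
        where
        module S = ℂ-Solver
        open S using () renaming (solve to ℂ-solve)

      decay : ∥ exp (- ofℝ y) ∥≤ 1ℚ -ℚ t *ℚ g
      decay = ∥∥-mono
        (≤-by (t *ℚ g -ℚ + 2 / 1 *ℚ (q *ℚ q)) (≤⇒0≤- 2q²≤tg)
          (solve 3 (λ t g r → r :+ (con 1ℚ :- con (+ 2 / 1) :* t :* g) :+ (t :* g :- r)
            := con 1ℚ :- t :* g) refl t g (+ 2 / 1 *ℚ (q *ℚ q))))
        (∥∥-cong (ℂ-solve 2 (λ z w → z S.:- w S.:+ w S.:= z) ≈.refl (exp (- ofℝ y)) (1ℂ + - ofℝ y))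
          (∥∥-+ (exp-near (∥∥-neg ∥y∥) q≤¼) linear))
        where
        module S = ℂ-Solver
        open S using () renaming (solve to ℂ-solve)
        linear : ∥ 1ℂ + - ofℝ y ∥≤ 1ℚ -ℚ + 2 / 1 *ℚ t *ℚ g
        linear = ∥∥-≤ N λ n n≥ → subst (_≤ℚ 1ℚ -ℚ + 2 / 1 *ℚ t *ℚ g)
          (sym (trans (ℚ.+-identityʳ (∣ 1ℚ -ℚ seq y n ∣)) (ℚ.0≤p⇒∣p∣≡p
            (≤⇒0≤- (ℚ.≤-trans (y≤q n n≥) (ℚ.≤-trans q≤¼ (≤-by (+ 3 / 4) (0≤+/ 3 4) refl)))))))
          (ℚ.+-monoʳ-≤ 1ℚ (ℚ.neg-antimono-≤ (2tg≤y n n≥)))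

  -- Since cos(π/2) = 0, the conjugate of e(1/4) is its negative, so |e(1/4)|² = 1 reads e(1/4)² =
  -- -1. The sign of the imaginary part then decides between i and -i.
  𝐞-¼ : 𝐞 ¼ ≈ 𝐢
  𝐞-¼ = z²≈-1⇒z≈𝐢 square (double (SmallAngle.exponent smallAngle) (SmallAngle.0<Im smallAngle))
    where
    -- sin 2x = 2 sin x cos x
    double : ∀ k → 0ʳ <ʳ Im (𝐞 (step k)) → 0ʳ <ʳ Im (𝐞 ¼)
    double zero h = h
    double (suc k) h = double k (0<ʳ-cong
      (Im-≈ (≈.trans (≈.sym (𝐞-+ (step (suc k)) (step (suc k)))) (𝐞-cong (step-double k))))
      (0<ʳ-+ (0<ʳ-* c h) (0<ʳ-* h c)))
      where
      c : 0ʳ <ʳ Re (𝐞 (step (suc k)))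
      c = 0<Re-𝐞 (step (suc k)) (ℚ.<⇒≤ (0<step (suc k))) (step-suc<¼ k)
    conj≈neg : conj (𝐞 ¼) ≈ - 𝐞 ¼
    conj≈neg = mk≈ (≈ʳ-trans Re-𝐞-¼ (≈ʳ-trans (pointwise (λ _ → refl)) (-ʳ-cong (≈ʳ-sym Re-𝐞-¼)))) ≈ʳ-refl
    square : 𝐞 ¼ * 𝐞 ¼ ≈ - 1ℂ
    square = ≈.trans (solve 1 (λ z → z :* z := :- (z :* :- z)) ≈.refl (𝐞 ¼))
      (-‿cong (≈.trans (*-cong (≈.refl {𝐞 ¼}) (≈.sym conj≈neg)) (∣𝐞∣ ¼)))
      where open ℂ-Solver

-- Uniqueness of q-expansions

^-cong : ∀ {z w} → z ≈ w → ∀ k → z ^ k ≈ w ^ k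
^-cong z≈w zero = ≈.refl
^-cong z≈w (suc k) = *-cong z≈w (^-cong z≈w k)

^-* : ∀ z w k → (z * w) ^ k ≈ z ^ k * w ^ k
^-* z w zero = ≈.sym (*-identityˡ 1ℂ)
^-* z w (suc k) = ≈.trans (*-cong ≈.refl (^-* z w k))
  (solve 4 (λ z w p q → z :* w :* (p :* q) := z :* p :* (w :* q)) ≈.refl z w (z ^ k) (w ^ k))
  where open ℂ-Solver

1^ : ∀ k → 1ℂ ^ k ≈ 1ℂ
1^ zero = ≈.refl
1^ (suc k) = ≈.trans (*-identityˡ (1ℂ ^ k)) (1^ k)

∥∥-^ : ∀ {z q} → ∥ z ∥≤ q → ∀ k → ∥ z ^ k ∥≤ q ^ℚ k
∥∥-^ z≤q zero = ∥ofℚ∥ (ℚ.<⇒≤ 0<1)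
∥∥-^ z≤q (suc k) = ∥∥-* z≤q (∥∥-^ z≤q k)

^ℚ-mono : ∀ {p q} → 0ℚ ≤ℚ p → p ≤ℚ q → ∀ k → p ^ℚ k ≤ℚ q ^ℚ k
^ℚ-mono 0≤p p≤q zero = ℚ.≤-refl
^ℚ-mono 0≤p p≤q (suc k) =
  *-mono-≤ 0≤p (^ℚ-nonNeg (ℚ.≤-trans 0≤p p≤q) k) p≤q (^ℚ-mono 0≤p p≤q k)

^ℚ-suc≤ : ∀ j → ¼ ^ℚ suc j ≤ℚ ¼
^ℚ-suc≤ zero = ℚ.≤-refl
^ℚ-suc≤ (suc j) = ℚ.≤-trans
  (ℚ.*-monoˡ-≤-nonNeg ¼ (ℚ.≤-trans (^ℚ-suc≤ j) (≤-by (+ 3 / 4) (0≤+/ 3 4) refl)))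
  (ℚ.≤-reflexive (ℚ.*-identityʳ ¼))

tail-bounded⇒bounded : ∀ N (y : ℕ → ℂ) c → (∀ n → N ℕ.≤ n → ∥ y n ∥≤ c) → ∃[ M ] (∀ n → ∥ y n ∥≤ M)
tail-bounded⇒bounded zero y c h = c , λ n → h n ℕ.z≤n
tail-bounded⇒bounded (suc N) y c h = tail-bounded⇒bounded N y (b +ℚ c) bound
  where
  b : ℚ
  b = proj₁ (∥∥-bounded (y N))
  0≤b : 0ℚ ≤ℚ b
  0≤b = ∥∥-nonNeg (proj₂ (∥∥-bounded (y N)))
  bound : ∀ n → N ℕ.≤ n → ∥ y n ∥≤ b +ℚ c
  bound n n≥ with ℕ.m≤n⇒m<n∨m≡n n≥
  ... | inj₁ N<n = ∥∥-mono (≤-by b 0≤b (ℚ.+-comm c b)) (h n N<n)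
  ... | inj₂ refl = ∥∥-mono (≤-by c (∥∥-nonNeg (h (suc N) ℕ.≤-refl)) refl) (proj₂ (∥∥-bounded (y N)))

convergent⇒bounded-terms : ∀ {y w} → Lim (partialSum y) w → ∃[ M ] (∀ n → ∥ y n ∥≤ M)
convergent⇒bounded-terms {y} {w} h =
  let N , hN = within terms→0 1ℚ 0<1
  in tail-bounded⇒bounded N y 1ℚ λ n n≥ →
       ∥∥-cong (solve 1 (λ y → y :- con 0ℚ := y) ≈.refl (y n)) (hN n n≥)
  where
  open ℂ-Solver
  terms→0 : Lim y 0ℂ
  terms→0 = Lim-cong (λ n → solve 2 (λ s y → (s :+ y) :+ :- s := y) ≈.refl (partialSum y n) (y n))
    (ℂ-Ring.-‿inverseʳ w) (Lim-+ (Lim-suc h) (Lim-neg h))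

module _ {x x⁻¹ : ℂ} (inverse : x⁻¹ * x ≈ 1ℂ) (x≤¼ : ∥ x ∥≤ ¼) where

  -- Zeros at x, x², x³, ... accumulate at 0, which is enough for the identity theorem for power
  -- series.
  VanishesOnPowers : (ℕ → ℂ) → Set
  VanishesOnPowers d = ∀ j → Lim (partialSum (λ k → d k * (x ^ suc j) ^ k)) 0ℂ

  -- For k ≥ 1 the k-th term at x^(j+2) is (the bounded term at x) × x^((j+1)k),
  -- so letting j → ∞ isolates d 0.
  vanishesOnPowers⇒head≈0 : ∀ {d} → VanishesOnPowers d → d 0 ≈ 0ℂ
  vanishesOnPowers⇒head≈0 {d} h = ∥∥≤0⇒≈ (∥∥-from-ε λ ε 0<ε →
    -- With h = ¾ the base 1 - h is ¼, the bound on x.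
    let j , hj = ^ℚ-small {+ 3 / 4} (0<suc/ 2 4) (≤-by ¼ 0≤¼ refl) (+ 2 / 1 *ℚ M) ε
                   (0≤* (0≤+/ 2 1) 0≤M) 0<ε
    in ∥∥-mono (ℚ.≤-trans (ℚ.≤-reflexive (sym (ℚ.*-assoc (+ 2 / 1) M (¼ ^ℚ suc j))))
         (ℚ.≤-trans (hj (suc j) (ℕ.n≤1+n j)) (ℚ.≤-reflexive (sym (ℚ.+-identityˡ ε)))))
         (head-bound j))
    where
    open ℂ-Solver
    y : ℕ → ℂ
    y k = d k * (x ^ 1) ^ k
    M : ℚ
    M = proj₁ (convergent⇒bounded-terms (h 0))
    y≤M : ∀ k → ∥ y k ∥≤ M
    y≤M = proj₂ (convergent⇒bounded-terms (h 0))
    0≤M : 0ℚ ≤ℚ M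
    0≤M = ∥∥-nonNeg (y≤M 0)
    module _ (i : ℕ) where
      term : ℕ → ℂ
      term k = d k * (x ^ suc (suc i)) ^ k
      term≈ : ∀ k → y k * (x ^ suc i) ^ k ≈ term k
      term≈ k = ≈.trans (*-assoc (d k) ((x ^ 1) ^ k) ((x ^ suc i) ^ k))
        (*-cong ≈.refl (≈.trans (≈.sym (^-* (x ^ 1) (x ^ suc i) k))
          (^-cong (*-cong (ℂ-Ring.*-identityʳ x) ≈.refl) k)))
      term-bound : ∀ k → ∥ term (suc k) ∥≤ M *ℚ ¼ ^ℚ suc i *ℚ ¼ ^ℚ k
      term-bound k = ∥∥-mono
        (ℚ.≤-trans (ℚ.≤-reflexive (sym (ℚ.*-assoc M (¼ ^ℚ suc i) ((¼ ^ℚ suc i) ^ℚ k))))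
          (ℚ.*-monoˡ-≤-nonNeg (M *ℚ ¼ ^ℚ suc i) {{ℚ.nonNegative (0≤* 0≤M (^ℚ-nonNeg 0≤¼ (suc i)))}}
            (^ℚ-mono (^ℚ-nonNeg 0≤¼ (suc i)) (^ℚ-suc≤ i) k)))
        (∥∥-cong (term≈ (suc k)) (∥∥-* (y≤M (suc k)) (∥∥-^ (∥∥-^ x≤¼ (suc i)) (suc k))))
      head-bound : ∥ d 0 - 0ℂ ∥≤ + 2 / 1 *ℚ (M *ℚ ¼ ^ℚ suc i)
      head-bound = Lim-∥∥
        (Lim-cong (λ n → ≈.trans (+-cong ≈.refl (-‿cong (partialSum-suc term n)))
            (solve 2 (λ d s → d :- (d :* con 1ℚ :+ s) := :- s) ≈.refl (d 0) (partialSum (term ∘ suc) n)))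
          ≈.refl (Lim-+ (Lim-const (d 0)) (Lim-neg (Lim-suc (h (suc i))))))
        (λ n → ∥∥-neg (geometric-bound {c = M *ℚ ¼ ^ℚ suc i} term-bound n))

  -- Once the head is known to vanish, the series at X is X times the shifted series. As X is a
  -- power of the invertible x, it can be divided out, and the shifted sequence satisfies the same
  -- hypothesis.
  vanishesOnPowers⇒≈0 : ∀ d → VanishesOnPowers d → ∀ k → d k ≈ 0ℂ
  vanishesOnPowers⇒≈0 d h zero = vanishesOnPowers⇒head≈0 h
  vanishesOnPowers⇒≈0 d h (suc k) = vanishesOnPowers⇒≈0 (d ∘ suc) shifted k
    where
    open ℂ-Solver
    shifted : VanishesOnPowers (d ∘ suc)
    shifted j = Lim-cong eq (ℂ-Ring.zeroʳ X⁻¹) (Lim-*ˡ X⁻¹ (Lim-suc (h j)))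
      where
      X X⁻¹ : ℂ
      X = x ^ suc j
      X⁻¹ = x⁻¹ ^ suc j
      X⁻¹X : X⁻¹ * X ≈ 1ℂ
      X⁻¹X = ≈.trans (≈.sym (^-* x⁻¹ x (suc j))) (≈.trans (^-cong inverse (suc j)) (1^ (suc j)))
      eq : ∀ n → X⁻¹ * partialSum (λ k → d k * X ^ k) (suc n) ≈ partialSum (λ k → d (suc k) * X ^ k) n
      eq n = ≈.trans (*-cong (≈.refl {X⁻¹}) (≈.trans (partialSum-suc (λ k → d k * X ^ k) n)
          (+-cong (*-cong (vanishesOnPowers⇒head≈0 h) ≈.refl)
            (≈.trans (partialSum-cong (λ k →
                solve 3 (λ d X p → d :* (X :* p) := X :* (d :* p)) ≈.refl (d (suc k)) X (X ^ k)) n)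
              (partialSum-*ˡ X (λ k → d (suc k) * X ^ k) n)))))
        (≈.trans (solve 3 (λ v X s → v :* (con 0ℚ :* con 1ℚ :+ X :* s) := v :* X :* s) ≈.refl
            X⁻¹ X (partialSum (λ k → d (suc k) * X ^ k) n))
          (≈.trans (*-cong X⁻¹X ≈.refl) (*-identityˡ _)))

-- A with-abstraction here would normalise + n / 1, whose gcd unfolds without end.

floorℕ : ∀ M s → 0ℚ ≤ℚ s → s ≤ℚ + M / 1 →
  ∃[ n ] ∃[ t ] (s ≡ + n / 1 +ℚ t × 0ℚ ≤ℚ t × t <ℚ 1ℚ)
floorℕ zero s 0≤s s≤0 = 0 , s , sym (ℚ.+-identityˡ s) , 0≤s , ℚ.≤-<-trans s≤0 0<1
floorℕ (suc M) s 0≤s s≤ = byCases (s ℚ.<? 1ℚ)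
  where
  open +-*-Solver
  byCases : Dec (s <ℚ 1ℚ) → ∃[ n ] ∃[ t ] (s ≡ + n / 1 +ℚ t × 0ℚ ≤ℚ t × t <ℚ 1ℚ)
  byCases (yes s<1) = 0 , s , sym (ℚ.+-identityˡ s) , 0≤s , s<1
  byCases (no s≮1) = shift (floorℕ M (s -ℚ 1ℚ) (≤⇒0≤- (ℚ.≮⇒≥ s≮1)) s-1≤M)
    where
    s-1≤M : s -ℚ 1ℚ ≤ℚ + M / 1
    s-1≤M = subst (s -ℚ 1ℚ ≤ℚ_) (trans (cong (_-ℚ 1ℚ) (suc/1 M))
      (solve 1 (λ m → (con 1ℚ :+ m) :- con 1ℚ := m) refl (+ M / 1))) (ℚ.+-monoˡ-≤ (-ℚ 1ℚ) s≤)
    shift : ∃[ n ] ∃[ t ] (s -ℚ 1ℚ ≡ + n / 1 +ℚ t × 0ℚ ≤ℚ t × t <ℚ 1ℚ) →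
      ∃[ n ] ∃[ t ] (s ≡ + n / 1 +ℚ t × 0ℚ ≤ℚ t × t <ℚ 1ℚ)
    shift (n , t , eq , bounds) = suc n , t
      , trans (solve 1 (λ s → s := con 1ℚ :+ (s :- con 1ℚ)) refl s)
          (trans (cong (1ℚ +ℚ_) eq)
            (trans (sym (ℚ.+-assoc 1ℚ (+ n / 1) t)) (cong (_+ℚ t) (sym (suc/1 n)))))
      , bounds

unitInterval : ∀ r → ∃[ z ] ∃[ t ] (r ≡ z / 1 +ℚ t × 0ℚ ≤ℚ t × t <ℚ 1ℚ)
unitInterval r = translate (archimedean (-ℚ r))
  where
  open +-*-Solver
  translate : ∃[ N ] -ℚ r ≤ℚ + N / 1 → ∃[ z ] ∃[ t ] (r ≡ z / 1 +ℚ t × 0ℚ ≤ℚ t × t <ℚ 1ℚ)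
  translate (N , -r≤N) = untranslate (floorℕ (proj₁ M) (r +ℚ + N / 1) 0≤r+N (proj₂ M))
    where
    M : ∃[ M ] r +ℚ + N / 1 ≤ℚ + M / 1
    M = archimedean (r +ℚ + N / 1)
    0≤r+N : 0ℚ ≤ℚ r +ℚ + N / 1
    0≤r+N = subst (0ℚ ≤ℚ_) (solve 2 (λ r n → n :- (:- r) := r :+ n) refl r (+ N / 1)) (≤⇒0≤- -r≤N)
    untranslate : ∃[ n ] ∃[ t ] (r +ℚ + N / 1 ≡ + n / 1 +ℚ t × 0ℚ ≤ℚ t × t <ℚ 1ℚ) →
      ∃[ z ] ∃[ t ] (r ≡ z / 1 +ℚ t × 0ℚ ≤ℚ t × t <ℚ 1ℚ)
    untranslate (n , t , eq , bounds) = + n ℤ.- + N , t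
      , trans (solve 2 (λ r n → r := (r :+ n) :+ :- n) refl r (+ N / 1))
          (trans (cong (_+ℚ -ℚ (+ N / 1)) eq)
          (trans (solve 3 (λ n t m → (n :+ t) :+ :- m := (n :+ :- m) :+ t) refl (+ n / 1) t (+ N / 1))
            (cong (_+ℚ t) (trans
              (cong (+ n / 1 +ℚ_) (proj₂ (integer-neg {+ N / 1} (+ N , refl))))
              (/1-+ (+ n) (ℤ.- + N))))))
      , bounds

module SeriesProperties (E : Exponential) where
  open CircleProperties E public

  𝐞-½ : 𝐞 ½ ≈ - 1ℂ
  𝐞-½ = ≈.trans (𝐞-+ ¼ ¼) (≈.trans (*-cong 𝐞-¼ 𝐞-¼) (pointwiseℂ (λ _ → refl) (λ _ → refl)))

  𝐞-1 : 𝐞 1ℚ ≈ 1ℂ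
  𝐞-1 = ≈.trans (𝐞-+ ½ ½) (≈.trans (*-cong 𝐞-½ 𝐞-½) (solve 0 (:- con 1ℚ :* (:- con 1ℚ) := con 1ℚ) ≈.refl))
    where open ℂ-Solver

  𝐞-ℕ : ∀ n → 𝐞 (+ n / 1) ≈ 1ℂ
  𝐞-ℕ zero = e-0
  𝐞-ℕ (suc n) = ≈.trans (𝐞-cong (suc/1 n)) (≈.trans (𝐞-+ 1ℚ (+ n / 1))
    (≈.trans (*-cong 𝐞-1 (𝐞-ℕ n)) (*-identityˡ 1ℂ)))

  𝐞-integer : ∀ {r} → IsInteger r → 𝐞 r ≈ 1ℂ
  𝐞-integer (+ n , refl) = 𝐞-ℕ n
  𝐞-integer (ℤ.-[1+ n ] , refl) = ≈.trans (≈.sym (𝐞-conj (+ suc n / 1)))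
    (≈.trans (conj-cong (𝐞-ℕ (suc n))) (conj-ofℚ 1ℚ))

  𝐞-mod1 : ∀ {r s} → IsInteger (r -ℚ s) → 𝐞 r ≈ 𝐞 s
  𝐞-mod1 {r} {s} h = ≈.trans (𝐞-cong (solve 2 (λ r s → r := (r :- s) :+ s) refl r s))
    (≈.trans (𝐞-+ (r -ℚ s) s) (≈.trans (*-cong (𝐞-integer h) ≈.refl) (*-identityˡ (𝐞 s))))
    where open +-*-Solver

  -- 1 - e(t) = 2 cos(2πu) e(u) for u = t/2 - 1/4.
  𝐞-nonInteger-cancel : ∀ {r z} → ¬ IsInteger r → z ≈ 𝐞 r * z → z ≈ 0ℂ
  𝐞-nonInteger-cancel {r} {z} r∉ℤ z≈𝐞z = reduce (unitInterval r)
    where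
    open ℂ-Solver
    module Q = +-*-Solver
    reduce : ∃[ m ] ∃[ t ] (r ≡ m / 1 +ℚ t × 0ℚ ≤ℚ t × t <ℚ 1ℚ) → z ≈ 0ℂ
    reduce (m , t , r≡ , 0≤t , t<1) = ≈.trans (≈.sym (*-identityˡ z))
      (≈.trans (*-cong (≈.sym (∣𝐞∣ u)) ≈.refl)
      (≈.trans (solve 3 (λ a b z → a :* b :* z := b :* (z :* a)) ≈.refl (𝐞 u) (conj (𝐞 u)) z)
      (≈.trans (*-cong ≈.refl (cancel-0<Re {z * 𝐞 u} {𝐞 u + conj (𝐞 u)} product (0<ʳ-+ cos>0 cos>0)))
        (ℂ-Ring.zeroʳ (conj (𝐞 u))))))
      where
      -- For 0 < t < 1 this lies strictly between -¼ and ¼, where the cosine is positive; t = 0 is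
      -- excluded because r is not an integer.
      u : ℚ
      u = ½ *ℚ t -ℚ ¼
      0<t : 0ℚ <ℚ t
      0<t with ℚ.<-cmp 0ℚ t
      ... | tri< 0<t _ _ = 0<t
      ... | tri≈ _ 0≡t _ = contradiction
              (m , trans r≡ (trans (cong (m / 1 +ℚ_) (sym 0≡t)) (ℚ.+-identityʳ (m / 1)))) r∉ℤ
      ... | tri> _ _ t<0 = contradiction (ℚ.<-≤-trans t<0 0≤t) (ℚ.<-irrefl refl)
      cos>0 : 0ʳ <ʳ Re (𝐞 u)
      cos>0 with ℚ.≤-total 0ℚ u
      ... | inj₁ 0≤u = 0<Re-𝐞 u 0≤u (<-by (½ *ℚ (1ℚ -ℚ t)) (0<* 0<½ (<⇒0<- t<1))
            (Q.solve 1 (λ t →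
              Q.con ½ Q.:* t Q.:- Q.con ¼ Q.:+ Q.con ½ Q.:* (Q.con 1ℚ Q.:- t) Q.:= Q.con ¼) refl t))
      ... | inj₂ u≤0 = 0<ʳ-cong (Re-≈ (𝐞-cong (Q.solve 1 (λ u → Q.:- (Q.:- u) Q.:= u) refl u)))
            (0<Re-𝐞-neg (-ℚ u) (ℚ.neg-antimono-≤ u≤0) (<-by (½ *ℚ t) (0<* 0<½ 0<t)
              (Q.solve 1 (λ t →
                Q.:- (Q.con ½ Q.:* t Q.:- Q.con ¼) Q.:+ Q.con ½ Q.:* t Q.:= Q.con ¼) refl t)))
      𝐞r≈ : 𝐞 r ≈ - (𝐞 u * 𝐞 u)
      𝐞r≈ = ≈.trans (𝐞-cong r≡) (≈.trans (𝐞-+ (m / 1) t) (≈.trans (*-cong (𝐞-integer (m , refl))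
          (≈.trans (𝐞-cong (Q.solve 1 (λ t → t Q.:=
              (Q.con ½ Q.:* t Q.:- Q.con ¼) Q.:+ (Q.con ½ Q.:* t Q.:- Q.con ¼) Q.:+ Q.con ½) refl t))
          (≈.trans (𝐞-+ (u +ℚ u) ½) (*-cong (𝐞-+ u u) 𝐞-½))))
        (solve 1 (λ s → con 1ℚ :* (s :* :- con 1ℚ) := :- s) ≈.refl (𝐞 u * 𝐞 u))))
      product : z * 𝐞 u * (𝐞 u + conj (𝐞 u)) ≈ 0ℂ
      product = ≈.trans
        (solve 3 (λ z a b → z :* a :* (a :+ b) := z :* (a :* b) :- (:- (a :* a)) :* z) ≈.refl
          z (𝐞 u) (conj (𝐞 u)))
        (≈.trans (+-cong (≈.trans (*-cong ≈.refl (∣𝐞∣ u)) (≈.trans (ℂ-Ring.*-identityʳ z) z≈𝐞z))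
            (-‿cong (*-cong (≈.sym 𝐞r≈) ≈.refl)))
          (ℂ-Ring.-‿inverseʳ (𝐞 r * z)))

  e-ℕ* : ∀ n z → e (ofℤ (+ n) * z) ≈ e z ^ n
  e-ℕ* zero z = ≈.trans (e-cong (ℂ-Ring.zeroˡ z)) e-0
  e-ℕ* (suc n) z = ≈.trans
    (e-cong (≈.trans (*-cong (ofℤ-suc n) ≈.refl)
      (solve 2 (λ n z → (con 1ℚ :+ n) :* z := z :+ n :* z) ≈.refl (ofℤ (+ n)) z)))
    (≈.trans (e-+ z (ofℤ (+ n) * z)) (*-cong ≈.refl (e-ℕ* n z)))
    where open ℂ-Solver

  -- At the points τ = (j + 1) z of the imaginary axis, dividing by e(r₀ τ) leaves a power series in
  -- x^(j + 1) with x = e(z), to which the identity theorem applies.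
  qSeries-unique : ∀ (d : ℕ → ℂ) r₀ →
    (∀ τ → Lim (partialSum (λ k → d k * e (ofℚ (r₀ +ℚ + k / 1) * point τ))) 0ℂ) →
    ∀ k → d k ≈ 0ℂ
  qSeries-unique d r₀ h = vanishesOnPowers⇒≈0 (e-inverse z) x≤¼ d λ j →
    Lim-cong (λ n → ≈.trans (≈.sym (partialSum-*ˡ (e (- (ofℚ r₀ * point (τ j)))) (term j) n))
        (partialSum-cong (term≈ j) n))
      (ℂ-Ring.zeroʳ (e (- (ofℚ r₀ * point (τ j)))))
      (Lim-*ˡ (e (- (ofℚ r₀ * point (τ j)))) (h (τ j)))
    where
    open ℂ-Solver
    open SmallAngle smallAngle using (exponent; gap; 0<gap; decay)
    t : ℚ
    t = step exponent
    gap≤1 : gap ≤ℚ 1ℚ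
    gap≤1 = ≤-by (1ℚ -ℚ gap) (∥∥-nonNeg decay)
      (Q.solve 1 (λ g → g Q.:+ (Q.con 1ℚ Q.:- g) Q.:= Q.con 1ℚ) refl gap)
      where module Q = +-*-Solver
    small : ∃[ N ] (∀ n → N ℕ.≤ n → 1ℚ *ℚ (1ℚ -ℚ gap) ^ℚ n ≤ℚ ¼)
    small = ^ℚ-small 0<gap gap≤1 1ℚ ¼ (ℚ.<⇒≤ 0<1) (0<suc/ 0 4)
    N : ℕ
    -- The N-th power of the contraction is at most ¼; the successor makes N positive, so that the
    -- points τ j lie in the upper half plane.
    N = suc (proj₁ small)
    z : ℂ
    z = ofℤ (+ N) * (𝐢 * ofℚ t)
    x≤¼ : ∥ e z ∥≤ ¼
    x≤¼ = ∥∥-mono (ℚ.≤-trans (ℚ.≤-reflexive (sym (ℚ.*-identityˡ _))) (proj₂ small N (ℕ.n≤1+n _)))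
      (∥∥-cong (≈.sym (e-ℕ* N (𝐢 * ofℚ t))) (∥∥-^ decay N))
    τ : ℕ → ℍ
    τ j = mkℍ (ofℤ (+ suc j) * z) (0<ʳ-cong (Im-≈ (≈.sym imaginary)) (0<ʳ-by y 0<y 0 λ _ _ →
      ℚ.≤-reflexive (Q.solve 1 (λ y → y Q.:= Q.con 0ℚ Q.:* Q.con 0ℚ Q.:+ Q.con 1ℚ Q.:* y) refl y)))
      where
      module Q = +-*-Solver
      y : ℚ
      y = + suc j / 1 *ℚ (+ N / 1 *ℚ t)
      0<y : 0ℚ <ℚ y
      0<y = 0<* (0<suc/ j 1) (0<* (0<suc/ (proj₁ small) 1) (0<step exponent))
      imaginary : ofℤ (+ suc j) * z ≈ 𝐢 * ofℚ y
      imaginary = ≈.trans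
        (solve 4 (λ s m i t → s :* (m :* (i :* t)) := i :* (s :* (m :* t))) ≈.refl
          (ofℤ (+ suc j)) (ofℤ (+ N)) 𝐢 (ofℚ t))
        (*-cong ≈.refl (≈.sym (≈.trans (ofℚ-* (+ suc j / 1) (+ N / 1 *ℚ t))
          (*-cong ≈.refl (ofℚ-* (+ N / 1) t)))))
    term : ℕ → ℕ → ℂ
    term j k = d k * e (ofℚ (r₀ +ℚ + k / 1) * point (τ j))
    term≈ : ∀ j k → e (- (ofℚ r₀ * point (τ j))) * term j k ≈ d k * (e z ^ suc j) ^ k
    term≈ j k = ≈.trans
      (*-cong ≈.refl (*-cong ≈.refl (≈.trans
        (e-cong (≈.trans (*-cong (ofℚ-+ r₀ (+ k / 1)) ≈.refl) (*-distribʳ-+ p (ofℚ r₀) (ofℤ (+ k)))))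
        (e-+ (ofℚ r₀ * p) (ofℤ (+ k) * p)))))
      (≈.trans (solve 4 (λ v d a b → v :* (d :* (a :* b)) := v :* a :* (d :* b)) ≈.refl
        (e (- (ofℚ r₀ * p))) (d k) (e (ofℚ r₀ * p)) (e (ofℤ (+ k) * p)))
      (≈.trans (*-cong (e-inverse (ofℚ r₀ * p)) ≈.refl)
      (≈.trans (*-identityˡ (d k * e (ofℤ (+ k) * p)))
        (*-cong ≈.refl (≈.trans (e-ℕ* k p) (^-cong (e-ℕ* (suc j) z) k))))))
      where
      p : ℂ
      p = point (τ j)

-- The centre of Mp₂(ℤ) and the discriminant form

open Mp₂ℤ using (matrix; φ)

0<ʳ-cancelˡ : ∀ {x y} → 0ʳ <ʳ x → 0ʳ <ʳ x *ʳ y → 0ʳ <ʳ y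
0<ʳ-cancelˡ {x} {y} 0<x 0<xy =
  let g , 0<g , N , h = lowerBound 0<x
      g′ , 0<g′ , N′ , h′ = lowerBound 0<xy
      B , x≤B = ∥∥-bounded (ofℝ x)
      M , k = eventually x≤B 1ℚ 0<1
      -- Eventually x ≤ B + 1, so a product of at least g′ forces y ≥ g′ / (B + 1).
      δ , 0<δ , eq = 0<⇒∃quotient {B +ℚ 1ℚ} g′ (ℚ.+-mono-≤-< (∥∥-nonNeg x≤B) 0<1) 0<g′
  in 0<ʳ-by δ 0<δ (N ⊔ (N′ ⊔ M)) λ n n≥ →
       let N′M≤n = ℕ.m⊔n≤o⇒n≤o N (N′ ⊔ M) n≥
       in lower {seq x n} {seq y n} (ℚ.<-≤-trans 0<g (h n (ℕ.m⊔n≤o⇒m≤o N (N′ ⊔ M) n≥)))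
            (ℚ.≤-trans (p≤∣p∣ (seq x n)) (subst (_≤ℚ B +ℚ 1ℚ) (ℚ.+-identityʳ (∣ seq x n ∣))
              (k n (ℕ.m⊔n≤o⇒n≤o N′ M N′M≤n))))
            (ℚ.<⇒≤ 0<δ) eq (h′ n (ℕ.m⊔n≤o⇒m≤o N′ M N′M≤n))
  where
  lower : ∀ {a b B δ g} → 0ℚ <ℚ a → a ≤ℚ B → 0ℚ ≤ℚ δ → B *ℚ δ ≡ g → g ≤ℚ a *ℚ b → δ ≤ℚ b
  lower {a} {b} {B} {δ} 0<a a≤B 0≤δ refl g≤ab = ℚ.*-cancelˡ-≤-pos a {{ℚ.positive 0<a}}
    (ℚ.≤-trans (ℚ.*-monoʳ-≤-nonNeg δ {{ℚ.nonNegative 0≤δ}} a≤B) g≤ab)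

-- Im z² = 2 Re z Im z. Applied to w = τ, it places the principal √τ in the open first quadrant.
0<Im-sqrt : ∀ {z w} → z * z ≈ w → 0ʳ <ʳ Re z → 0ʳ <ʳ Im w → 0ʳ <ʳ Im z
0<Im-sqrt {z} z²≈w 0<Re 0<Im = 0<ʳ-cancelˡ (0<ʳ-+ 0<Re 0<Re) (0<ʳ-cong
  (≈ʳ-trans (≈ʳ-sym (Im-≈ z²≈w)) (pointwise λ n →
    solve 2 (λ a b → a :* b :+ b :* a := (a :+ a) :* b) refl (seq (Re z) n) (seq (Im z) n))) 0<Im)
  where open +-*-Solver

^2 : ∀ z → z ^ 2 ≈ z * z
^2 z = *-cong ≈.refl (ℂ-Ring.*-identityʳ z)

ofℤ-cong : ∀ {a b} → a ≡ b → ofℤ a ≈ ofℤ b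
ofℤ-cong refl = ≈.refl

const-holomorphic : ∀ z → IsHolomorphic (λ _ → z)
const-holomorphic z τ = 0ℂ , λ ε 0<ε → 1ℚ , 0<1 , λ σ _ (mk<ʳ g 0<g N h) →
  let x = seq (Re (point σ - point τ)) N
      y = seq (Im (point σ - point τ)) N
  in ℚ.<-irrefl refl (ℚ.<-≤-trans
       (<-by g 0<g refl)
       (ℚ.≤-trans (h N ℕ.≤-refl) (ℚ.≤-trans
         (ℚ.≤-reflexive (solve 4 (λ a b x y →
           ((a :+ :- a) :+ :- (con 0ℚ :* x :+ :- (con 0ℚ :* y)))
             :* ((a :+ :- a) :+ :- (con 0ℚ :* x :+ :- (con 0ℚ :* y)))
           :+ ((b :+ :- b) :+ :- (con 0ℚ :* y :+ con 0ℚ :* x))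
             :* ((b :+ :- b) :+ :- (con 0ℚ :* y :+ con 0ℚ :* x)) := con 0ℚ) refl
           (seq (Re z) N) (seq (Im z) N) x y))
         (0≤* (0≤* (ℚ.<⇒≤ 0<ε) (ℚ.<⇒≤ 0<ε)) (0≤+ (0≤square x) (0≤square y))))))
  where open +-*-Solver

constantMp : (A : SL₂ℤ) (z : ℂ) → (∀ τ → z ^ 2 ≈ j A τ) → Mp₂ℤ
constantMp A z z² = record
  { matrix = A
  ; φ = record { to = λ _ → z ; cong = λ _ → ≈.refl }
  ; holomorphic = const-holomorphic z
  ; φ² = z²
  }

module _ where
  open ℂ-Solver

  -- Z = (-I , i) generates the centre of Mp₂(ℤ) and has order 4.

  Z Z² 𝟙 : Mp₂ℤ
  Z = constantMp (mkSL₂ (ℤ.- + 1) (+ 0) (+ 0) (ℤ.- + 1) refl) 𝐢 λ τ →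
    ≈.trans (^2 𝐢) (≈.trans 𝐢²
      (solve 1 (λ τ → :- con 1ℚ := con 0ℚ :* τ :+ con ((ℤ.- + 1) / 1)) ≈.refl (point τ)))
  Z² = constantMp (mkSL₂ (+ 1) (+ 0) (+ 0) (+ 1) refl) (- 1ℂ) λ τ →
    solve 1 (λ τ → :- con 1ℚ :* (:- con 1ℚ :* con 1ℚ) := con 0ℚ :* τ :+ con 1ℚ) ≈.refl (point τ)
  𝟙 = constantMp (mkSL₂ (+ 1) (+ 0) (+ 0) (+ 1) refl) 1ℂ λ τ →
    solve 1 (λ τ → con 1ℚ :* (con 1ℚ :* con 1ℚ) := con 0ℚ :* τ :+ con 1ℚ) ≈.refl (point τ)

  Z∙Z : IsProduct Z Z Z²
  Z∙Z = record { entries = refl , refl , refl , refl ; φ-product = λ _ _ _ → ≈.sym 𝐢² }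

  Z²∙Z² : IsProduct Z² Z² 𝟙
  Z²∙Z² = record { entries = refl , refl , refl , refl ; φ-product = λ _ _ _ →
    solve 0 (con 1ℚ := :- con 1ℚ :* (:- con 1ℚ)) ≈.refl }

  𝟙-identity : IsIdentity 𝟙
  𝟙-identity = (refl , refl , refl , refl) , λ _ → ≈.refl

  Z-fixes : ∀ τ → τ ≐ matrix Z · τ
  Z-fixes τ = solve 1 (λ τ → (con 0ℚ :* τ :+ con ((ℤ.- + 1) / 1)) :* τ
    := con ((ℤ.- + 1) / 1) :* τ :+ con 0ℚ) ≈.refl (point τ)

  -- For σ = -1/τ the product of the branches √σ √τ squares to στ = -1. Both lie in the open first
  -- quadrant, so the product has positive imaginary part and is i rather than -i.
  S∙S : ∀ {S} → IsS S → IsProduct S S Z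
  S∙S {S} ((a≡0 , b≡-1 , c≡1 , d≡0) , 0<Re) = record
    { entries = square a≡0 b≡-1 c≡1 d≡0
    ; φ-product = λ τ σ σ≐ → ≈.sym (z²≈-1⇒z≈𝐢
        (≈.trans (solve 2 (λ p r → r :* p :* (r :* p) := p :* p :* (r :* r)) ≈.refl (φ S ⟨$⟩ τ) (φ S ⟨$⟩ σ))
          (≈.trans (*-cong (φ²≈ τ) (φ²≈ σ)) (≈.trans (*-cong (≈.sym (j≈ τ)) ≈.refl) (≈.trans σ≐ (right τ)))))
        (0<ʳ-+ (0<ʳ-* (0<Re σ) (0<Im-φ τ)) (0<ʳ-* (0<Im-φ σ) (0<Re τ))))
    }
    where
    square : ∀ {a b c d} → a ≡ + 0 → b ≡ ℤ.- + 1 → c ≡ + 1 → d ≡ + 0 →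
      HasEntries Z (a ℤ.* a ℤ.+ b ℤ.* c) (a ℤ.* b ℤ.+ b ℤ.* d)
        (c ℤ.* a ℤ.+ d ℤ.* c) (c ℤ.* b ℤ.+ d ℤ.* d)
    square refl refl refl refl = refl , refl , refl , refl
    j≈ : ∀ τ → j (matrix S) τ ≈ point τ
    j≈ τ = ≈.trans (+-cong (*-cong (ofℤ-cong c≡1) ≈.refl) (ofℤ-cong d≡0))
      (solve 1 (λ τ → con 1ℚ :* τ :+ con 0ℚ := τ) ≈.refl (point τ))
    right : ∀ τ → ofℤ (SL₂ℤ.a (matrix S)) * point τ + ofℤ (SL₂ℤ.b (matrix S)) ≈ - 1ℂ
    right τ = ≈.trans (+-cong (*-cong (ofℤ-cong a≡0) ≈.refl) (ofℤ-cong b≡-1))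
      (solve 1 (λ τ → con 0ℚ :* τ :+ con ((ℤ.- + 1) / 1) := :- con 1ℚ) ≈.refl (point τ))
    φ²≈ : ∀ τ → (φ S ⟨$⟩ τ) * (φ S ⟨$⟩ τ) ≈ point τ
    φ²≈ τ = ≈.trans (≈.sym (^2 (φ S ⟨$⟩ τ))) (≈.trans (Mp₂ℤ.φ² S τ) (j≈ τ))
    0<Im-φ : ∀ τ → 0ʳ <ʳ Im (φ S ⟨$⟩ τ)
    0<Im-φ τ = 0<Im-sqrt (φ²≈ τ) (0<Re τ) (0<Im τ)

-- Finite sums and the pairing on the dual lattice

module ℂ-Sum = Algebra.Properties.Semiring.Sum ℂ-Ring.semiring

sum-single : ∀ {n} (f : Fin n → ℂ) i → (∀ k → k ≢ i → f k ≈ 0ℂ) → ℂ-Sum.sum f ≈ f i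
sum-single {suc n} f Fin.zero h = ≈.trans (+-cong (≈.refl {f Fin.zero}) (≈.trans
    (ℂ-Sum.sum-cong-≋ (λ k → h (Fin.suc k) λ ())) (ℂ-Sum.sum-replicate-zero n)))
  (ℂ-Ring.+-identityʳ (f Fin.zero))
sum-single {suc n} f (Fin.suc i) h = ≈.trans
  (+-cong (h Fin.zero λ ()) (sum-single (f ∘ Fin.suc) i λ k k≢i → h (Fin.suc k) (k≢i ∘ Fin.suc-injective)))
  (+-identityˡ (f (Fin.suc i)))

sum-ones : ∀ n (f : Fin n → ℂ) → (∀ k → f k ≈ 1ℂ) → ℂ-Sum.sum f ≈ ofℚ (+ n / 1)
sum-ones zero f h = ≈.refl
sum-ones (suc n) f h = ≈.trans (+-cong (h Fin.zero) (sum-ones n (f ∘ Fin.suc) (h ∘ Fin.suc)))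
  (≈.sym (ofℤ-suc n))

module ℚ-Sum = Algebra.Properties.CommutativeMonoid.Sum ℚ.+-0-commutativeMonoid

module PairingProperties {n : ℕ} (L : EvenLattice n) where
  open EvenLattice L
  open Discriminant L public

  ⟪⟫-congʳ : ∀ x {y y′} → (∀ i → y i ≡ y′ i) → ⟪ x , y ⟫ ≡ ⟪ x , y′ ⟫
  ⟪⟫-congʳ x h = ℚ-Sum.sum-cong-≗ λ i → ℚ-Sum.sum-cong-≗ λ k →
    cong (λ t → gram i k / 1 *ℚ (x i *ℚ t)) (h k)

  ⟪⟫-sym : ∀ x y → ⟪ x , y ⟫ ≡ ⟪ y , x ⟫
  ⟪⟫-sym x y = trans (ℚ-Sum.∑-comm λ i k → gram i k / 1 *ℚ (x i *ℚ y k))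
    (ℚ-Sum.sum-cong-≗ λ k → ℚ-Sum.sum-cong-≗ λ i →
      cong₂ _*ℚ_ (cong (_/ 1) (symmetric i k)) (ℚ.*-comm (x i) (y k)))

  ⟪⟫-+ʳ : ∀ x y z → ⟪ x , (λ i → y i +ℚ z i) ⟫ ≡ ⟪ x , y ⟫ +ℚ ⟪ x , z ⟫
  ⟪⟫-+ʳ x y z = trans
    (ℚ-Sum.sum-cong-≗ λ i → trans
      (ℚ-Sum.sum-cong-≗ λ k → solve 4 (λ g x y z → g :* (x :* (y :+ z)) := g :* (x :* y) :+ g :* (x :* z)) refl
        (gram i k / 1) (x i) (y k) (z k))
      (ℚ-Sum.∑-distrib-+ (λ k → gram i k / 1 *ℚ (x i *ℚ y k)) (λ k → gram i k / 1 *ℚ (x i *ℚ z k))))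
    (ℚ-Sum.∑-distrib-+ (λ i → ℚ-Sum.sum λ k → gram i k / 1 *ℚ (x i *ℚ y k))
                       (λ i → ℚ-Sum.sum λ k → gram i k / 1 *ℚ (x i *ℚ z k)))
    where open +-*-Solver

  ⟪⟫-+ˡ : ∀ x y z → ⟪ (λ i → x i +ℚ y i) , z ⟫ ≡ ⟪ x , z ⟫ +ℚ ⟪ y , z ⟫
  ⟪⟫-+ˡ x y z = trans (⟪⟫-sym _ z) (trans (⟪⟫-+ʳ z x y) (cong₂ _+ℚ_ (⟪⟫-sym z x) (⟪⟫-sym z y)))

  ⟪⟫-0ʳ : ∀ x → ⟪ x , (λ _ → 0ℚ) ⟫ ≡ 0ℚ
  ⟪⟫-0ʳ x = trans
    (ℚ-Sum.sum-cong-≗ λ i → trans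
      (ℚ-Sum.sum-cong-≗ λ k → solve 2 (λ g x → g :* (x :* con 0ℚ) := con 0ℚ) refl (gram i k / 1) (x i))
      (ℚ-Sum.sum-replicate-zero n))
    (ℚ-Sum.sum-replicate-zero n)
    where open +-*-Solver

  ⟪⟫-negʳ : ∀ x y → ⟪ x , (λ i → -ℚ y i) ⟫ ≡ -ℚ ⟪ x , y ⟫
  ⟪⟫-negʳ x y = trans
    (solve 2 (λ s t → t := (s :+ t) :- s) refl ⟪ x , y ⟫ ⟪ x , (λ i → -ℚ y i) ⟫)
    (trans (cong (_-ℚ ⟪ x , y ⟫) (trans (sym (⟪⟫-+ʳ x y (λ i → -ℚ y i)))
      (trans (⟪⟫-congʳ x (λ i → ℚ.+-inverseʳ (y i))) (⟪⟫-0ʳ x))))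
      (ℚ.+-identityˡ _))
    where open +-*-Solver

  ⟪⟫-negˡ : ∀ x y → ⟪ (λ i → -ℚ x i) , y ⟫ ≡ -ℚ ⟪ x , y ⟫
  ⟪⟫-negˡ x y = trans (⟪⟫-sym _ y) (trans (⟪⟫-negʳ y x) (cong -ℚ_ (⟪⟫-sym y x)))

  ⟨⟩-sym : ∀ γ δ → ⟨ γ , δ ⟩ ≡ ⟨ δ , γ ⟩
  ⟨⟩-sym γ δ = ⟪⟫-sym (vec γ) (vec δ)

  -- Representatives of one coset differ by a lattice vector, with which a dual vector pairs
  -- integrally.
  ⟨⟩-congʳ : ∀ γ {δ δ′} → δ ∼ δ′ → IsInteger (⟨ γ , δ ⟩ -ℚ ⟨ γ , δ′ ⟩)
  ⟨⟩-congʳ γ {δ} {δ′} (mk∼ h) = subst IsInteger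
    (trans (⟪⟫-congʳ (vec γ) (λ i → sym (proj₂ (h i))))
      (trans (⟪⟫-+ʳ (vec γ) (vec δ) (λ i → -ℚ vec δ′ i)) (cong (⟨ γ , δ ⟩ +ℚ_) (⟪⟫-negʳ (vec γ) (vec δ′)))))
    (integral γ (λ i → proj₁ (h i)))

  infixl 6 _⊞_

  _⊞_ : Dual → Dual → Dual
  vec (γ ⊞ δ) i = vec γ i +ℚ vec δ i
  integral (γ ⊞ δ) y = subst IsInteger (sym (⟪⟫-+ˡ (vec γ) (vec δ) (ι y)))
    (integer-+ {⟪ vec γ , ι y ⟫} {⟪ vec δ , ι y ⟫} (integral γ y) (integral δ y))

  ⊞-congˡ : ∀ {γ γ′} δ → γ ∼ γ′ → γ ⊞ δ ∼ γ′ ⊞ δ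
  ⊞-congˡ {γ} {γ′} δ (mk∼ h) = mk∼ λ i → subst IsInteger
    (solve 3 (λ a b c → a :- b := (a :+ c) :- (b :+ c)) refl (vec γ i) (vec γ′ i) (vec δ i)) (h i)
    where open +-*-Solver

  ≡⇒∼ : ∀ {γ δ} → (∀ i → vec γ i ≡ vec δ i) → γ ∼ δ
  ≡⇒∼ {γ} {δ} h = mk∼ λ i →
    subst IsInteger (sym (trans (cong (_-ℚ vec δ i) (h i)) (ℚ.+-inverseʳ (vec δ i)))) integer-0

  neg-cong : ∀ {γ δ} → γ ∼ δ → neg γ ∼ neg δ
  neg-cong {γ} {δ} (mk∼ h) = mk∼ λ i → subst IsInteger
    (solve 2 (λ a b → :- (a :- b) := :- a :- :- b) refl (vec γ i) (vec δ i)) (integer-neg {vec γ i -ℚ vec δ i} (h i))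
    where open +-*-Solver

  neg-involutive : ∀ γ → neg (neg γ) ∼ γ
  neg-involutive γ = ≡⇒∼ λ i → solve 1 (λ a → :- (:- a) := a) refl (vec γ i)
    where open +-*-Solver

  twoTorsion⇒neg∼ : ∀ {γ} → IsTwoTorsion γ → neg γ ∼ γ
  twoTorsion⇒neg∼ {γ} h = mk∼ λ i → subst IsInteger
    (solve 1 (λ a → :- (a :+ a) := :- a :- a) refl (vec γ i)) (integer-neg {vec γ i +ℚ vec γ i} (h i))
    where open +-*-Solver

  q-neg : ∀ γ → q (neg γ) ≡ q γ
  q-neg γ = cong (½ *ℚ_) (trans (⟪⟫-negˡ (vec γ) (vec (neg γ)))
    (trans (cong -ℚ_ (⟪⟫-negʳ (vec γ) (vec γ))) (solve 1 (λ a → :- (:- a) := a) refl ⟨ γ , γ ⟩)))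
    where open +-*-Solver

  𝔢-∼ : ∀ {γ δ} → γ ∼ δ → 𝔢 γ ⟨$⟩ δ ≈ 1ℂ
  𝔢-∼ {γ} {δ} γ∼δ with γ ∼? δ
  ... | yes _ = ≈.refl
  ... | no γ≁δ = contradiction γ∼δ γ≁δ

  𝔢-≁ : ∀ {γ δ} → ¬ γ ∼ δ → 𝔢 γ ⟨$⟩ δ ≈ 0ℂ
  𝔢-≁ {γ} {δ} γ≁δ with γ ∼? δ
  ... | yes γ∼δ = contradiction γ∼δ γ≁δ
  ... | no _ = ≈.refl

  0≉1 : ¬ 0ℂ ≈ 1ℂ
  0≉1 h = let N , k = close (Re-≈ h) ½ 0<½ in
    ℚ.<-irrefl refl (ℚ.<-≤-trans (<-by {½} {1ℚ} ½ 0<½ refl) (k N ℕ.≤-refl))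

  𝔢-injective : ∀ {γ δ} → 𝔢 γ ≋ 𝔢 δ → γ ∼ δ
  𝔢-injective {γ} {δ} h with γ ∼? δ
  ... | yes γ∼δ = γ∼δ
  ... | no γ≁δ = contradiction
        (≈.trans (≈.sym (𝔢-≁ γ≁δ)) (≈.trans (h δ) (𝔢-∼ (∼-refl {δ})))) 0≉1

-- The action of Z in the Weil representation

module WeilProperties (E : Exponential) {n : ℕ} (L : EvenLattice n)
  (W : ModularForms.WeilRepresentation E L) where
  open SeriesProperties E
  open PairingProperties L
  open ModularForms E L
  open WeilRepresentation W

  element : Fin order → Dual
  element = Inverse.to size

  index : Dual → Fin order
  index = Inverse.from size

  element-index : ∀ γ → element (index γ) ∼ γ
  element-index = Inverse.strictlyInverseˡ size

  index-∼ : ∀ {γ k} → element k ∼ γ → index γ ≡ k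
  index-∼ h = Inverse.inverseʳ size (∼-sym h)

  ρ-congʳ : ∀ M {u v} → u ≋ v → ρ M u ≋ ρ M v
  ρ-congʳ M = ρ-cong {M} {M} ((refl , refl , refl , refl) , λ _ → ≈.refl)

  𝟎 : ℂ[𝒟]
  𝟎 = record { to = λ _ → 0ℂ ; cong = λ _ → ≈.refl }

  ρ-𝟎 : ∀ M → ρ M 𝟎 ≋ 𝟎
  ρ-𝟎 M γ = ≈.trans (ρ-congʳ M {𝟎} {0ℂ · 𝟎} (λ _ → ≈.sym (ℂ-Ring.zeroˡ 0ℂ)) γ)
    (≈.trans (ρ-· M 0ℂ 𝟎 γ) (ℂ-Ring.zeroˡ (ρ M 𝟎 ⟨$⟩ γ)))

  ⨁ : ∀ {m} → (Fin m → ℂ[𝒟]) → ℂ[𝒟]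
  ⨁ {zero} v = 𝟎
  ⨁ {suc m} v = v Fin.zero ⊕ ⨁ (v ∘ Fin.suc)

  ⨁-coordinate : ∀ {m} (v : Fin m → ℂ[𝒟]) γ → ⨁ v ⟨$⟩ γ ≈ ℂ-Sum.sum (λ k → v k ⟨$⟩ γ)
  ⨁-coordinate {zero} v γ = ≈.refl
  ⨁-coordinate {suc m} v γ = +-cong ≈.refl (⨁-coordinate (v ∘ Fin.suc) γ)

  ρ-⨁ : ∀ M {m} (v : Fin m → ℂ[𝒟]) γ → ρ M (⨁ v) ⟨$⟩ γ ≈ ℂ-Sum.sum (λ k → ρ M (v k) ⟨$⟩ γ)
  ρ-⨁ M {zero} v γ = ρ-𝟎 M γ
  ρ-⨁ M {suc m} v γ = ≈.trans (ρ-⊕ M (v Fin.zero) (⨁ (v ∘ Fin.suc)) γ)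
    (+-cong ≈.refl (ρ-⨁ M (v ∘ Fin.suc) γ))

  basisTerm : ℂ[𝒟] → Fin order → ℂ[𝒟]
  basisTerm u k = (u ⟨$⟩ element k) · 𝔢 (element k)

  basis-expansion : ∀ u → u ≋ ⨁ (basisTerm u)
  basis-expansion u γ = ≈.sym (≈.trans (⨁-coordinate (basisTerm u) γ) (≈.trans
    (sum-single (λ k → (u ⟨$⟩ element k) * (𝔢 (element k) ⟨$⟩ γ)) (index γ) λ k k≢ →
      ≈.trans (*-cong ≈.refl (𝔢-≁ {element k} {γ} λ h → k≢ (sym (index-∼ h)))) (ℂ-Ring.zeroʳ (u ⟨$⟩ element k)))
    (≈.trans (*-cong (Func.cong u (element-index γ)) (𝔢-∼ {element (index γ)} {γ} (element-index γ)))
      (ℂ-Ring.*-identityʳ (u ⟨$⟩ γ)))))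

  -- `ρ-S` prescribes only the images of basis vectors. Linearity over the finite basis extends this
  -- to ρ S (𝔢 γ), which is needed to compute ρ(S)².
  ρ-matrix : ∀ M u γ → ρ M u ⟨$⟩ γ ≈
    ℂ-Sum.sum (λ k → (u ⟨$⟩ element k) * (ρ M (𝔢 (element k)) ⟨$⟩ γ))
  ρ-matrix M u γ = ≈.trans (ρ-congʳ M {u} {⨁ (basisTerm u)} (basis-expansion u) γ) (≈.trans (ρ-⨁ M (basisTerm u) γ)
    (ℂ-Sum.sum-cong-≋ {order} {λ k → ρ M (basisTerm u k) ⟨$⟩ γ} λ k → ρ-· M (u ⟨$⟩ element k) (𝔢 (element k)) γ))

  ρ-S² : ∀ u → ρ Z u ≋ ρ S (ρ S u)
  ρ-S² u = ρ-∙ S S Z u (S∙S isS)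

  -- S² = Z and Z⁴ = 1, so ρ(Z²) ρ(Z) ρ(S) is a left inverse of ρ(S).
  ρ-S-injective : ∀ {u v} → ρ S u ≋ ρ S v → u ≋ v
  ρ-S-injective {u} {v} h γ = ≈.trans (≈.sym (inverse u γ)) (≈.trans
    (ρ-congʳ Z² {ρ Z (ρ S (ρ S u))} {ρ Z (ρ S (ρ S v))}
      (ρ-congʳ Z {ρ S (ρ S u)} {ρ S (ρ S v)} (ρ-congʳ S {ρ S u} {ρ S v} h)) γ)
    (inverse v γ))
    where
    inverse : ∀ u → ρ Z² (ρ Z (ρ S (ρ S u))) ≋ u
    inverse u γ = ≈.trans
      (ρ-congʳ Z² {ρ Z (ρ S (ρ S u))} {ρ Z² u} (λ δ → ≈.trans
        (ρ-congʳ Z {ρ S (ρ S u)} {ρ Z u} (λ η → ≈.sym (ρ-S² u η)) δ)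
        (≈.sym (ρ-∙ Z Z Z² u Z∙Z δ))) γ)
      (≈.trans (≈.sym (ρ-∙ Z² Z² 𝟙 u Z²∙Z² γ)) (ρ-id 𝟙 u 𝟙-identity γ))

  pairing : Dual → Dual → ℂ
  pairing γ δ = 𝐞 (-ℚ ⟨ γ , δ ⟩)

  pairing-sym : ∀ γ δ → pairing γ δ ≈ pairing δ γ
  pairing-sym γ δ = 𝐞-cong (cong -ℚ_ (⟨⟩-sym γ δ))

  pairing-congʳ : ∀ γ {δ δ′} → δ ∼ δ′ → pairing γ δ ≈ pairing γ δ′
  pairing-congʳ γ {δ} {δ′} h = 𝐞-mod1 (subst IsInteger
    (solve 2 (λ a b → :- (a :- b) := :- a :- :- b) refl ⟨ γ , δ ⟩ ⟨ γ , δ′ ⟩)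
    (integer-neg {⟨ γ , δ ⟩ -ℚ ⟨ γ , δ′ ⟩} (⟨⟩-congʳ γ h)))
    where open +-*-Solver

  pairing-⊞ʳ : ∀ γ δ δ₀ → pairing γ (δ ⊞ δ₀) ≈ pairing γ δ * pairing γ δ₀
  pairing-⊞ʳ γ δ δ₀ = ≈.trans
    (𝐞-cong (trans (cong -ℚ_ (⟪⟫-+ʳ (vec γ) (vec δ) (vec δ₀))) (ℚ.neg-distrib-+ ⟨ γ , δ ⟩ ⟨ γ , δ₀ ⟩)))
    (𝐞-+ (-ℚ ⟨ γ , δ ⟩) (-ℚ ⟨ γ , δ₀ ⟩))

  ⟨neg⟩ : ∀ γ δ → ⟨ neg γ , δ ⟩ ≡ -ℚ ⟨ γ , δ ⟩
  ⟨neg⟩ γ δ = ⟪⟫-negˡ (vec γ) (vec δ)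

  -- If ε and -γ pair alike with every δ, then ρ(S) 𝔢_ε = ρ(S) 𝔢_{-γ}.
  nondegenerate : ∀ {γ ε} → (∀ δ → IsInteger (⟨ γ , δ ⟩ +ℚ ⟨ ε , δ ⟩)) → ε ∼ neg γ
  nondegenerate {γ} {ε} h = 𝔢-injective {ε} {neg γ} (ρ-S-injective {𝔢 ε} {𝔢 (neg γ)} λ δ →
    ≈.trans (ρ-S ε δ) (≈.trans (*-cong ≈.refl (𝐞-mod1 (subst IsInteger
      (trans (solve 2 (λ a b → :- (a :+ b) := :- b :- a) refl ⟨ γ , δ ⟩ ⟨ ε , δ ⟩)
        (trans (solve 2 (λ a b → :- b :- a := :- b :- :- (:- a)) refl ⟨ γ , δ ⟩ ⟨ ε , δ ⟩)
          (cong (λ t → -ℚ ⟨ ε , δ ⟩ -ℚ -ℚ t) (sym (⟨neg⟩ γ δ)))))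
      (integer-neg {⟨ γ , δ ⟩ +ℚ ⟨ ε , δ ⟩} (h δ))))) (≈.sym (ρ-S (neg γ) δ))))
    where open +-*-Solver

  -- The character δ ↦ e(-(γ + ε, δ)), kept in the factored form in which two applications of ρ(S)
  -- produce it.
  character : Dual → Dual → Dual → ℂ
  character γ ε δ = pairing γ δ * pairing δ ε

  character-cong : ∀ γ ε {δ δ′} → δ ∼ δ′ → character γ ε δ ≈ character γ ε δ′
  character-cong γ ε {δ} {δ′} h = *-cong (pairing-congʳ γ h)
    (≈.trans (pairing-sym δ ε) (≈.trans (pairing-congʳ ε h) (pairing-sym ε δ′)))

  character-value : ∀ γ ε δ → character γ ε δ ≈ 𝐞 (-ℚ (⟨ γ , δ ⟩ +ℚ ⟨ ε , δ ⟩))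
  character-value γ ε δ = ≈.trans (*-cong ≈.refl (pairing-sym δ ε))
    (≈.trans (≈.sym (𝐞-+ (-ℚ ⟨ γ , δ ⟩) (-ℚ ⟨ ε , δ ⟩)))
      (𝐞-cong (sym (ℚ.neg-distrib-+ ⟨ γ , δ ⟩ ⟨ ε , δ ⟩))))

  character-⊞ : ∀ γ ε δ δ₀ → character γ ε (δ ⊞ δ₀) ≈ character γ ε δ₀ * character γ ε δ
  character-⊞ γ ε δ δ₀ = ≈.trans
    (*-cong (pairing-⊞ʳ γ δ δ₀) (≈.trans (pairing-sym (δ ⊞ δ₀) ε) (≈.trans (pairing-⊞ʳ ε δ δ₀)
      (*-cong (pairing-sym ε δ) (pairing-sym ε δ₀)))))
    (solve 4 (λ a b c d → a :* b :* (c :* d) := b :* d :* (a :* c)) ≈.refl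
      (pairing γ δ) (pairing γ δ₀) (pairing δ ε) (pairing δ₀ ε))
    where open ℂ-Solver

  translation : Dual → Permutation order order
  translation δ₀ = permutation
    (λ k → index (element k ⊞ δ₀)) (λ k → index (element k ⊞ neg δ₀))
    (λ k → cancel (neg δ₀) δ₀ k λ i →
      solve 2 (λ a b → a :+ :- b :+ b := a) refl (vec (element k) i) (vec δ₀ i))
    (λ k → cancel δ₀ (neg δ₀) k λ i →
      solve 2 (λ a b → a :+ b :+ :- b := a) refl (vec (element k) i) (vec δ₀ i))
    where
    open +-*-Solver
    cancel : ∀ δ δ′ k → (∀ i → vec (element k ⊞ δ ⊞ δ′) i ≡ vec (element k) i) →
      index (element (index (element k ⊞ δ)) ⊞ δ′) ≡ k
    cancel δ δ′ k h = index-∼ (∼-sym (∼-trans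
      (⊞-congˡ δ′ (element-index (element k ⊞ δ))) (≡⇒∼ h)))

  characterSum : Dual → Dual → ℂ
  characterSum γ ε = ℂ-Sum.sum (λ k → character γ ε (element k))

  -- Translating the summation by δ₀ multiplies the sum by e(r) with r = -(γ + ε, δ₀), so a δ₀ with
  -- non-integral r makes it vanish. If every r were integral, nondegeneracy would give ε ∼ -γ; as 𝒟
  -- is finite and integrality decidable, a witness δ₀ can be found.
  characterSum-≁ : ∀ {γ ε} → ¬ ε ∼ neg γ → characterSum γ ε ≈ 0ℂ
  characterSum-≁ {γ} {ε} ε≁-γ = 𝐞-nonInteger-cancel {r} r∉ℤ
    (≈.trans (ℂ-Sum.sum-permute (λ k → character γ ε (element k)) (translation δ₀))
      (≈.trans (ℂ-Sum.sum-cong-≋ λ k →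
          ≈.trans (character-cong γ ε (element-index (element k ⊞ δ₀)))
            (≈.trans (character-⊞ γ ε (element k) δ₀) (*-cong (character-value γ ε δ₀) ≈.refl)))
        (≈.sym (ℂ-Sum.*-distribˡ-sum (𝐞 r) (λ k → character γ ε (element k))))))
    where
    IntegralAt : Dual → Set
    IntegralAt δ = IsInteger (⟨ γ , δ ⟩ +ℚ ⟨ ε , δ ⟩)
    IntegralAt-∼ : ∀ {δ δ′} → δ ∼ δ′ → IntegralAt δ → IntegralAt δ′
    IntegralAt-∼ {δ} {δ′} h p = subst IsInteger
      (solve 4 (λ a b c d → (a :+ b) :+ ((c :- a) :+ (d :- b)) := c :+ d) refl
        ⟨ γ , δ ⟩ ⟨ ε , δ ⟩ ⟨ γ , δ′ ⟩ ⟨ ε , δ′ ⟩)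
      (integer-+ {⟨ γ , δ ⟩ +ℚ ⟨ ε , δ ⟩} {(⟨ γ , δ′ ⟩ -ℚ ⟨ γ , δ ⟩) +ℚ (⟨ ε , δ′ ⟩ -ℚ ⟨ ε , δ ⟩)} p
        (integer-+ {⟨ γ , δ′ ⟩ -ℚ ⟨ γ , δ ⟩} {⟨ ε , δ′ ⟩ -ℚ ⟨ ε , δ ⟩}
          (⟨⟩-congʳ γ (∼-sym h)) (⟨⟩-congʳ ε (∼-sym h))))
      where open +-*-Solver
    witness : ∃[ k ] ¬ IntegralAt (element k)
    witness = Fin.¬∀⟶∃¬ order (IntegralAt ∘ element)
      (λ k → integer? (⟨ γ , element k ⟩ +ℚ ⟨ ε , element k ⟩))
      (λ h → ε≁-γ (nondegenerate λ δ → IntegralAt-∼ (element-index δ) (h (index δ))))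
    δ₀ : Dual
    δ₀ = element (proj₁ witness)
    s r : ℚ
    s = ⟨ γ , δ₀ ⟩ +ℚ ⟨ ε , δ₀ ⟩
    r = -ℚ s
    r∉ℤ : ¬ IsInteger r
    r∉ℤ h = proj₂ witness (subst IsInteger (solve 1 (λ s → :- (:- s) := s) refl s) (integer-neg {r} h))
      where open +-*-Solver

  characterSum-∼ : ∀ {γ ε} → ε ∼ neg γ → characterSum γ ε ≈ ofℚ (+ order / 1)
  characterSum-∼ {γ} {ε} ε∼-γ = sum-ones order _ λ k → let δ = element k in
    ≈.trans (*-cong ≈.refl (≈.trans (pairing-congʳ δ ε∼-γ) (pairing-sym δ (neg γ))))
      (≈.trans (character-dual γ δ) e-0)
    where
    character-dual : ∀ γ δ → pairing γ δ * pairing (neg γ) δ ≈ 𝐞 0ℚ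
    character-dual γ δ = ≈.trans (≈.sym (𝐞-+ (-ℚ ⟨ γ , δ ⟩) (-ℚ ⟨ neg γ , δ ⟩)))
      (𝐞-cong (trans (cong (λ t → -ℚ ⟨ γ , δ ⟩ +ℚ -ℚ t) (⟨neg⟩ γ δ)) (ℚ.+-inverseʳ (-ℚ ⟨ γ , δ ⟩))))

  c : ℂ
  c = 𝐞 (ℤ.- + 1 / 8) * ofℝ 1/√∣𝒟∣

  -- The factor 1/√|𝒟|, taken twice, cancels the value |𝒟| of the nonvanishing character sum. What
  -- remains is e(-1/8)² = e(-1/4), the conjugate of e(1/4).
  c²*order : c * c * ofℚ (+ order / 1) ≈ - 𝐢
  c²*order = ≈.trans
    (solve 3 (λ e s o → e :* s :* (e :* s) :* o := e :* e :* (s :* s :* o)) ≈.refl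
      (𝐞 (ℤ.- + 1 / 8)) (ofℝ 1/√∣𝒟∣) (ofℚ (+ order / 1)))
    (≈.trans (*-cong
      (≈.trans (≈.sym (𝐞-+ (ℤ.- + 1 / 8) (ℤ.- + 1 / 8)))
        (≈.trans (≈.sym (𝐞-conj ¼)) (≈.trans (conj-cong 𝐞-¼) (pointwiseℂ (λ _ → refl) (λ _ → refl)))))
      (≈.trans (pointwiseℂ
          (λ m → Q.solve 2 (λ s o → (s Q.:* s Q.:+ Q.:- (Q.con 0ℚ Q.:* Q.con 0ℚ)) Q.:* o
            Q.:+ Q.:- ((s Q.:* Q.con 0ℚ Q.:+ Q.con 0ℚ Q.:* s) Q.:* Q.con 0ℚ) Q.:= s Q.:* s Q.:* o) refl
            (seq 1/√∣𝒟∣ m) (+ order / 1))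
          (λ m → Q.solve 2 (λ s o → (s Q.:* s Q.:+ Q.:- (Q.con 0ℚ Q.:* Q.con 0ℚ)) Q.:* Q.con 0ℚ
            Q.:+ (s Q.:* Q.con 0ℚ Q.:+ Q.con 0ℚ Q.:* s) Q.:* o Q.:= Q.con 0ℚ) refl
            (seq 1/√∣𝒟∣ m) (+ order / 1)))
        (mk≈ 1/√² ≈ʳ-refl)))
      (ℂ-Ring.*-identityʳ (- 𝐢)))
    where
    open ℂ-Solver
    module Q = +-*-Solver

  ρ-Z-𝔢 : ∀ γ ε → ρ Z (𝔢 γ) ⟨$⟩ ε ≈ c * c * characterSum γ ε
  ρ-Z-𝔢 γ ε = ≈.trans (ρ-S² (𝔢 γ) ε) (≈.trans (ρ-matrix S (ρ S (𝔢 γ)) ε)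
    (≈.trans (ℂ-Sum.sum-cong-≋ λ k → ≈.trans (*-cong (ρ-S γ (element k)) (ρ-S (element k) ε))
        (solve 3 (λ c a b → c :* a :* (c :* b) := c :* c :* (a :* b)) ≈.refl
          c (pairing γ (element k)) (pairing (element k) ε)))
      (≈.sym (ℂ-Sum.*-distribˡ-sum (c * c) (λ k → character γ ε (element k))))))
    where open ℂ-Solver

  -- In the expansion of u over the basis, orthogonality leaves only the vector at -γ to contribute
  -- to the coordinate at γ.
  ρ-Z : ∀ u γ → ρ Z u ⟨$⟩ γ ≈ - 𝐢 * (u ⟨$⟩ neg γ)
  ρ-Z u γ = ≈.trans (ρ-matrix Z u γ) (≈.trans
    (sum-single (λ k → (u ⟨$⟩ element k) * (ρ Z (𝔢 (element k)) ⟨$⟩ γ)) i off)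
    (≈.trans (*-cong (Func.cong u (element-index (neg γ)))
        (≈.trans (ρ-Z-𝔢 (element i) γ) (≈.trans (*-cong ≈.refl (characterSum-∼ γ∼)) c²*order)))
      (*-comm (u ⟨$⟩ neg γ) (- 𝐢))))
    where
    i : Fin order
    i = index (neg γ)
    γ∼ : γ ∼ neg (element i)
    γ∼ = ∼-sym (∼-trans (neg-cong (element-index (neg γ))) (neg-involutive γ))
    off : ∀ k → k ≢ i → (u ⟨$⟩ element k) * (ρ Z (𝔢 (element k)) ⟨$⟩ γ) ≈ 0ℂ
    off k k≢i = ≈.trans (*-cong ≈.refl (≈.trans (ρ-Z-𝔢 (element k) γ)
        (≈.trans (*-cong ≈.refl (characterSum-≁ γ≁)) (ℂ-Ring.zeroʳ (c * c)))))
      (ℂ-Ring.zeroʳ (u ⟨$⟩ element k))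
      where
      γ≁ : ¬ γ ∼ neg (element k)
      γ≁ h = k≢i (sym (index-∼ (∼-sym (∼-trans (neg-cong h) (neg-involutive (element k))))))

-- Parity at weight 1/2

-- Take an index N from which the sequence varies by at most ε/2. If |x N| exceeded ε/2, then x
-- could not be 0; as this rational comparison is decidable, the doubly negated hypothesis forces |x
-- N| ≤ ε/2.
≈0-stable : ∀ {z} → ¬ ¬ (z ≈ 0ℂ) → z ≈ 0ℂ
≈0-stable {z} h = mk≈
  (stable λ k → h λ z≈0 → k (Re-≈ z≈0)) (stable λ k → h λ z≈0 → k (Im-≈ z≈0))
  where
  open +-*-Solver
  stable : ∀ {x} → ¬ ¬ (x ≈ʳ 0ʳ) → x ≈ʳ 0ʳ
  close (stable {x} h) ε 0<ε = N , λ n n≥ →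
    ℚ.≤-trans (subst (λ t → ∣ t ∣ ≤ℚ ∣ seq x n -ℚ seq x N ∣ +ℚ ∣ seq x N ∣)
        (solve 2 (λ a b → (a :- b) :+ b := a :- con 0ℚ) refl (seq x n) (seq x N))
        (ℚ.∣p+q∣≤∣p∣+∣q∣ (seq x n -ℚ seq x N) (seq x N)))
      (subst (∣ seq x n -ℚ seq x N ∣ +ℚ ∣ seq x N ∣ ≤ℚ_) (½+½ ε)
        (ℚ.+-mono-≤ (hN n N n≥ ℕ.≤-refl) small))
    where
    N : ℕ
    N = proj₁ (cauchy x (½ *ℚ ε) (0<* 0<½ 0<ε))
    hN : ∀ m n → N ℕ.≤ m → N ℕ.≤ n → ∣ seq x m -ℚ seq x n ∣ ≤ℚ ½ *ℚ ε
    hN = proj₂ (cauchy x (½ *ℚ ε) (0<* 0<½ 0<ε))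
    small : ∣ seq x N ∣ ≤ℚ ½ *ℚ ε
    small with ∣ seq x N ∣ ℚ.≤? ½ *ℚ ε
    ... | yes p = p
    ... | no p = contradiction x≉0 h
      where
      g : ℚ
      g = ∣ seq x N ∣ -ℚ ½ *ℚ ε
      0<g : 0ℚ <ℚ g
      0<g = <⇒0<- (ℚ.≰⇒> p)
      x≉0 : ¬ x ≈ʳ 0ʳ
      x≉0 x≈0 =
        let M , hM = close x≈0 (½ *ℚ g) (0<* 0<½ 0<g)
            n = N ⊔ M
        in ℚ.<-irrefl refl (ℚ.<-≤-trans
             (<-by (½ *ℚ g) (0<* 0<½ 0<g)
               (solve 2 (λ s ε → (con ½ :* ε :+ con ½ :* (s :- con ½ :* ε)) :+ con ½ :* (s :- con ½ :* ε) := s)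
                 refl (∣ seq x N ∣) ε))
             (ℚ.≤-trans
               (subst (λ t → ∣ t ∣ ≤ℚ ∣ seq x N -ℚ seq x n ∣ +ℚ ∣ seq x n -ℚ 0ℚ ∣)
                 (solve 2 (λ a b → (a :- b) :+ (b :- con 0ℚ) := a) refl (seq x N) (seq x n))
                 (ℚ.∣p+q∣≤∣p∣+∣q∣ (seq x N -ℚ seq x n) (seq x n -ℚ 0ℚ)))
               (ℚ.+-mono-≤ (hN N n ℕ.≤-refl (ℕ.m≤m⊔n N M)) (hM n (ℕ.m≤n⊔m N M)))))

≈neg⇒≈0 : ∀ {z} → z ≈ - z → z ≈ 0ℂ
≈neg⇒≈0 {z} h = ≈.trans
  (solve 1 (λ z → z := con ½ :* (z :+ z)) ≈.refl z)
  (≈.trans (*-cong ≈.refl (+-cong ≈.refl h))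
    (solve 1 (λ z → con ½ :* (z :+ :- z) := con 0ℚ) ≈.refl z))
  where open ℂ-Solver

≈-neg-sym : ∀ {z w} → z ≈ - w → w ≈ - z
≈-neg-sym {z} {w} h = ≈.trans (solve 1 (λ w → w := :- (:- w)) ≈.refl w) (-‿cong (≈.sym h))
  where open ℂ-Solver

neg-≉0 : ∀ {z w} → w ≈ - z → ¬ (z ≈ 0ℂ) → ¬ (w ≈ 0ℂ)
neg-≉0 {z} {w} w≈-z z≉0 w≈0 = z≉0 (≈.trans (≈-neg-sym w≈-z)
  (≈.trans (-‿cong w≈0) (pointwiseℂ (λ _ → refl) (λ _ → refl))))

module PrescriptionProperties {n : ℕ} (L : EvenLattice n) where
  open EvenLattice L using (⟪_,_⟫)
  open PairingProperties L
  open ReflectivePrescription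

  slot-positive : ∀ {μ m} → IsReflectiveSlot μ m → 0ℚ <ℚ m
  slot-positive {μ} {m} slot = ℚ.≰⇒> λ m≤0 → ℚ.<-irrefl refl (ℚ.<-≤-trans
    (subst (0ℚ <ℚ_) (sym m≡α²/2ℓ²) (IsRoot.positive root))
    (ℚ.≤-trans (ℚ.*-monoˡ-≤-nonNeg k {{ℚ.nonNegative (0≤+/ (2 ℕ.* ℓ ℕ.* ℓ) 1)}} m≤0)
      (ℚ.≤-reflexive (ℚ.*-zeroʳ k))))
    where
    open IsReflectiveSlot slot
    k : ℚ
    k = + (2 ℕ.* ℓ ℕ.* ℓ) / 1

  -- Being the principal part of a form constrains only m > 0. For all other m a prescription
  -- vanishes, because 2ℓ²m = α² > 0 on a reflective slot.
  nonPositive⇒a≈0 : ∀ P μ {m} → ¬ 0ℚ <ℚ m → a P μ m ≈ 0ℂ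
  nonPositive⇒a≈0 P μ {m} m≯0 = ≈0-stable λ a≉0 → m≯0 (slot-positive (slots P μ m a≉0))

  -- Oddness carries a nonzero coefficient at μ to a nonzero one at -μ, so both are slots. On
  -- two-torsion the two coincide, and the coefficient would equal its own negative.
  available⇒supported : ∀ P → AvailableAtWeight½ P → SupportedOnNonTorsionPairs P
  available⇒supported P odd μ m a≉0 = slots P μ m a≉0
    , slots P (neg μ) m (neg-≉0 (odd μ m) a≉0)
    , λ torsion → a≉0 (≈neg⇒≈0 (≈.trans
        (a-cong P m (∼-sym (twoTorsion⇒neg∼ {μ} torsion))) (odd μ m)))

  -- Whether a coefficient vanishes cannot be decided, so the sum of the two is shown to be 0 up to
  -- double negation: were it not 0, neither coefficient could be nonzero by antisymmetry, so both
  -- would vanish and so would the sum.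
  supported⇒available : ∀ P → SupportedOnNonTorsionPairs P → AntisymmetricOnNonTorsionPairs P →
    AvailableAtWeight½ P
  supported⇒available P supported antisymmetric μ m =
    ≈.trans (solve 2 (λ x y → y := (y :+ x) :- x) ≈.refl (a P μ m) (a P (neg μ) m))
      (≈.trans (+-cong a+a≈0 ≈.refl) (+-identityˡ (- a P μ m)))
    where
    open ℂ-Solver
    cancel : ∀ {x y} → y ≈ - x → y + x ≈ 0ℂ
    cancel {x} h = ≈.trans (+-cong h ≈.refl) (+-inverseˡ x)
    a+a≈0 : a P (neg μ) m + a P μ m ≈ 0ℂ
    a+a≈0 = ≈0-stable λ h →
      let aμ≈0 = ≈0-stable λ aμ≉0 → h (cancel (antisymmetric μ m (supported μ m aμ≉0)))
          a-μ≈0 = ≈0-stable λ a-μ≉0 → h (cancel (≈-neg-sym (≈.trans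
            (a-cong P m (∼-sym (neg-involutive μ)))
            (antisymmetric (neg μ) m (supported (neg μ) m a-μ≉0)))))
      in h (≈.trans (+-cong a-μ≈0 aμ≈0) (+-identityˡ 0ℂ))

module FormProperties (E : Exponential) {n : ℕ} (L : EvenLattice n)
  (W : ModularForms.WeilRepresentation E L) where
  open SeriesProperties E
  open PairingProperties L
  open PrescriptionProperties L
  open ModularForms E L
  open WeilRepresentation W using (ρ; ρ̄)
  open WeilProperties E L W using (ρ-Z)
  open WeaklyHolomorphicForm

  -- F = i ρ̄(Z) F and ρ̄(Z) 𝔢_γ = i 𝔢_{-γ}.
  component-odd : ∀ (f : WeightOneHalfForm W) γ τ → component f (neg γ) τ ≈ - component f γ τ
  component-odd f γ τ = ≈-neg-sym (≈.trans (modular f Z τ τ (Z-fixes τ) γ)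
    (≈.trans (*-cong ≈.refl (≈.trans (conj-cong (ρ-Z (conjugate (F f ⟨$⟩ τ)) γ))
        (≈.trans (conj-* (- 𝐢) (conj x)) (*-cong
          (pointwiseℂ {conj (- 𝐢)} {𝐢} (λ _ → refl) (λ _ → refl)) (conj-involutive x)))))
    (≈.trans (solve 2 (λ i x → i :* con 1ℚ :* (i :* x) := i :* i :* x) ≈.refl 𝐢 x)
    (≈.trans (*-cong 𝐢² ≈.refl) (solve 1 (λ x → :- con 1ℚ :* x := :- x) ≈.refl x)))))
    where
    open ℂ-Solver
    x : ℂ
    x = component f (neg γ) τ

  -- Since q(-γ) = q(γ), the components at γ and -γ are expanded over the same exponents. Their
  -- series add up to one that converges to 0 everywhere, and uniqueness applies; other exponents
  -- carry no coefficient at all.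
  coeff-odd : ∀ (f : WeightOneHalfForm W) γ r → coeff f (neg γ) r ≈ - coeff f γ r
  coeff-odd f γ r = byCases (integer? (r +ℚ q γ))
    where
    cancel : coeff f γ r + coeff f (neg γ) r ≈ 0ℂ → coeff f (neg γ) r ≈ - coeff f γ r
    cancel h = ≈.trans (solve 2 (λ x y → y := (x :+ y) :- x) ≈.refl (coeff f γ r) (coeff f (neg γ) r))
      (≈.trans (+-cong h ≈.refl) (+-identityˡ (- coeff f γ r)))
      where open ℂ-Solver
    integral-case : IsInteger (r +ℚ q γ) → ∃[ K ] r +ℚ + pole f / 1 ≤ℚ + K / 1 →
      coeff f γ r + coeff f (neg γ) r ≈ 0ℂ
    integral-case r∈ (K , r≤) = subst (λ s → coeff f γ s + coeff f (neg γ) s ≈ 0ℂ)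
      (solve 2 (λ r k → (r :- k) :+ k := r) refl r (+ K / 1))
      (qSeries-unique d r₀ sum→0 K)
      where
      open +-*-Solver
      r₀ : ℚ
      -- K ≥ r + pole puts the starting exponent at or below the pole bound, and r becomes the
      -- exponent with index K.
      r₀ = r -ℚ + K / 1
      r₀∈ : IsInteger (r₀ +ℚ q γ)
      r₀∈ = subst IsInteger (solve 3 (λ r k s → (r :+ s) :+ :- k := (r :- k) :+ s) refl r (+ K / 1) (q γ))
        (integer-+ {r +ℚ q γ} { -ℚ (+ K / 1)} r∈ (integer-neg {+ K / 1} (+ K , refl)))
      r₀≤ : r₀ ≤ℚ -ℚ (+ pole f / 1)
      r₀≤ = ≤-by (+ K / 1 -ℚ (r +ℚ + pole f / 1)) (≤⇒0≤- r≤)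
        (solve 3 (λ r k p → (r :- k) :+ (k :- (r :+ p)) := :- p) refl r (+ K / 1) (+ pole f / 1))
      d : ℕ → ℂ
      d k = coeff f γ (r₀ +ℚ + k / 1) + coeff f (neg γ) (r₀ +ℚ + k / 1)
      sum→0 : ∀ τ → Lim (partialSum (λ k → d k * e (ofℚ (r₀ +ℚ + k / 1) * point τ))) 0ℂ
      sum→0 τ = Lim-cong
        (λ m → ≈.trans (≈.sym (partialSum-+ (qTerm (coeff f γ) r₀ τ) (qTerm (coeff f (neg γ)) r₀ τ) m))
          (partialSum-cong (λ k → ≈.sym (*-distribʳ-+ (e (ofℚ (r₀ +ℚ + k / 1) * point τ))
            (coeff f γ (r₀ +ℚ + k / 1)) (coeff f (neg γ) (r₀ +ℚ + k / 1)))) m))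
        (≈.trans (+-cong ≈.refl (component-odd f γ τ)) (ℂ-Ring.-‿inverseʳ (component f γ τ)))
        (Lim-+ (⟶⇒Lim (expansion f γ r₀ r₀∈ r₀≤ τ))
          (⟶⇒Lim (expansion f (neg γ) r₀ (subst (λ s → IsInteger (r₀ +ℚ s)) (sym (q-neg γ)) r₀∈) r₀≤ τ)))
    byCases : Dec (IsInteger (r +ℚ q γ)) → coeff f (neg γ) r ≈ - coeff f γ r
    byCases (yes r∈) = cancel (integral-case r∈ (archimedean (r +ℚ + pole f / 1)))
    byCases (no r∉) = cancel (≈.trans (+-cong (exponents f γ r r∉)
      (exponents f (neg γ) r (r∉ ∘ subst (λ s → IsInteger (r +ℚ s)) (q-neg γ)))) (+-identityˡ 0ℂ))

  component-twoTorsion : ∀ (f : WeightOneHalfForm W) μ → IsTwoTorsion μ → ∀ τ → component f μ τ ≈ 0ℂ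
  component-twoTorsion f μ torsion τ = ≈neg⇒≈0 (≈.trans
    (Func.cong (F f ⟨$⟩ τ) (∼-sym (twoTorsion⇒neg∼ {μ} torsion))) (component-odd f μ τ))

  coeff-twoTorsion : ∀ (f : WeightOneHalfForm W) μ → IsTwoTorsion μ → ∀ r → coeff f μ r ≈ 0ℂ
  coeff-twoTorsion f μ torsion r = ≈neg⇒≈0 (≈.trans
    (coeff-cong f r (∼-sym (twoTorsion⇒neg∼ {μ} torsion))) (coeff-odd f μ r))

  principalPart⇒available : ∀ P (f : WeightOneHalfForm W) →
    _IsPrincipalPartOf_ W P f → AvailableAtWeight½ P
  principalPart⇒available P f principal μ m with 0ℚ ℚ.<? m
  ... | yes 0<m = ≈.trans (≈.sym (principal (neg μ) m 0<m))
        (≈.trans (coeff-odd f μ (-ℚ m)) (-‿cong (principal μ m 0<m)))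
  ... | no m≯0 = ≈.trans (nonPositive⇒a≈0 P (neg μ) m≯0)
        (≈-neg-sym (≈.trans (nonPositive⇒a≈0 P μ m≯0) (pointwiseℂ (λ _ → refl) (λ _ → refl))))

lemma9p1 :
    (E : Exponential) (L : EvenLattice 3) → HasSignature 2 1 L →
    let open Discriminant L
        open ModularForms E L
    in (W : WeilRepresentation) →
    let Form = WeightOneHalfForm W
        component = λ (f : Form) → WeaklyHolomorphicForm.component f
        coeff = λ (f : Form) → WeaklyHolomorphicForm.coeff f
    in
      -- oddness
      ((f : Form) (γ : Dual) (τ : ℍ) → component f (neg γ) τ ≈ - component f γ τ)
      -- (i)
    × ((f : Form) (μ : Dual) → IsTwoTorsion μ →
         ((τ : ℍ) → component f μ τ ≈ 0ℂ) × ((r : ℚ) → coeff f μ r ≈ 0ℂ))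
    × ((μ : Dual) (m : ℚ) → IsReflectiveSlot μ m → IsTwoTorsion μ →
         InvisibleAtWeight½ W μ m)
      -- (ii)
    × ((P : ReflectivePrescription) →
         ((f : Form) → _IsPrincipalPartOf_ W P f → AvailableAtWeight½ P)
         × (AvailableAtWeight½ P
              ⇔ (SupportedOnNonTorsionPairs P × AntisymmetricOnNonTorsionPairs P)))
lemma9p1 E L _ W =
    component-odd
  , (λ f μ torsion → component-twoTorsion f μ torsion , coeff-twoTorsion f μ torsion)
  , (λ μ m _ torsion f → coeff-twoTorsion f μ torsion (-ℚ m))
  , λ P → principalPart⇒available P , mk⇔
      (λ odd → available⇒supported P odd , λ μ m _ → odd μ m)
      (λ (supported , antisymmetric) → supported⇒available P supported antisymmetric)
  where
  open FormProperties E L W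
  open PrescriptionProperties L
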